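{- There is a randomized polynomial-time $O\left(n \cdot \left(\frac{\log \log n}{\log n}\right)^3\right)$-approximation algorithm for Maximum Balanced Biclique. That is, there are a constant $C > 0$ and a randomized algorithm, running in time polynomial in $n$, that on every input bipartite graph $G = (U, V, E)$ with $|U| = |V| = n \geq 3$ outputs, with high probability, a balanced biclique of $G$ of some size $s$ such that $\mathrm{OPT}(G) \leq C \cdot n \cdot \left(\frac{\log\log n}{\log n}\right)^3 \cdot s$, where $\mathrm{OPT}(G)$ is the maximum size of a balanced biclique in $G$.
   Context: $\log$ denotes the natural logarithm. For a bipartite graph $G = (U, V, E)$ with sides $U, V$ and $E \subseteq U \times V$, a balanced biclique of size $k$ (also called a $k$-biclique, or $K_{k,k}$) is a pair $S \subseteq U$, $T \subseteq V$ with $|S| = |T| = k$ and $S \times T \subseteq E$. The Maximum Balanced Biclique (MBB) problem is: given a bipartite graph $G = (U, V, E)$ with $|U| = |V| = n$, find a balanced biclique in $G$ of maximum size. "With high probability" means with probability $1 - o(1)$ as $n \to \infty$ over the algorithm's internal randomness, where $o(1)$ depends only on $n$. -}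

module Defs where

open import Data.Bool using (Bool; true; false; if_then_else_)
import Data.Bool.Properties as Bool
open import Data.Fin using (Fin; toℕ; fromℕ<; remQuot)
open import Data.Fin.Properties using (all?)
open import Data.Fin.Subset using (Subset; _∈_; ∣_∣)
open import Data.Fin.Subset.Properties using (_∈?_; anySubset?)
open import Data.Integer using (+_)
open import Data.List using (List; []; _∷_; filter; upTo; foldr)
import Data.List as List
open import Data.List.Extrema.Nat using (max)
open import Data.Nat using (ℕ; zero; suc; _≡ᵇ_; _≤_; _<?_)
  renaming (_+_ to _+ᴺ_; _∸_ to _∸ᴺ_; _*_ to _*ᴺ_; _^_ to _^ᴺ_; _≟_ to _≟ᴺ_)
open import Data.Nat.Properties using (m^n≢0)
open import Data.Product using (Σ-syntax; ∃-syntax; _×_; _,_; proj₁; uncurry)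
open import Data.Rational as ℚ using (ℚ; 0ℚ; 1ℚ)
import Data.Rational.Properties as ℚ
open import Data.Vec using (Vec; []; _∷_; tabulate; toList)
open import Function using (_∘_)
open import Relation.Binary.PropositionalEquality using (_≡_; _≢_)
open import Relation.Nullary using (Dec; yes; no)
open import Relation.Nullary.Decidable using (_×-dec_; _→-dec_)

------------------------------------------------------------------------
-- Bipartite graphs and balanced bicliques

-- Sides U = V = Fin n; E u v is the indicator of (u , v) ∈ E.
BipartiteGraph : ℕ → Set
BipartiteGraph n = Fin n → Fin n → Bool

IsBiclique : ∀ {n} → BipartiteGraph n → ℕ → Subset n → Subset n → Set
IsBiclique G k S T =
  ∣ S ∣ ≡ k × ∣ T ∣ ≡ k × (∀ u v → u ∈ S → v ∈ T → G u v ≡ true)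

HasBiclique : ∀ {n} → BipartiteGraph n → ℕ → Set
HasBiclique {n} G k = ∃[ S ] ∃[ T ] IsBiclique G k S T

isBiclique? : ∀ {n} (G : BipartiteGraph n) k S T → Dec (IsBiclique G k S T)
isBiclique? G k S T =
  (∣ S ∣ ≟ᴺ k) ×-dec ((∣ T ∣ ≟ᴺ k) ×-dec
    all? λ u → all? λ v →
      (u ∈? S) →-dec ((v ∈? T) →-dec (G u v Bool.≟ true)))

hasBiclique? : ∀ {n} (G : BipartiteGraph n) k → Dec (HasBiclique G k)
hasBiclique? G k = anySubset? λ S → anySubset? λ T → isBiclique? G k S T

-- No biclique is larger than n, and the empty biclique always exists.
OPT : ∀ {n} → BipartiteGraph n → ℕ
OPT {n} G = max 0 (filter (hasBiclique? G) (upTo (suc n)))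

------------------------------------------------------------------------
-- Randomized RAM programs
--
-- The memory consists of arrays of natural numbers, addressed by array
-- name and index; a program mentions only finitely many names, and cell 0
-- of an array serves as a scalar register. Arithmetic is restricted to
-- addition and truncated subtraction: in t unit-cost steps numbers then
-- only reach O(t) bits beyond those of the input, so unit-cost polynomial
-- time agrees with Turing-machine polynomial time. (This would fail if
-- multiplication were a unit-cost operation.)

Memory : Set
Memory = ℕ → ℕ → ℕ

infixl 6 _⊕_ _⊖_
infix  8 _!_

data Expr : Set where
  lit     : ℕ → Expr
  _!_     : ℕ → Expr → Expr
  _⊕_ _⊖_ : Expr → Expr → Expr

⟦_⟧ : Expr → Memory → ℕ
⟦ lit k ⟧ μ = k
⟦ a ! e ⟧ μ = μ a (⟦ e ⟧ μ)
⟦ e ⊕ f ⟧ μ = ⟦ e ⟧ μ +ᴺ ⟦ f ⟧ μ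
⟦ e ⊖ f ⟧ μ = ⟦ e ⟧ μ ∸ᴺ ⟦ f ⟧ μ

infix  5 _!_≔_ _!_≔coin
infixr 4 _⨾_

data Program : Set where
  skip      : Program
  _!_≔_     : ℕ → Expr → Expr → Program
  _!_≔coin  : ℕ → Expr → Program
  _⨾_       : Program → Program → Program
  cond      : Expr → Program → Program → Program
  while     : Expr → Program → Program

_[_,_↦_] : Memory → ℕ → ℕ → ℕ → Memory
(μ [ a , i ↦ x ]) b j with a ≟ᴺ b | i ≟ᴺ j
... | yes _ | yes _ = x
... | _     | _     = μ b j

bit : Bool → ℕ
bit b = if b then 1 else 0

-- A memory together with the coin flips not yet used.
State : Set
State = Memory × List Bool

-- P ∶ σ ⇓[ t ] σ′ : started in σ, the program P halts in σ′ after t steps.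
-- A nonzero value counts as true. Every assignment, coin flip and test
-- takes one step; expressions have constant size for a fixed program.
infix 3 _∶_⇓[_]_

data _∶_⇓[_]_ : Program → State → ℕ → State → Set where
  skip    : ∀ {σ} → skip ∶ σ ⇓[ 1 ] σ
  assign  : ∀ {a i e μ r} →
            a ! i ≔ e ∶ (μ , r) ⇓[ 1 ] (μ [ a , ⟦ i ⟧ μ ↦ ⟦ e ⟧ μ ] , r)
  coin    : ∀ {a i μ b r} →
            a ! i ≔coin ∶ (μ , b ∷ r) ⇓[ 1 ] (μ [ a , ⟦ i ⟧ μ ↦ bit b ] , r)
  seq     : ∀ {P Q σ σ′ σ″ s t} →
            P ∶ σ ⇓[ s ] σ′ → Q ∶ σ′ ⇓[ t ] σ″ →
            P ⨾ Q ∶ σ ⇓[ s +ᴺ t ] σ″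
  if-yes  : ∀ {e P Q σ σ′ t} → ⟦ e ⟧ (proj₁ σ) ≢ 0 →
            P ∶ σ ⇓[ t ] σ′ →
            cond e P Q ∶ σ ⇓[ suc t ] σ′
  if-no   : ∀ {e P Q σ σ′ t} → ⟦ e ⟧ (proj₁ σ) ≡ 0 →
            Q ∶ σ ⇓[ t ] σ′ →
            cond e P Q ∶ σ ⇓[ suc t ] σ′
  loop    : ∀ {e P σ σ′ σ″ s t} → ⟦ e ⟧ (proj₁ σ) ≢ 0 →
            P ∶ σ ⇓[ s ] σ′ → while e P ∶ σ′ ⇓[ t ] σ″ →
            while e P ∶ σ ⇓[ suc (s +ᴺ t) ] σ″
  done    : ∀ {e P σ} → ⟦ e ⟧ (proj₁ σ) ≡ 0 →
            while e P ∶ σ ⇓[ 1 ] σ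

-- Array 0 holds n in cell 0; array 1 holds the adjacency matrix row by
-- row, the entry (u , v) in cell u * n + v; everything else is 0.
input : ∀ {n} → BipartiteGraph n → Memory
input {n} G 0 0 = n
input {n} G 1 j with j <? n *ᴺ n
... | yes j<n² = bit (uncurry G (remQuot n (fromℕ< j<n²)))
... | no  _    = 0
input G _ _ = 0

-- Arrays 2 and 3 hold the indicators of the two output sets.
readSubset : ∀ n → ℕ → Memory → Subset n
readSubset n a μ = tabulate λ i → if μ a (toℕ i) ≡ᵇ 0 then false else true

outputU outputV : ∀ n → Memory → Subset n
outputU n = readSubset n 2
outputV n = readSubset n 3

-- Halting within T steps. As each coin flip costs one step, T coins are
-- enough for a run of at most T steps.
HaltsWithin : ∀ {n T} → Program → BipartiteGraph n → Vec Bool T → Set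
HaltsWithin {T = T} P G r =
  ∃[ t ] ∃[ σ ] t ≤ T × P ∶ (input G , toList r) ⇓[ t ] σ

-- On coins r, the program P halts with an output (S , T) satisfying Q.
Outputs : ∀ {n m} → Program → BipartiteGraph n → Vec Bool m →
          (Subset n → Subset n → Set) → Set
Outputs {n} P G r Q =
  ∃[ t ] ∃[ μ ] ∃[ r′ ] P ∶ (input G , toList r) ⇓[ t ] (μ , r′)
    × Q (outputU n μ) (outputV n μ)

------------------------------------------------------------------------
-- Probability over m independent fair coins

count : ∀ {m} → (Vec Bool m → Bool) → ℕ
count {zero}  E = bit (E [])
count {suc m} E = count (E ∘ (true ∷_)) +ᴺ count (E ∘ (false ∷_))

Pr : ∀ {m} → (Vec Bool m → Bool) → ℚ
Pr {m} E = (+ count E ℚ./ (2 ^ᴺ m)) {{m^n≢0 2 m}}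

-- Pr[ A ] ≥ p. The event A need not be decidable (below it involves an
-- inequality between reals), hence the decidable subevent E.
Pr[_]≥_ : ∀ {m} → (Vec Bool m → Set) → ℚ → Set
Pr[_]≥_ {m} A p =
  Σ[ E ∈ (Vec Bool m → Bool) ] (∀ r → E r ≡ true → A r) × p ℚ.≤ Pr E

IsVanishing : (ℕ → ℚ) → Set
IsVanishing δ = ∀ ε → 0ℚ ℚ.< ε → ∃[ N ] (∀ n → N ≤ n → ℚ.∣ δ n ∣ ℚ.≤ ε)

------------------------------------------------------------------------
-- Real numbers and the natural logarithm

-- A convergent sequence of rationals stands for its limit. Convergence is
-- not recorded in the type; all sequences formed in this development
-- converge, since log is only applied to reals > 1 and division is only by
-- nonzero reals.
Real : Set
Real = ℕ → ℚ

fromℚ : ℚ → Real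
fromℚ q _ = q

fromℕ : ℕ → Real
fromℕ k = fromℚ (+ k ℚ./ 1)

infixl 7 _*_ _/_ _÷_
infixr 8 _^_
infix  4 _≲_

-- The value at divisor 0 is a dummy.
_÷_ : ℚ → ℚ → ℚ
p ÷ q with q ℚ.≟ 0ℚ
... | yes _  = 0ℚ
... | no q≢0 = (p ℚ.÷ q) {{ℚ.≢-nonZero q≢0}}

_*_ _/_ : Real → Real → Real
(x * y) m = x m ℚ.* y m
(x / y) m = x m ÷ y m

_^_ : Real → ℕ → Real
x ^ zero  = fromℚ 1ℚ
x ^ suc k = x * x ^ k

-- lim x ≤ lim y
_≲_ : Real → Real → Set
x ≲ y = ∀ ε → 0ℚ ℚ.< ε → ∃[ N ] (∀ m → N ≤ m → x m ℚ.≤ y m ℚ.+ ε)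

-- Left Riemann sum, with M = suc m equal pieces, of log x = ∫₁ˣ dt / t :
--   Σ_{i<M} h / (1 + i h)  where h = (x - 1) / M.
-- It tends to log x locally uniformly on (0 , ∞), so (riemann m (x m))ₘ
-- tends to log (lim x) whenever lim x > 0.
step : ℕ → ℚ → ℚ
step m x = (x ℚ.- 1ℚ) ℚ.* (+ 1 ℚ./ suc m)

riemann : ℕ → ℚ → ℚ
riemann m x = foldr ℚ._+_ 0ℚ
  (List.map (λ i → step m x ÷ (1ℚ ℚ.+ (+ i ℚ./ 1) ℚ.* step m x)) (upTo (suc m)))

log : Real → Real
log x m = riemann m (x m)

------------------------------------------------------------------------
-- Approximation algorithms

-- (S , T) is a balanced biclique of some size s with OPT(G) ≤ ρ · s.
IsApproximateMBB : ∀ {n} → Real → BipartiteGraph n → Subset n → Subset n → Set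
IsApproximateMBB ρ G S T =
  ∃[ s ] IsBiclique G s S T × fromℕ (OPT G) ≲ ρ * fromℕ s

-- P runs in time c · n ^ d for every outcome of its coins, and with
-- probability at least 1 - δ n it finds a ρ n-approximate solution, on
-- every graph with n ≥ 3.
record RandomizedApproximation
         (P : Program) (c d : ℕ) (δ : ℕ → ℚ) (ρ : ℕ → Real) : Set where
  field
    running-time : ∀ n → 3 ≤ n → (G : BipartiteGraph n) →
                   (r : Vec Bool (c *ᴺ n ^ᴺ d)) → HaltsWithin P G r
    correctness  : ∀ n → 3 ≤ n → (G : BipartiteGraph n) →
                   Pr[ (λ (r : Vec Bool (c *ᴺ n ^ᴺ d)) →
                         Outputs P G r (IsApproximateMBB (ρ n) G)) ]≥
                   (1ℚ ℚ.- δ n)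

{-# OPTIONS --safe #-}

-- The algorithm tosses no coins. Let A × B be a biclique with m = OPT
-- vertices on either side, and write L, ℓ for rounded binary values of log n
-- and log log n. If m L³ = O(n ℓ³), a single edge is good enough. Otherwise
-- a biclique of size s = d E is sought, where E = ℓ j, j ≈ L / 64 ℓ, and d, j,
-- like all other parameters, are found by exhaustive enumeration.
--
-- Extraction: if at least 2 s vertices have fewer than 2 |W| / D
-- non-neighbours in W, where D = 16 d, then greedily choosing vertices with few
-- non-neighbours in the current subset of W costs a factor of at most
-- 1 - 1 / 2 d per choice, so s choices leave about |W| / 2^E ≥ s common
-- neighbours.
--
-- First phase: let Q be a block of q vertices of V meeting B in at least 2 s
-- vertices, and U the set of all vertices on the left. If extraction fails, a
-- vertex of B ∩ Q has many non-neighbours in U, and intersecting U with its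
-- neighbourhood preserves A ⊆ U but shrinks U by a factor 1 - Ω(1 / D). As there
-- are only q^j < n sequences of j vertices of Q, all of them can be tried, and
-- after j steps A is dense in U, hence also in U ∩ [e , e + q) =: P for some e.
--
-- Second phase: starting from V, intersect with the non-neighbourhoods of j
-- vertices of P. If extraction fails, then for at least g = (|P| - 2 s)^j of the
-- sequences the resulting set is large, and it is disjoint from B unless the
-- whole sequence avoids A, which happens for at most l = (|P| - |A ∩ P|)^j
-- sequences. Remove one vertex of each such set from V. By the density of A in
-- P, 2 n l ≤ m g, so n rounds of this would exhaust V while at least half of B
-- remains; hence extraction succeeds at some point.

module Submission where

-- The third power comes from the choice of d. Put k = n / m. Blocks of polylogarithmic size q allow
-- sequences of length j ~ log n / log log n to be enumerated. By Bernoulli's inequality, j steps of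
-- the first phase leave U with at most about 8 d n / j vertices, so A has density about j / 8 d k
-- in U. In the second phase each of the j steps multiplies the ratio g / l of useful to harmful
-- sequences by 1 + Ω(density), and this ratio has to reach 2 n / m, which is polylogarithmic. So j
-- times the density must be of order log log n, whence d ~ j ^ 2 / (k log log n), and s = d E ~ j ^
-- 3 / k, which is the required fraction of m.
--
-- As A and B are unknown, no step can check that it is on the right track. Every candidate pair is
-- therefore tested for being a biclique and only the best is kept. Soundness is then an invariant
-- independent of the parameters, and for the guarantee it is enough to exhibit one tuple of loop
-- values that leads to a large biclique.
--
-- The machine only adds and subtracts. Products, quotients and searches are written as sums over 0
-- , ... , n - 1, and the combinatorics is stated with the same sums.

open import Data.Bool using (Bool; true; false; _∧_; _∨_; not; if_then_else_)
open import Data.Bool.Properties using (T-≡; ∧-zeroʳ; ∧-assoc)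
open import Data.Empty using (⊥)
open import Data.Product using (∃-syntax; _×_; _,_; proj₁; proj₂; Σ-syntax; uncurry)
open import Data.Sum using (_⊎_; inj₁; inj₂)
open import Data.Unit using (⊤; tt)
open import Function using (_∘_; Equivalence; id)
open import Relation.Binary.PropositionalEquality
open import Relation.Nullary using (yes; no; contradiction; Dec; ¬_)

-- Finite sums and counting with indicator functions.

module Sums where

  open import Data.Nat
  open import Data.Nat.Properties
  open import Data.Nat.DivMod using ([m+kn]%n≡m%n; +-distrib-/; m<n⇒m%n≡m; m<n⇒m/n≡0; m*n/n≡m; m*n%n≡0)
  open import Defs using (bit)

  ∧-true : ∀ {a b} → a ∧ b ≡ true → a ≡ true × b ≡ true
  ∧-true {true} {true} _ = refl , refl

  ∧-intro : ∀ {a b} → a ≡ true → b ≡ true → a ∧ b ≡ true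
  ∧-intro refl refl = refl

  not-true : ∀ {a} → not a ≡ true → a ≡ false
  not-true {false} _ = refl

  false-or-true : ∀ a → a ≡ false ⊎ a ≡ true
  false-or-true false = inj₁ refl
  false-or-true true  = inj₂ refl

  ≤ᵇ-true : ∀ {m n} → (m ≤ᵇ n) ≡ true → m ≤ n
  ≤ᵇ-true {m} {n} eq = ≤ᵇ⇒≤ m n (Equivalence.from T-≡ eq)

  ≤ᵇ-false : ∀ {m n} → (m ≤ᵇ n) ≡ false → n < m
  ≤ᵇ-false {m} {n} eq with m ≤? n
  ... | no  m≰n = ≰⇒> m≰n
  ... | yes m≤n with () ← trans (sym (Equivalence.to T-≡ (≤⇒≤ᵇ m≤n))) eq

  true-≤ᵇ : ∀ {m n} → m ≤ n → (m ≤ᵇ n) ≡ true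
  true-≤ᵇ m≤n = Equivalence.to T-≡ (≤⇒≤ᵇ m≤n)

  false-≤ᵇ : ∀ {m n} → n < m → (m ≤ᵇ n) ≡ false
  false-≤ᵇ {m} {n} n<m with false-or-true (m ≤ᵇ n)
  ... | inj₁ eq = eq
  ... | inj₂ eq = contradiction (≤ᵇ-true eq) (<⇒≱ n<m)

  bit≤1 : ∀ b → bit b ≤ 1
  bit≤1 true  = ≤-refl
  bit≤1 false = z≤n

  bit-mono : ∀ {a b} → (a ≡ true → b ≡ true) → bit a ≤ bit b
  bit-mono {false} f = z≤n
  bit-mono {true}  f rewrite f refl = ≤-refl

  sum : ℕ → (ℕ → ℕ) → ℕ
  sum zero    f = 0
  sum (suc n) f = sum n f + f n

  sum-cong : ∀ n {f g} → (∀ i → i < n → f i ≡ g i) → sum n f ≡ sum n g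
  sum-cong zero    h = refl
  sum-cong (suc n) h = cong₂ _+_ (sum-cong n λ i i<n → h i (m<n⇒m<1+n i<n)) (h n (n<1+n n))

  sum-mono : ∀ n {f g} → (∀ i → i < n → f i ≤ g i) → sum n f ≤ sum n g
  sum-mono zero    h = z≤n
  sum-mono (suc n) h = +-mono-≤ (sum-mono n λ i i<n → h i (m<n⇒m<1+n i<n)) (h n (n<1+n n))

  interchange : ∀ a b c d → (a + b) + (c + d) ≡ (a + c) + (b + d)
  interchange a b c d = begin
    (a + b) + (c + d) ≡⟨ +-assoc a b (c + d) ⟩
    a + (b + (c + d)) ≡⟨ cong (a +_) (sym (+-assoc b c d)) ⟩
    a + ((b + c) + d) ≡⟨ cong (λ x → a + (x + d)) (+-comm b c) ⟩
    a + ((c + b) + d) ≡⟨ cong (a +_) (+-assoc c b d) ⟩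
    a + (c + (b + d)) ≡⟨ sym (+-assoc a c (b + d)) ⟩
    (a + c) + (b + d) ∎
    where open ≡-Reasoning

  sum-+ : ∀ n f g → sum n (λ i → f i + g i) ≡ sum n f + sum n g
  sum-+ zero    f g = refl
  sum-+ (suc n) f g rewrite sum-+ n f g = interchange (sum n f) (sum n g) (f n) (g n)

  sum-* : ∀ n c f → sum n (λ i → c * f i) ≡ c * sum n f
  sum-* zero    c f = sym (*-zeroʳ c)
  sum-* (suc n) c f rewrite sum-* n c f = sym (*-distribˡ-+ c (sum n f) (f n))

  sum-const : ∀ n c → sum n (λ _ → c) ≡ n * c
  sum-const zero    c = refl
  sum-const (suc n) c rewrite sum-const n c = +-comm (n * c) c

  sum-swap : ∀ m n (f : ℕ → ℕ → ℕ) → sum m (λ i → sum n (f i)) ≡ sum n (λ j → sum m (λ i → f i j))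
  sum-swap zero    n f = sym (trans (sum-const n 0) (*-zeroʳ n))
  sum-swap (suc m) n f rewrite sum-swap m n f = sym (sum-+ n (λ j → sum m (λ i → f i j)) (f m))

  sum-append : ∀ m n f → sum (m + n) f ≡ sum m f + sum n (λ i → f (m + i))
  sum-append m zero    f rewrite +-identityʳ m = sym (+-identityʳ (sum m f))
  sum-append m (suc n) f rewrite +-suc m n | sum-append m n f =
    +-assoc (sum m f) (sum n (λ i → f (m + i))) (f (m + n))

  sum-blocks : ∀ m q f → sum (m * q) f ≡ sum m (λ b → sum q (λ i → f (b * q + i)))
  sum-blocks zero    q f = refl
  sum-blocks (suc m) q f = begin
    sum (q + m * q) f                                   ≡⟨ cong (λ x → sum x f) (+-comm q (m * q)) ⟩
    sum (m * q + q) f                                   ≡⟨ sum-append (m * q) q f ⟩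
    sum (m * q) f + sum q (λ i → f (m * q + i))         ≡⟨ cong (_+ sum q (λ i → f (m * q + i))) (sum-blocks m q f) ⟩
    sum m (λ b → sum q (λ i → f (b * q + i))) + sum q (λ i → f (m * q + i)) ∎
    where open ≡-Reasoning

  term≤sum : ∀ n f {i} → i < n → f i ≤ sum n f
  term≤sum (suc n) f {i} i<1+n with m≤n⇒m<n∨m≡n (s≤s⁻¹ i<1+n)
  ... | inj₁ i<n  = ≤-trans (term≤sum n f i<n) (m≤m+n _ _)
  ... | inj₂ refl = m≤n+m (f n) _

  sum-<⇒∃ : ∀ n f g → sum n f < sum n g → ∃[ i ] (i < n × f i < g i)
  sum-<⇒∃ (suc n) f g lt with f n <? g n
  ... | yes fn<gn = n , n<1+n n , fn<gn
  ... | no  fn≮gn with sum-<⇒∃ n f g (+-cancelʳ-< (f n) _ _ (<-≤-trans lt (+-monoʳ-≤ (sum n g) (≮⇒≥ fn≮gn))))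
  ...   | i , i<n , h = i , m<n⇒m<1+n i<n , h

  # : ℕ → (ℕ → Bool) → ℕ
  # n p = sum n (bit ∘ p)

  #-cong : ∀ n {p q} → (∀ i → i < n → p i ≡ q i) → # n p ≡ # n q
  #-cong n h = sum-cong n λ i i<n → cong bit (h i i<n)

  #-mono : ∀ n {p q} → (∀ i → i < n → p i ≡ true → q i ≡ true) → # n p ≤ # n q
  #-mono n h = sum-mono n λ i i<n → bit-mono (h i i<n)

  #≤n : ∀ n p → # n p ≤ n
  #≤n n p = subst (# n p ≤_) (trans (sum-const n 1) (*-identityʳ n)) (sum-mono n λ i _ → bit≤1 (p i))

  #-all : ∀ n → # n (λ _ → true) ≡ n
  #-all n = trans (sum-const n 1) (*-identityʳ n)

  #-none : ∀ n → # n (λ _ → false) ≡ 0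
  #-none n = trans (sum-const n 0) (*-zeroʳ n)

  #-split : ∀ n (p q : ℕ → Bool) → # n p ≡ # n (λ i → p i ∧ q i) + # n (λ i → p i ∧ not (q i))
  #-split n p q = trans (sum-cong n λ i _ → lemma (p i) (q i)) (sum-+ n _ _)
    where
    lemma : ∀ a b → bit a ≡ bit (a ∧ b) + bit (a ∧ not b)
    lemma true  true  = refl
    lemma true  false = refl
    lemma false _     = refl

  #-∃ : ∀ n (p q : ℕ → Bool) → # n p < # n q → ∃[ i ] (i < n × p i ≡ false × q i ≡ true)
  #-∃ n p q lt with sum-<⇒∃ n _ _ lt
  ... | i , i<n , h = i , i<n , lemma (p i) (q i) h
    where
    lemma : ∀ a b → bit a < bit b → a ≡ false × b ≡ true
    lemma false true _ = refl , refl
    lemma true true (s≤s ())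

  #-pos : ∀ n (p : ℕ → Bool) → 0 < # n p → ∃[ i ] (i < n × p i ≡ true)
  #-pos n p lt with #-∃ n (λ _ → false) p (subst (_< # n p) (sym (#-none n)) lt)
  ... | i , i<n , _ , h = i , i<n , h

  #-single : ∀ n {i} → i < n → # n (λ k → (k ≤ᵇ i) ∧ (i ≤ᵇ k)) ≡ 1
  #-single (suc n) {i} i<1+n with m≤n⇒m<n∨m≡n (s≤s⁻¹ i<1+n)
  ... | inj₁ i<n rewrite #-single n i<n | false-≤ᵇ i<n = refl
  ... | inj₂ refl rewrite true-≤ᵇ (≤-refl {n}) =
    cong (_+ 1) (trans (#-cong n λ k k<n → trans (cong ((k ≤ᵇ n) ∧_) (false-≤ᵇ k<n)) (∧-zeroʳ _)) (#-none n))

  -- The least i < n with p i, or n if there is none, as a sum of indicators.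
  first : ℕ → (ℕ → Bool) → ℕ
  first n p = # n (λ i → # n (λ k → (k ≤ᵇ i) ∧ p k) ≤ᵇ 0)

  least : ∀ n (p : ℕ → Bool) → (∀ i → i < n → p i ≡ false) ⊎ ∃[ i ] (i < n × p i ≡ true × (∀ k → k < i → p k ≡ false))
  least zero    p = inj₁ λ i ()
  least (suc n) p with least n p
  ... | inj₂ (i , i<n , pi , h) = inj₂ (i , m<n⇒m<1+n i<n , pi , h)
  ... | inj₁ h with false-or-true (p n)
  ...   | inj₂ pn = inj₂ (n , n<1+n n , pn , h)
  ...   | inj₁ pn = inj₁ λ i i<1+n → case i (m≤n⇒m<n∨m≡n (s≤s⁻¹ i<1+n))
    where
    case : ∀ i → i < n ⊎ i ≡ n → p i ≡ false
    case i (inj₁ i<n)  = h i i<n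
    case i (inj₂ refl) = pn

  #-below : ∀ n {i} → i ≤ n → # n (λ k → not (i ≤ᵇ k)) ≡ i
  #-below zero    z≤n = refl
  #-below (suc n) {i} i≤1+n with m≤n⇒m<n∨m≡n i≤1+n
  ... | inj₁ i<1+n rewrite #-below n (s≤s⁻¹ i<1+n) | true-≤ᵇ (s≤s⁻¹ i<1+n) = +-identityʳ i
  ... | inj₂ refl rewrite false-≤ᵇ (n<1+n n) =
    trans (cong (_+ 1) (trans (#-cong n λ k k<n → cong not (false-≤ᵇ (m<n⇒m<1+n k<n))) (#-all n))) (+-comm n 1)

  -- If i is the least witness, the indicator at k is 1 exactly for k < i, so the sum is i.
  first-correct : ∀ n (p : ℕ → Bool) → (∃[ i ] (i < n × p i ≡ true)) → first n p < n × p (first n p) ≡ true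
  first-correct n p (i₁ , i₁<n , pi₁) with least n p
  ... | inj₁ h with () ← trans (sym pi₁) (h i₁ i₁<n)
  ... | inj₂ (i , i<n , pi , h) = subst (λ x → x < n × p x ≡ true) (sym eq) (i<n , pi)
    where
    below : ∀ k → (# n (λ k′ → (k′ ≤ᵇ k) ∧ p k′) ≤ᵇ 0) ≡ not (i ≤ᵇ k)
    below k with i ≤? k
    ... | yes i≤k rewrite true-≤ᵇ i≤k =
      false-≤ᵇ (≤-trans (≤-reflexive (cong bit (sym (∧-intro (true-≤ᵇ i≤k) pi)))) (term≤sum n _ i<n))
    ... | no i≰k rewrite false-≤ᵇ (≰⇒> i≰k) =
      true-≤ᵇ (≤-trans (#-mono n none) (≤-reflexive (#-none n)))
      where
      none : ∀ k′ → k′ < n → (k′ ≤ᵇ k) ∧ p k′ ≡ true → false ≡ true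
      none k′ _ eq with ∧-true eq
      ... | k′≤k , pk′ = trans (sym (h k′ (≤-<-trans (≤ᵇ-true k′≤k) (≰⇒> i≰k)))) pk′
    eq : first n p ≡ i
    eq = trans (#-cong n λ k _ → below k) (#-below n (<⇒≤ i<n))

  -- The default `n` is not a vertex and differs from every index below `n`, so that removing the
  -- vertex found has no effect in this case.
  first-none : ∀ n (p : ℕ → Bool) → (∀ i → i < n → p i ≡ false) → first n p ≡ n
  first-none n p h = trans (#-cong n λ k _ → true-≤ᵇ (≤-reflexive (trans
    (#-cong n λ k′ k′<n → trans (cong ((k′ ≤ᵇ k) ∧_) (h k′ k′<n)) (∧-zeroʳ _)) (#-none n)))) (#-all n)

  [bq+i]%q : ∀ b q i .{{_ : NonZero q}} → i < q → (b * q + i) % q ≡ i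
  [bq+i]%q b q i i<q = trans (cong (_% q) (+-comm (b * q) i)) (trans ([m+kn]%n≡m%n i b q) (m<n⇒m%n≡m i<q))

  [bq+i]/q : ∀ b q i .{{_ : NonZero q}} → i < q → (b * q + i) / q ≡ b
  [bq+i]/q b q i i<q = trans (+-distrib-/ (b * q) i lemma)
    (trans (cong₂ _+_ (m*n/n≡m b q) (m<n⇒m/n≡0 i<q)) (+-identityʳ b))
    where
    lemma : (b * q) % q + i % q < q
    lemma = subst (_< q) (sym (cong₂ _+_ (m*n%n≡0 b q) (m<n⇒m%n≡m i<q))) i<q

-- A language of sums and bounded loops, its cost and its compilation.

module Lang where

  open import Data.Fin using (Fin; zero; suc)
  open import Data.List using (List)
  open import Data.Nat hiding (_!)
  open import Data.Nat.Properties
  open import Data.Vec using (Vec; []; _∷_; lookup)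
  open import Defs using (Memory; Program; Expr; lit; _!_; _⊕_; _⊖_; skip; _!_≔_; _⨾_; cond; while; ⟦_⟧; _[_,_↦_]; _∶_⇓[_]_; assign; seq; if-yes; if-no; loop; done)
  open Sums

  infixl 6 _⊞_ _⊟_
  infix  5 _≼_
  infixr 4 _&_
  infix  8 ~_ _at_

  -- Terms over m bound variables, which range over 0 , … , n - 1.
  data Tm (m : ℕ) : Set
  data BT (m : ℕ) : Set

  data Tm m where
    num      : ℕ → Tm m
    var      : Fin m → Tm m
    _at_     : ℕ → Tm m → Tm m
    _⊞_ _⊟_  : Tm m → Tm m → Tm m
    Σ[_]     : Tm (suc m) → Tm m
    if_‵_‵_  : BT m → Tm m → Tm m → Tm m

  data BT m where
    nz   : Tm m → BT m
    _≼_  : Tm m → Tm m → BT m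
    _&_  : BT m → BT m → BT m
    ~_   : BT m → BT m

  nonzero : ℕ → Bool
  nonzero zero    = false
  nonzero (suc _) = true

  -- n is the range of summation.
  evalₙ  : ∀ {m} → ℕ → Tm m → Memory → Vec ℕ m → ℕ
  evalᵇₙ : ∀ {m} → ℕ → BT m → Memory → Vec ℕ m → Bool

  evalₙ n (num c)        μ ε = c
  evalₙ n (var x)        μ ε = lookup ε x
  evalₙ n (a at t)       μ ε = μ a (evalₙ n t μ ε)
  evalₙ n (t ⊞ u)        μ ε = evalₙ n t μ ε + evalₙ n u μ ε
  evalₙ n (t ⊟ u)        μ ε = evalₙ n t μ ε ∸ evalₙ n u μ ε
  evalₙ n Σ[ t ]         μ ε = sum n (λ i → evalₙ n t μ (i ∷ ε))
  evalₙ n (if b ‵ t ‵ u) μ ε = if evalᵇₙ n b μ ε then evalₙ n t μ ε else evalₙ n u μ ε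

  evalᵇₙ n (nz t)  μ ε = nonzero (evalₙ n t μ ε)
  evalᵇₙ n (t ≼ u) μ ε = evalₙ n t μ ε ≤ᵇ evalₙ n u μ ε
  evalᵇₙ n (a & b) μ ε = evalᵇₙ n a μ ε ∧ evalᵇₙ n b μ ε
  evalᵇₙ n (~ a)   μ ε = not (evalᵇₙ n a μ ε)

  eval : ∀ {m} → Tm m → Memory → Vec ℕ m → ℕ
  eval t μ ε = evalₙ (μ 0 0) t μ ε

  evalᵇ : ∀ {m} → BT m → Memory → Vec ℕ m → Bool
  evalᵇ b μ ε = evalᵇₙ (μ 0 0) b μ ε

  infix  3 _⟵_ _⟵ᵇ_
  infixr 2 _⨟_

  -- a ⟵ t sets the cells i < n of array a to t(i), simultaneously; for a c
  -- runs c with cell 0 of array a equal to 0 , … , n - 1.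
  data Cmd : Set where
    _⟵_  : ℕ → Tm 1 → Cmd
    _⨟_  : Cmd → Cmd → Cmd
    when : BT 0 → Cmd → Cmd
    for  : ℕ → Cmd → Cmd

  _⟵ᵇ_ : ℕ → BT 1 → Cmd
  a ⟵ᵇ b = a ⟵ (if b ‵ num 1 ‵ num 0)

  store : ℕ → (ℕ → ℕ) → Memory → Memory
  store a f μ b i = if a ≡ᵇ b then f i else μ b i

  set : ℕ → ℕ → Memory → Memory
  set a v μ = store a (λ i → if i ≡ᵇ 0 then v else μ a i) μ

  exec : Cmd → Memory → Memory
  iter : Cmd → ℕ → ℕ → ℕ → Memory → Memory

  exec (a ⟵ t)    μ = store a (λ i → if suc i ≤ᵇ μ 0 0 then eval t μ (i ∷ []) else μ a i) μ
  exec (c ⨟ d)    μ = exec d (exec c μ)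
  exec (when b c) μ = if evalᵇ b μ [] then exec c μ else μ
  exec (for a c)  μ = iter c a (μ 0 0) 0 (set a 0 μ)

  iter c a zero    i μ = μ
  iter c a (suc k) i μ = iter c a k (suc i) (set a (suc i) (exec c μ))

  when-true : ∀ b c μ → evalᵇ b μ [] ≡ true → exec c μ ≡ exec (when b c) μ
  when-true b c μ eq = cong (λ x → if x then exec c μ else μ) (sym eq)

  when-false : ∀ b c μ → evalᵇ b μ [] ≡ false → μ ≡ exec (when b c) μ
  when-false b c μ eq = cong (λ x → if x then exec c μ else μ) (sym eq)

  writes : ℕ → Cmd → Bool
  writes a (b ⟵ t)    = b ≡ᵇ a
  writes a (c ⨟ d)    = writes a c ∨ writes a d
  writes a (when b c) = writes a c
  writes a (for b c)  = (b ≡ᵇ a) ∨ writes a c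

  boundedᵗ : ∀ {m} → ℕ → Tm m → Bool
  boundedᵇ : ∀ {m} → ℕ → BT m → Bool

  boundedᵗ β (num c)        = true
  boundedᵗ β (var x)        = true
  boundedᵗ β (a at t)       = (suc a ≤ᵇ β) ∧ boundedᵗ β t
  boundedᵗ β (t ⊞ u)        = boundedᵗ β t ∧ boundedᵗ β u
  boundedᵗ β (t ⊟ u)        = boundedᵗ β t ∧ boundedᵗ β u
  boundedᵗ β Σ[ t ]         = boundedᵗ β t
  boundedᵗ β (if b ‵ t ‵ u) = boundedᵇ β b ∧ boundedᵗ β t ∧ boundedᵗ β u

  boundedᵇ β (nz t)  = boundedᵗ β t
  boundedᵇ β (t ≼ u) = boundedᵗ β t ∧ boundedᵗ β u
  boundedᵇ β (a & b) = boundedᵇ β a ∧ boundedᵇ β b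
  boundedᵇ β (~ a)   = boundedᵇ β a

  wellFormed : ℕ → Cmd → Bool
  wellFormed β (a ⟵ t)    = (1 ≤ᵇ a) ∧ (suc a ≤ᵇ β) ∧ boundedᵗ β t
  wellFormed β (c ⨟ d)    = wellFormed β c ∧ wellFormed β d
  wellFormed β (when b c) = boundedᵇ β b ∧ wellFormed β c
  wellFormed β (for a c)  = (1 ≤ᵇ a) ∧ (suc a ≤ᵇ β) ∧ not (writes a c) ∧ wellFormed β c

  ≡ᵇ-refl : ∀ n → (n ≡ᵇ n) ≡ true
  ≡ᵇ-refl zero    = refl
  ≡ᵇ-refl (suc n) = ≡ᵇ-refl n

  ≢⇒≡ᵇ : ∀ {m n} → m ≢ n → (m ≡ᵇ n) ≡ false
  ≢⇒≡ᵇ {zero}  {zero}  h = contradiction refl h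
  ≢⇒≡ᵇ {zero}  {suc n} h = refl
  ≢⇒≡ᵇ {suc m} {zero}  h = refl
  ≢⇒≡ᵇ {suc m} {suc n} h = ≢⇒≡ᵇ (λ eq → h (cong suc eq))

  ∨-false : ∀ {a b} → a ∨ b ≡ false → a ≡ false × b ≡ false
  ∨-false {false} {false} _ = refl , refl

  if-false : ∀ {b} {x y : ℕ} → b ≡ false → (if b then x else y) ≡ y
  if-false refl = refl

  if-true : ∀ {b} {x y : ℕ} → b ≡ true → (if b then x else y) ≡ x
  if-true refl = refl

  frame : ∀ c {a} → writes a c ≡ false → ∀ μ i → exec c μ a i ≡ μ a i
  frame-iter : ∀ c {a b} → writes a c ≡ false → (b ≡ᵇ a) ≡ false →
               ∀ k l μ i → iter c b k l μ a i ≡ μ a i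
  frame (b ⟵ t) w μ i = if-false w
  frame (c ⨟ d) w μ i with ∨-false {writes _ c} w
  ... | w₁ , w₂ = trans (frame d w₂ (exec c μ) i) (frame c w₁ μ i)
  frame (when b c) w μ i with evalᵇ b μ []
  ... | true  = frame c w μ i
  ... | false = refl
  frame (for b c) w μ i with ∨-false {b ≡ᵇ _} w
  ... | w₁ , w₂ = trans (frame-iter c w₂ w₁ (μ 0 0) 0 (set b 0 μ) i) (if-false w₁)
  frame-iter c w e zero    l μ i = refl
  frame-iter c w e (suc k) l μ i = trans (frame-iter c w e k (suc l) _ i)
    (trans (if-false e) (frame c w μ i))

  set-0 : ∀ a v μ → set a v μ a 0 ≡ v
  set-0 a v μ rewrite ≡ᵇ-refl a = refl

  -- The invariant refers to the memory in which the counter has already been advanced, so that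
  -- `I n` describes the memory after the loop. Since the body writes neither the counter nor array
  -- 0, there are n rounds and the counter is the number of the round.
  for-ind : ∀ {a c} → writes a c ≡ false → writes 0 c ≡ false → (a ≡ᵇ 0) ≡ false →
            (I : ℕ → Memory → Set) → ∀ {n} μ → μ 0 0 ≡ n → I 0 (set a 0 μ) →
            (∀ i μ → i < n → μ 0 0 ≡ n → μ a 0 ≡ i → I i μ → I (suc i) (set a (suc i) (exec c μ))) →
            I n (exec (for a c) μ)
  for-ind {a} {c} wa w0 a0 I {n} μ n≡ I₀ step rewrite n≡ =
    go n 0 (set a 0 μ) refl (trans (if-false a0) n≡) (set-0 a 0 μ) I₀
    where
    go : ∀ k i μ → i + k ≡ n → μ 0 0 ≡ n → μ a 0 ≡ i → I i μ → I n (iter c a k i μ)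
    go zero    i μ eq _  _  Ii rewrite +-identityʳ i = subst (λ x → I x μ) eq Ii
    go (suc k) i μ eq e₀ eᵢ Ii = go k (suc i) _ (trans (sym (+-suc i k)) eq)
      (trans (if-false a0) (trans (frame c w0 μ 0) e₀)) (set-0 a (suc i) (exec c μ))
      (step i μ (≤-trans (≤-reflexive (sym (+-comm i 1))) (≤-trans (+-monoʳ-≤ i (s≤s z≤n)) (≤-reflexive eq))) e₀ eᵢ Ii)

  Poly : (ℕ → ℕ) → Set
  Poly f = ∃[ K ] ∃[ D ] (∀ n → 1 ≤ n → f n ≤ K * n ^ D)

  poly-const : ∀ c → Poly (λ _ → c)
  poly-const c = c , 0 , λ n _ → ≤-reflexive (sym (*-identityʳ c))

  poly-id : Poly (λ n → n)
  poly-id = 1 , 1 , λ n _ → ≤-reflexive (trans (sym (*-identityʳ n)) (sym (*-identityˡ (n * 1))))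

  n^-monoʳ : ∀ n → 1 ≤ n → ∀ {d e} → d ≤ e → n ^ d ≤ n ^ e
  n^-monoʳ (suc n) _ = ^-monoʳ-≤ (suc n)

  -- The sum of the exponents serves as an upper bound for both of them, as n ≥ 1.
  poly-+ : ∀ {f g} → Poly f → Poly g → Poly (λ n → f n + g n)
  poly-+ {f} {g} (K , D , p) (L , E , q) = K + L , D + E , bound
    where
    open ≤-Reasoning
    bound : ∀ n → 1 ≤ n → f n + g n ≤ (K + L) * n ^ (D + E)
    bound n 1≤n = begin
      f n + g n                         ≤⟨ +-mono-≤ (p n 1≤n) (q n 1≤n) ⟩
      K * n ^ D + L * n ^ E             ≤⟨ +-mono-≤ (*-monoʳ-≤ K (n^-monoʳ n 1≤n (m≤m+n D E)))
                                                    (*-monoʳ-≤ L (n^-monoʳ n 1≤n (m≤n+m E D))) ⟩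
      K * n ^ (D + E) + L * n ^ (D + E) ≡⟨ sym (*-distribʳ-+ (n ^ (D + E)) K L) ⟩
      (K + L) * n ^ (D + E)             ∎

  poly-* : ∀ {f g} → Poly f → Poly g → Poly (λ n → f n * g n)
  poly-* {f} {g} (K , D , p) (L , E , q) = K * L , D + E , bound
    where
    open ≤-Reasoning
    bound : ∀ n → 1 ≤ n → f n * g n ≤ (K * L) * n ^ (D + E)
    bound n 1≤n = begin
      f n * g n                   ≤⟨ *-mono-≤ (p n 1≤n) (q n 1≤n) ⟩
      (K * n ^ D) * (L * n ^ E)   ≡⟨ [m*n]*[o*p]≡[m*o]*[n*p] K (n ^ D) L (n ^ E) ⟩
      (K * L) * (n ^ D * n ^ E)   ≡⟨ cong (K * L *_) (sym (^-distribˡ-+-* n D E)) ⟩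
      (K * L) * n ^ (D + E)       ∎

  -- The clauses mirror the compiled code. A loop over a body of cost T costs n * (T + 2) + 1: each
  -- round adds a test and an increment, and the last test fails. A conditional is charged for both
  -- branches. All ranges being n, the result is a polynomial in n.
  costᵗ : ∀ {m} → Tm m → ℕ → ℕ
  costᵇ : ∀ {m} → BT m → ℕ → ℕ

  costᵗ (num c)        n = 1
  costᵗ (var x)        n = 1
  costᵗ (a at t)       n = costᵗ t n + 1
  costᵗ (t ⊞ u)        n = costᵗ t n + (costᵗ u n + 1)
  costᵗ (t ⊟ u)        n = costᵗ t n + (costᵗ u n + 1)
  costᵗ Σ[ t ]         n = 1 + (1 + (n * ((costᵗ t n + 1) + 2) + 1))
  costᵗ (if b ‵ t ‵ u) n = costᵇ b n + suc (costᵗ t n + costᵗ u n)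

  costᵇ (nz t)  n = costᵗ t n + 2
  costᵇ (t ≼ u) n = costᵗ t n + (costᵗ u n + 2)
  costᵇ (a & b) n = costᵇ a n + suc (costᵇ b n + 1)
  costᵇ (~ a)   n = costᵇ a n + 1

  costᶜ : Cmd → ℕ → ℕ
  costᶜ (a ⟵ t)    n = 1 + ((n * ((costᵗ t n + 1) + 2) + 1) + (1 + (n * (1 + 2) + 1)))
  costᶜ (c ⨟ d)    n = costᶜ c n + costᶜ d n
  costᶜ (when b c) n = costᵇ b n + suc (costᶜ c n + 1)
  costᶜ (for a c)  n = 1 + (n * (costᶜ c n + 2) + 1)

  polyᵗ : ∀ {m} (t : Tm m) → Poly (costᵗ t)
  polyᵇ : ∀ {m} (b : BT m) → Poly (costᵇ b)
  polyᵗ (num c)        = poly-const 1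
  polyᵗ (var x)        = poly-const 1
  polyᵗ (a at t)       = poly-+ (polyᵗ t) (poly-const 1)
  polyᵗ (t ⊞ u)        = poly-+ (polyᵗ t) (poly-+ (polyᵗ u) (poly-const 1))
  polyᵗ (t ⊟ u)        = poly-+ (polyᵗ t) (poly-+ (polyᵗ u) (poly-const 1))
  polyᵗ Σ[ t ]         = poly-+ (poly-const 1) (poly-+ (poly-const 1) (poly-+ (poly-* poly-id
                           (poly-+ (poly-+ (polyᵗ t) (poly-const 1)) (poly-const 2))) (poly-const 1)))
  polyᵗ (if b ‵ t ‵ u) = poly-+ (polyᵇ b) (poly-+ (poly-const 1) (poly-+ (polyᵗ t) (polyᵗ u)))
  polyᵇ (nz t)  = poly-+ (polyᵗ t) (poly-const 2)
  polyᵇ (t ≼ u) = poly-+ (polyᵗ t) (poly-+ (polyᵗ u) (poly-const 2))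
  polyᵇ (a & b) = poly-+ (polyᵇ a) (poly-+ (poly-const 1) (poly-+ (polyᵇ b) (poly-const 1)))
  polyᵇ (~ a)   = poly-+ (polyᵇ a) (poly-const 1)

  polyᶜ : ∀ c → Poly (costᶜ c)
  polyᶜ (a ⟵ t)    = poly-+ (poly-const 1) (poly-+ (poly-+ (poly-* poly-id
                       (poly-+ (poly-+ (polyᵗ t) (poly-const 1)) (poly-const 2))) (poly-const 1))
                       (poly-+ (poly-const 1) (poly-+ (poly-* poly-id (poly-const 3)) (poly-const 1))))
  polyᶜ (c ⨟ d)    = poly-+ (polyᶜ c) (polyᶜ d)
  polyᶜ (when b c) = poly-+ (polyᵇ b) (poly-+ (poly-const 1) (poly-+ (polyᶜ c) (poly-const 1)))
  polyᶜ (for a c)  = poly-+ (poly-const 1) (poly-+ (poly-* poly-id (poly-+ (polyᶜ c) (poly-const 2))) (poly-const 1))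

  -- The value of a term is left in cell 0 of array k; the arrays
  -- from k on are scratch space, and ρ lists the arrays that hold the values
  -- of the bound variables.

  reg : ℕ → Expr
  reg a = a ! lit 0

  -- Truncated subtraction serves as the test that the counter is below n.
  countUp : ℕ → Program → Program
  countUp a P = while (reg 0 ⊖ reg a) (P ⨾ (a ! lit 0 ≔ (reg a ⊕ lit 1)))

  compileᵗ : ∀ {m} → ℕ → Tm m → Vec ℕ m → Program
  compileᵇ : ∀ {m} → ℕ → BT m → Vec ℕ m → Program

  compileᵗ k (num c)        ρ = k ! lit 0 ≔ lit c
  compileᵗ k (var x)        ρ = k ! lit 0 ≔ reg (lookup ρ x)
  compileᵗ k (a at t)       ρ = compileᵗ k t ρ ⨾ (k ! lit 0 ≔ a ! reg k)
  compileᵗ k (t ⊞ u)        ρ = compileᵗ k t ρ ⨾ compileᵗ (suc k) u ρ ⨾ (k ! lit 0 ≔ (reg k ⊕ reg (suc k)))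
  compileᵗ k (t ⊟ u)        ρ = compileᵗ k t ρ ⨾ compileᵗ (suc k) u ρ ⨾ (k ! lit 0 ≔ (reg k ⊖ reg (suc k)))
  compileᵗ k Σ[ t ]         ρ = (k ! lit 0 ≔ lit 0) ⨾ (suc k ! lit 0 ≔ lit 0) ⨾
    countUp (suc k) (compileᵗ (2 + k) t (suc k ∷ ρ) ⨾ (k ! lit 0 ≔ (reg k ⊕ reg (2 + k))))
  compileᵗ k (if b ‵ t ‵ u) ρ = compileᵇ k b ρ ⨾ cond (reg k) (compileᵗ k t ρ) (compileᵗ k u ρ)

  compileᵇ k (nz t)  ρ = compileᵗ k t ρ ⨾ cond (reg k) (k ! lit 0 ≔ lit 1) (k ! lit 0 ≔ lit 0)
  compileᵇ k (t ≼ u) ρ = compileᵗ k t ρ ⨾ compileᵗ (suc k) u ρ ⨾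
    cond (reg k ⊖ reg (suc k)) (k ! lit 0 ≔ lit 0) (k ! lit 0 ≔ lit 1)
  compileᵇ k (a & b) ρ = compileᵇ k a ρ ⨾ cond (reg k) (compileᵇ k b ρ) skip
  compileᵇ k (~ a)   ρ = compileᵇ k a ρ ⨾ (k ! lit 0 ≔ (lit 1 ⊖ reg k))

  compile : ℕ → Cmd → Program
  -- All values are first collected in a scratch array and copied afterwards, because `t` may read
  -- the array `a` that it is about to change.
  compile β (a ⟵ t) = (β ! lit 0 ≔ lit 0) ⨾
    countUp β (compileᵗ (2 + β) t (β ∷ []) ⨾ (suc β ! reg β ≔ reg (2 + β))) ⨾
    (β ! lit 0 ≔ lit 0) ⨾ countUp β (a ! reg β ≔ suc β ! reg β)
  compile β (c ⨟ d)    = compile β c ⨾ compile β d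
  compile β (when b c) = compileᵇ β b [] ⨾ cond (reg β) (compile β c) skip
  compile β (for a c)  = (a ! lit 0 ≔ lit 0) ⨾ countUp a (compile β c)

  -- The coins `r` are the same before and after, which expresses that the run tosses none.
  Runs : Program → Memory → List Bool → ℕ → (Memory → Set) → Set
  Runs P μ r T Q = ∃[ t ] ∃[ μ′ ] t ≤ T × P ∶ (μ , r) ⇓[ t ] (μ′ , r) × Q μ′

  Agree : ℕ → Memory → Memory → Set
  Agree k μ ν = ∀ a → a < k → ∀ i → μ a i ≡ ν a i

  agree-trans : ∀ {k μ ν ξ} → Agree k μ ν → Agree k ν ξ → Agree k μ ξ
  agree-trans f g a a<k i = trans (f a a<k i) (g a a<k i)

  agree-≤ : ∀ {k l μ ν} → k ≤ l → Agree l μ ν → Agree k μ ν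
  agree-≤ k≤l f a a<k = f a (<-≤-trans a<k k≤l)

  upd-same : ∀ μ a i x → (μ [ a , i ↦ x ]) a i ≡ x
  upd-same μ a i x with a ≟ a | i ≟ i
  ... | yes _ | yes _ = refl
  ... | no a≢a | _     = contradiction refl a≢a
  ... | yes _  | no i≢i = contradiction refl i≢i

  upd-array : ∀ μ {a b} i x j → a ≢ b → (μ [ a , i ↦ x ]) b j ≡ μ b j
  upd-array μ {a} {b} i x j a≢b with a ≟ b | i ≟ j
  ... | yes refl | _     = contradiction refl a≢b
  ... | no _     | yes _ = refl
  ... | no _     | no _  = refl

  upd-cell : ∀ μ a {i j} x → i ≢ j → (μ [ a , i ↦ x ]) a j ≡ μ a j
  upd-cell μ a {i} {j} x i≢j with a ≟ a | i ≟ j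
  ... | _     | yes refl = contradiction refl i≢j
  ... | yes _ | no _     = refl
  ... | no _  | no _     = refl

  agree-upd : ∀ {k a} μ i x → k ≤ a → Agree k μ (μ [ a , i ↦ x ])
  agree-upd {a = a} μ i x k≤a b b<k j = sym (upd-array μ {a} {b} i x j (λ { refl → <⇒≱ b<k k≤a }))

  runs-seq : ∀ {P Q μ r S T A B} → Runs P μ r S A → (∀ {ν} → A ν → Runs Q ν r T B) → Runs (P ⨾ Q) μ r (S + T) B
  runs-seq (s , ν , s≤S , p , a) k with k a
  ... | t , ξ , t≤T , q , b = s + t , ξ , +-mono-≤ s≤S t≤T , seq p q , b

  runs-assign : ∀ {a i e μ r B} → B (μ [ a , ⟦ i ⟧ μ ↦ ⟦ e ⟧ μ ]) → Runs (a ! i ≔ e) μ r 1 B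
  runs-assign b = 1 , _ , ≤-refl , assign , b

  runs-skip : ∀ {μ r B} → B μ → Runs skip μ r 1 B
  runs-skip b = 1 , _ , ≤-refl , skip , b

  runs-weaken : ∀ {P μ r S T} {A B : Memory → Set} → S ≤ T → (∀ {ν} → A ν → B ν) → Runs P μ r S A → Runs P μ r T B
  runs-weaken S≤T f (s , ν , s≤S , p , a) = s , ν , ≤-trans s≤S S≤T , p , f a

  runs-cond : ∀ {e P Q μ r T B} → (⟦ e ⟧ μ ≢ 0 → Runs P μ r T B) → (⟦ e ⟧ μ ≡ 0 → Runs Q μ r T B) →
              Runs (cond e P Q) μ r (suc T) B
  runs-cond {e} {μ = μ} f g with ⟦ e ⟧ μ ≟ 0
  ... | yes e≡0 with g e≡0
  ...   | t , ν , t≤T , q , b = suc t , ν , s≤s t≤T , if-no e≡0 q , b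
  runs-cond {e} {μ = μ} f g | no e≢0 with f e≢0
  ...   | t , ν , t≤T , q , b = suc t , ν , s≤s t≤T , if-yes e≢0 q , b

  runs-countUp : ∀ {a P n T} (I : ℕ → Memory → Set) →
                 (∀ i μ → I i μ → μ a 0 ≡ i × μ 0 0 ≡ n) →
                 (∀ i μ r → i < n → I i μ → Runs P μ r T (λ ν → ν a 0 ≡ i × I (suc i) (ν [ a , 0 ↦ suc i ]))) →
                 ∀ k i μ r → i + k ≡ n → I i μ → Runs (countUp a P) μ r (k * (T + 2) + 1) (I n)
  runs-countUp {a} {n = n} I reads body zero i μ r eq Ii =
    1 , μ , ≤-refl , done test , subst (λ x → I x μ) i≡n Ii
    where
    i≡n : i ≡ n
    i≡n = trans (sym (+-identityʳ i)) eq
    test : μ 0 0 ∸ μ a 0 ≡ 0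
    test with reads i μ Ii
    ... | e₁ , e₂ rewrite e₁ | e₂ | i≡n = n∸n≡0 n
  runs-countUp {a} {P} {n} {T} I reads body (suc k) i μ r eq Ii with body i μ r i<n Ii
    where
    i<n : i < n
    i<n = subst (i <_) eq (m<m+n i (s≤s z≤n))
  ... | s , ν , s≤T , p , (e , Is) with runs-countUp {a} {P} {n} {T} I reads body k (suc i) (ν [ a , 0 ↦ suc i ]) r (trans (sym (+-suc i k)) eq) Is
  ...   | t , ξ , t≤ , q , In = suc ((s + 1) + t) , ξ , time , loop test
            (seq p (subst (λ x → (a ! lit 0 ≔ (reg a ⊕ lit 1)) ∶ (ν , r) ⇓[ 1 ] (ν [ a , 0 ↦ x ] , r)) inc assign)) q , In
    where
    inc : ν a 0 + 1 ≡ suc i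
    inc = trans (cong (_+ 1) e) (+-comm i 1)
    test : μ 0 0 ∸ μ a 0 ≢ 0
    test h with reads i μ Ii
    ... | e₁ , e₂ = <⇒≱ (subst (i <_) eq (m<m+n i (s≤s z≤n))) (m∸n≡0⇒m≤n (trans (sym (cong₂ _∸_ e₂ e₁)) h))
    open ≤-Reasoning
    time : suc ((s + 1) + t) ≤ suc k * (T + 2) + 1
    time = begin
      suc ((s + 1) + t)                 ≤⟨ s≤s (+-mono-≤ (+-monoˡ-≤ 1 s≤T) t≤) ⟩
      suc ((T + 1) + (k * (T + 2) + 1)) ≡⟨ cong suc (sym (+-assoc (T + 1) (k * (T + 2)) 1)) ⟩
      suc (T + 1) + k * (T + 2) + 1     ≡⟨ cong (λ x → x + k * (T + 2) + 1) (sym (+-suc T 1)) ⟩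
      suc k * (T + 2) + 1               ∎

-- Correctness and running time of compiled commands.

module Compile where

  open import Data.Fin using (zero; suc)
  open import Data.Nat hiding (_!)
  open import Data.Nat.Properties
  open import Data.Vec using (Vec; []; _∷_; lookup)
  open import Defs using (bit; Memory; lit; _!_; _⊕_; _!_≔_; _⨾_; ⟦_⟧; _[_,_↦_])
  open Sums
  open Lang

  nonzero-true : ∀ {n} → n ≢ 0 → nonzero n ≡ true
  nonzero-true {zero}  h = contradiction refl h
  nonzero-true {suc n} h = refl

  nonzero-false : ∀ {n} → n ≡ 0 → nonzero n ≡ false
  nonzero-false refl = refl

  bit≢0 : ∀ {b} → bit b ≢ 0 → b ≡ true
  bit≢0 {true}  _ = refl
  bit≢0 {false} h = contradiction refl h

  bit≡0 : ∀ {b} → bit b ≡ 0 → b ≡ false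
  bit≡0 {false} _ = refl

  module Correct (β : ℕ) (1≤β : 1 ≤ β) (μ : Memory) where

    -- The condition for entering compiled code at level k: the arrays of the source program and the
    -- registers of the bound variables all lie below the scratch space, and they still agree with
    -- the reference memory `μ` and the environment `ε`.
    record Ready {m} (k : ℕ) (ρ ε : Vec ℕ m) (ν : Memory) : Set where
      constructor ready
      field
        β≤k    : β ≤ k
        ρ<k    : ∀ x → lookup ρ x < k
        agree  : Agree β μ ν
        values : ∀ x → ν (lookup ρ x) 0 ≡ lookup ε x
    open Ready

    transfer : ∀ {m k} {ρ ε : Vec ℕ m} {ν ξ} → Ready k ρ ε ν → Agree k ν ξ → Ready k ρ ε ξ
    transfer R A = ready (β≤k R) (ρ<k R) (agree-trans (agree R) (agree-≤ (β≤k R) A))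
      λ x → trans (sym (A _ (ρ<k R x) 0)) (values R x)

    raise : ∀ {m k} {ρ ε : Vec ℕ m} {ν} → Ready k ρ ε ν → Ready (suc k) ρ ε ν
    raise R = ready (m≤n⇒m≤1+n (β≤k R)) (λ x → m<n⇒m<1+n (ρ<k R x)) (agree R) (values R)

    size : ∀ {m k} {ρ ε : Vec ℕ m} {ν} → Ready k ρ ε ν → ν 0 0 ≡ μ 0 0
    size R = sym (agree R 0 1≤β 0)

    Post : ℕ → Memory → ℕ → Memory → Set
    Post k ν v ξ = Agree k ν ξ × ξ k 0 ≡ v

    runs-set : ∀ {k ν ξ r e v} → Agree k ν ξ → ⟦ e ⟧ ξ ≡ v → Runs (k ! lit 0 ≔ e) ξ r 1 (Post k ν v)
    runs-set {k} {ξ = ξ} A eq = runs-assign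
      (agree-trans A (agree-upd ξ 0 _ ≤-refl) , trans (upd-same ξ k 0 _) eq)

    correctᵗ : ∀ {m k} (t : Tm m) {ρ ε ν} r → boundedᵗ β t ≡ true → Ready k ρ ε ν →
               Runs (compileᵗ k t ρ) ν r (costᵗ t (μ 0 0)) (Post k ν (eval t μ ε))
    correctᵇ : ∀ {m k} (b : BT m) {ρ ε ν} r → boundedᵇ β b ≡ true → Ready k ρ ε ν →
               Runs (compileᵇ k b ρ) ν r (costᵇ b (μ 0 0)) (Post k ν (bit (evalᵇ b μ ε)))
    -- The value of `t` survives in array k while `u` is evaluated, since that evaluation only
    -- writes arrays from `suc k` on.
    correct₂ : ∀ {m k P T v} (t u : Tm m) {ρ ε ν} r → boundedᵗ β t ∧ boundedᵗ β u ≡ true → Ready k ρ ε ν →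
               (∀ {ξ} → Agree k ν ξ → ξ k 0 ≡ eval t μ ε → ξ (suc k) 0 ≡ eval u μ ε → Runs P ξ r T (Post k ν v)) →
               Runs (compileᵗ k t ρ ⨾ compileᵗ (suc k) u ρ ⨾ P) ν r
                    (costᵗ t (μ 0 0) + (costᵗ u (μ 0 0) + T)) (Post k ν v)

    correct₂ {k = k} t u r b R last with ∧-true b
    ... | bt , bu = runs-seq (correctᵗ t r bt R) λ (A , e) →
      runs-seq (correctᵗ u r bu (raise (transfer R A))) λ (A′ , e′) →
      last (agree-trans A (agree-≤ (n≤1+n k) A′)) (trans (sym (A′ k ≤-refl 0)) e) e′

    correctᵗ (num c) r b R = runs-set (λ _ _ _ → refl) refl
    correctᵗ (var x) r b R = runs-set (λ _ _ _ → refl) (values R x)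
    correctᵗ (a at t) r b R with ∧-true b
    ... | a<β , bt = runs-seq (correctᵗ t r bt R) λ {ξ} (A , e) →
      runs-set A (trans (cong (ξ a) e) (sym (agree (transfer R A) a (≤ᵇ-true a<β) _)))
    correctᵗ (t ⊞ u) r b R = correct₂ t u r b R λ A e e′ → runs-set A (cong₂ _+_ e e′)
    correctᵗ (t ⊟ u) r b R = correct₂ t u r b R λ A e e′ → runs-set A (cong₂ _∸_ e e′)
    correctᵗ {k = k} Σ[ t ] {ρ} {ε} {ν} r b R =
      runs-seq (runs-set (λ _ _ _ → refl) refl) λ {ν₁} (A₁ , e₁) →
      runs-seq (runs-assign {B = I 0} (agree-trans A₁ (agree-upd ν₁ 0 0 (n≤1+n k)) ,
                trans (upd-array ν₁ 0 0 0 (1+n≢n {k})) e₁ , upd-same ν₁ (suc k) 0 0))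
      λ {ν₂} (A₂ , e₂ , e₃) →
      runs-weaken ≤-refl (λ (A , e , _) → A , e)
        (runs-countUp I reads body (μ 0 0) 0 ν₂ r refl (A₂ , e₂ , e₃))
      where
      f : ℕ → ℕ
      f i = eval t μ (i ∷ ε)
      I : ℕ → Memory → Set
      I i ξ = Agree k ν ξ × ξ k 0 ≡ sum i f × ξ (suc k) 0 ≡ i
      reads : ∀ i ξ → I i ξ → ξ (suc k) 0 ≡ i × ξ 0 0 ≡ μ 0 0
      reads i ξ (A , _ , e) = e , size (transfer R A)
      body : ∀ i ξ r → i < μ 0 0 → I i ξ →
             Runs (compileᵗ (2 + k) t (suc k ∷ ρ) ⨾ (k ! lit 0 ≔ (reg k ⊕ reg (2 + k)))) ξ r
                  (costᵗ t (μ 0 0) + 1) (λ ξ → ξ (suc k) 0 ≡ i × I (suc i) (ξ [ suc k , 0 ↦ suc i ]))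
      body i ξ r i<n (A , e , e′) =
        runs-seq (correctᵗ t r b (ready (m≤n⇒m≤1+n (m≤n⇒m≤1+n (β≤k R))) ρ′< (agree (transfer R A)) values′))
        λ {ζ} (B , v) → runs-assign
          ( trans (upd-array ζ {k} 0 _ 0 (λ q → 1+n≢n (sym q))) (trans (sym (B (suc k) (n<1+n _) 0)) e′)
          , agree-trans A (agree-trans (agree-≤ (m≤n⇒m≤1+n (n≤1+n k)) B)
              (agree-trans (agree-upd ζ 0 _ ≤-refl) (agree-upd _ 0 _ (n≤1+n k))))
          , trans (upd-array _ 0 _ 0 (1+n≢n {k})) (trans (upd-same ζ k 0 _)
              (cong₂ _+_ (trans (sym (B k (m<n⇒m<1+n (n<1+n k)) 0)) e) v))
          , upd-same _ (suc k) 0 _ )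
        where
        ρ′< : ∀ x → lookup (suc k ∷ ρ) x < 2 + k
        ρ′< zero    = ≤-refl
        ρ′< (suc x) = m<n⇒m<1+n (m<n⇒m<1+n (ρ<k R x))
        values′ : ∀ x → ξ (lookup (suc k ∷ ρ) x) 0 ≡ lookup (i ∷ ε) x
        values′ zero    = e′
        values′ (suc x) = values (transfer R A) x
    correctᵗ (if b ‵ t ‵ u) {ε = ε} r w R with ∧-true {boundedᵇ β b} w
    ... | wb , w′ with ∧-true {boundedᵗ β t} w′
    ...   | wt , wu = runs-seq (correctᵇ b r wb R) λ {ξ} (A , e) → runs-cond
      (λ h → runs-weaken (m≤m+n _ _) (λ (B , e′) → agree-trans A B ,
        trans e′ (sym (if-true (bit≢0 (λ h′ → h (trans e h′))))))
        (correctᵗ t r wt (transfer R A)))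
      (λ h → runs-weaken (m≤n+m _ _) (λ (B , e′) → agree-trans A B ,
        trans e′ (sym (if-false (bit≡0 (trans (sym e) h)))))
        (correctᵗ u r wu (transfer R A)))

    correctᵇ (nz t) r b R = runs-seq (correctᵗ t r b R) λ (A , e) → runs-cond
      (λ h → runs-set A (sym (cong bit (nonzero-true (λ h′ → h (trans e h′))))))
      (λ h → runs-set A (sym (cong bit (nonzero-false (trans (sym e) h)))))
    correctᵇ (t ≼ u) {ε = ε} r b R = correct₂ t u r b R λ A e e′ → runs-cond
      (λ h → runs-set A (sym (cong bit (false-≤ᵇ {eval t μ ε} (≰⇒> λ t≤u → h (trans (cong₂ _∸_ e e′) (m≤n⇒m∸n≡0 t≤u)))))))
      (λ h → runs-set A (sym (cong bit (true-≤ᵇ {eval t μ ε} (m∸n≡0⇒m≤n (trans (sym (cong₂ _∸_ e e′)) h))))))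
    correctᵇ (a & b) {ε = ε} r w R with ∧-true {boundedᵇ β a} w
    ... | wa , wb = runs-seq (correctᵇ a r wa R) λ {ξ} (A , e) → runs-cond
      (λ h → runs-weaken (m≤m+n _ 1) (λ (B , e′) → agree-trans A B ,
        trans e′ (cong bit (cong (_∧ evalᵇ b μ ε) (sym (bit≢0 (λ h′ → h (trans e h′)))))))
        (correctᵇ b r wb (transfer R A)))
      (λ h → runs-weaken (m≤n+m 1 _) (λ B → B)
        (runs-skip (A , trans h (cong bit (cong (_∧ evalᵇ b μ ε) (sym (bit≡0 (trans (sym e) h))))))))
    correctᵇ (~ a) {ε = ε} r w R = runs-seq (correctᵇ a r w R) λ {ξ} (A , e) →
      runs-set A (trans (cong (1 ∸_) e) (lemma (evalᵇ a μ ε)))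
      where
      lemma : ∀ b → 1 ∸ bit b ≡ bit (not b)
      lemma true  = refl
      lemma false = refl

  open Correct

  start : ∀ {β μ ν} → Agree β μ ν → (1≤β : 1 ≤ β) → Ready β 1≤β μ β [] [] ν
  start A 1≤β = ready ≤-refl (λ ()) A (λ ())

  agree-set : ∀ {β μ ν} a v → Agree β μ ν → Agree β (set a v μ) (ν [ a , 0 ↦ v ])
  agree-set {β} {μ} {ν} a v A b b<β i = go (a ≟ b) (i ≟ 0)
    where
    go : Dec (a ≡ b) → Dec (i ≡ 0) → set a v μ b i ≡ (ν [ a , 0 ↦ v ]) b i
    go (no a≢b)   _          = trans (if-false (≢⇒≡ᵇ a≢b)) (trans (A b b<β i) (sym (upd-array ν 0 v i a≢b)))
    go (yes refl) (yes refl) = trans (set-0 a v μ) (sym (upd-same ν a 0 v))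
    go (yes refl) (no i≢0)   = trans (if-true (≡ᵇ-refl a)) (trans (if-false (≢⇒≡ᵇ i≢0))
      (trans (A a b<β i) (sym (upd-cell ν a v (λ e → i≢0 (sym e))))))

  -- Hence n, and with it every loop range and every cost bound, stays the same throughout a run.
  no-write-0 : ∀ {β} c → wellFormed β c ≡ true → writes 0 c ≡ false
  no-write-0 (zero ⟵ t) ()
  no-write-0 (suc a ⟵ t) w = refl
  no-write-0 {β} (c ⨟ d) w with ∧-true {wellFormed β c} w
  ... | wc , wd rewrite no-write-0 c wc = no-write-0 d wd
  no-write-0 {β} (when b c) w with ∧-true {boundedᵇ β b} w
  ... | _ , wc = no-write-0 c wc
  no-write-0 (for zero c) ()
  no-write-0 {β} (for (suc a) c) w with ∧-true {suc (suc a) ≤ᵇ β} w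
  ... | _ , w′ with ∧-true {not (writes (suc a) c)} w′
  ...   | _ , wc = no-write-0 c wc

  correct : ∀ {β} (1≤β : 1 ≤ β) c → wellFormed β c ≡ true → ∀ μ ν r → Agree β μ ν →
            Runs (compile β c) ν r (costᶜ c (μ 0 0)) (Agree β (exec c μ))
  correct {β} 1≤β (a ⟵ t) w μ ν r A with ∧-true {1 ≤ᵇ a} w
  ... | 1≤a , w′ with ∧-true {suc a ≤ᵇ β} w′
  ...   | a<β , wt =
    runs-seq (runs-assign (agree-trans A (agree-upd ν 0 0 ≤-refl) , upd-same ν β 0 0 , λ l ())) λ {ν₁} I₁ →
    runs-seq (runs-countUp I reads body n 0 ν₁ r refl I₁) λ {ν₂} (A₂ , _ , T₂) →
    runs-seq (runs-assign ((λ b b<β i → trans (if≡ b i) (trans (A₂ b b<β i) (sym (upd-array ν₂ {β} 0 0 i (λ { refl → <-irrefl refl b<β }))))) ,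
      upd-same ν₂ β 0 0 , λ l l<n → trans (upd-array ν₂ {β} 0 0 l (λ e → 1+n≢n (sym e))) (T₂ l l<n))) λ {ν₃} I₃ →
    runs-weaken ≤-refl (λ (B , _) b b<β i → trans (final b i) (B b b<β i)) (runs-countUp I′ readsJ bodyJ n 0 ν₃ r refl I₃)
    where
    n : ℕ
    n = μ 0 0
    f : ℕ → ℕ
    f i = eval t μ (i ∷ [])
    I : ℕ → Memory → Set
    I i ξ = Agree β μ ξ × ξ β 0 ≡ i × (∀ l → l < i → ξ (suc β) l ≡ f l)
    reads : ∀ i ξ → I i ξ → ξ β 0 ≡ i × ξ 0 0 ≡ n
    reads i ξ (B , e , _) = e , sym (B 0 1≤β 0)
    body : ∀ i ξ r → i < n → I i ξ →
           Runs (compileᵗ (2 + β) t (β ∷ []) ⨾ (suc β ! reg β ≔ reg (2 + β))) ξ r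
                (costᵗ t n + 1) (λ ζ → ζ β 0 ≡ i × I (suc i) (ζ [ β , 0 ↦ suc i ]))
    body i ξ r i<n (B , e , T) =
      runs-seq (correctᵗ β 1≤β μ t r wt (ready (m≤n⇒m≤1+n (n≤1+n β)) (λ { zero → n≤1+n (suc β) }) B (λ { zero → e })))
      λ {ζ} (C , v) → runs-assign (lemma ζ C v)
      where
      lemma : ∀ ζ → Agree (2 + β) ξ ζ → ζ (2 + β) 0 ≡ f i →
              let ω = ζ [ suc β , ζ β 0 ↦ ζ (2 + β) 0 ] in ω β 0 ≡ i × I (suc i) (ω [ β , 0 ↦ suc i ])
      lemma ζ C v rewrite trans (sym (C β (m<n⇒m<1+n (n<1+n β)) 0)) e =
        trans (upd-array ζ i _ 0 (1+n≢n {β})) (trans (sym (C β (m<n⇒m<1+n (n<1+n β)) 0)) e) ,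
        agree-trans B (agree-trans (agree-≤ (m≤n⇒m≤1+n (n≤1+n β)) C)
          (agree-trans (agree-upd ζ i _ (n≤1+n β)) (agree-upd _ 0 _ ≤-refl))) ,
        upd-same _ β 0 _ ,
        λ l l<1+i → trans (upd-array _ {β} 0 _ l (λ q → 1+n≢n (sym q))) (new l l<1+i)
        where
        new : ∀ l → l < suc i → (ζ [ suc β , i ↦ ζ (2 + β) 0 ]) (suc β) l ≡ f l
        new l l<1+i = go (i ≟ l)
          where
          go : Dec (i ≡ l) → (ζ [ suc β , i ↦ ζ (2 + β) 0 ]) (suc β) l ≡ f l
          go (yes refl) = trans (upd-same ζ (suc β) i _) v
          go (no i≢l)   = trans (upd-cell ζ (suc β) _ i≢l) (trans (sym (C (suc β) ≤-refl l))
                            (T l (≤∧≢⇒< (s≤s⁻¹ l<1+i) (λ e → i≢l (sym e)))))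
    -- `g i` is the intended memory once the first i cells of `a` have been copied; `g 0` agrees
    -- with `μ`, and `g n` with the result of the assignment.
    g : ℕ → Memory
    g i = store a (λ l → if suc l ≤ᵇ i then f l else μ a l) μ
    I′ : ℕ → Memory → Set
    I′ i ξ = Agree β (g i) ξ × ξ β 0 ≡ i × (∀ l → l < n → ξ (suc β) l ≡ f l)
    g0 : ∀ {i} → (a ≡ᵇ 0) ≡ false → g i 0 0 ≡ n
    g0 = if-false
    a≢0 : (a ≡ᵇ 0) ≡ false
    a≢0 = ≢⇒≡ᵇ {a} {0} λ e → <⇒≱ (≤ᵇ-true 1≤a) (≤-reflexive e)
    if≡ : ∀ b i → g 0 b i ≡ μ b i
    if≡ b i with false-or-true (a ≡ᵇ b)
    ... | inj₁ e = if-false e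
    ... | inj₂ e rewrite e = cong (λ x → μ x i) (≡ᵇ⇒≡ a b (Equivalence.from T-≡ e))
    final : ∀ b i → exec (a ⟵ t) μ b i ≡ g n b i
    final b i = refl
    readsJ : ∀ i ξ → I′ i ξ → ξ β 0 ≡ i × ξ 0 0 ≡ n
    readsJ i ξ (B , e , _) = e , trans (sym (B 0 1≤β 0)) (g0 {i} a≢0)
    bodyJ : ∀ i ξ r → i < n → I′ i ξ → Runs (a ! reg β ≔ suc β ! reg β) ξ r 1
            (λ ζ → ζ β 0 ≡ i × I′ (suc i) (ζ [ β , 0 ↦ suc i ]))
    bodyJ i ξ r i<n (B , e , T) = runs-assign lemma
      where
      a<β′ : a < β
      a<β′ = ≤ᵇ-true a<β
      a≢β : a ≢ β
      a≢β refl = <-irrefl refl a<β′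
      a≢1+β : a ≢ suc β
      a≢1+β refl = <⇒≱ a<β′ (n≤1+n β)
      lemma : let ω = ξ [ a , ξ β 0 ↦ ξ (suc β) (ξ β 0) ] in ω β 0 ≡ i × I′ (suc i) (ω [ β , 0 ↦ suc i ])
      lemma rewrite e =
        trans (upd-array ξ i _ 0 a≢β) e ,
        (λ b b<β l → trans (new b b<β l) (sym (upd-array _ {β} 0 _ l (λ { refl → <-irrefl refl b<β })))) ,
        upd-same _ β 0 _ ,
        λ l l<n → trans (upd-array _ {β} 0 _ l (λ q → 1+n≢n (sym q))) (trans (upd-array ξ i _ l a≢1+β) (T l l<n))
        where
        new : ∀ b → b < β → ∀ l → g (suc i) b l ≡ (ξ [ a , i ↦ ξ (suc β) i ]) b l
        new b b<β l = go (a ≟ b) (i ≟ l)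
          where
          same : i ≢ l → (if suc l ≤ᵇ suc i then f l else μ a l) ≡ (if suc l ≤ᵇ i then f l else μ a l)
          same i≢l with l <? i
          ... | yes l<i = trans (if-true (true-≤ᵇ (m<n⇒m<1+n l<i))) (sym (if-true (true-≤ᵇ l<i)))
          ... | no  l≮i = trans (if-false (false-≤ᵇ (s≤s (≤∧≢⇒< (≮⇒≥ l≮i) i≢l)))) (sym (if-false (false-≤ᵇ (s≤s (≮⇒≥ l≮i)))))
          go : Dec (a ≡ b) → Dec (i ≡ l) → g (suc i) b l ≡ (ξ [ a , i ↦ ξ (suc β) i ]) b l
          go (no a≢b) _ = trans (if-false (≢⇒≡ᵇ a≢b)) (trans (sym (if-false (≢⇒≡ᵇ a≢b)))
            (trans (B b b<β l) (sym (upd-array ξ i _ l a≢b))))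
          go (yes refl) (yes refl) = trans (if-true (≡ᵇ-refl a)) (trans (if-true (true-≤ᵇ (≤-refl {suc i})))
            (trans (sym (T i i<n)) (sym (upd-same ξ a i _))))
          go (yes refl) (no i≢l) = trans (if-true (≡ᵇ-refl a)) (trans (same i≢l)
            (trans (sym (if-true (≡ᵇ-refl a))) (trans (B a b<β l) (sym (upd-cell ξ a _ i≢l)))))
  correct 1≤β (c ⨟ d) w μ ν r A with ∧-true {wellFormed _ c} w
  ... | wc , wd = runs-seq (correct 1≤β c wc μ ν r A) λ {ξ} B →
    runs-weaken (≤-reflexive (cong (costᶜ d) (frame c (no-write-0 c wc) μ 0))) (λ C → C) (correct 1≤β d wd _ ξ r B)
  correct {β} 1≤β (when b c) w μ ν r A with ∧-true {boundedᵇ β b} w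
  ... | wb , wc = runs-seq (correctᵇ β 1≤β μ b r wb (start A 1≤β)) λ {ξ} (B , e) → runs-cond
    (λ h → runs-weaken (m≤m+n _ 1)
       (λ {ζ} C → subst (λ x → Agree β (if x then exec c μ else μ) ζ) (sym (bit≢0 (λ h′ → h (trans e h′)))) C)
       (correct 1≤β c wc μ ξ r (agree-trans A B)))
    (λ h → runs-weaken (m≤n+m 1 _) (λ C → C)
       (runs-skip (subst (λ x → Agree β (if x then exec c μ else μ) ξ) (sym (bit≡0 (trans (sym e) h))) (agree-trans A B))))
  correct {β} 1≤β (for a c) w μ ν r A with ∧-true {1 ≤ᵇ a} w
  ... | 1≤a , w′ with ∧-true {suc a ≤ᵇ β} w′
  ...   | a<β , w″ with ∧-true {not (writes a c)} w″
  ...     | wac , wc =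
    runs-seq (runs-assign (agree-set a 0 A , upd-same ν a 0 0)) λ {ν₁} I₀ →
    runs-weaken ≤-refl (λ {ζ} (B , _) → subst (λ ω → Agree β ω ζ) (sym (unroll n 0)) B)
      (runs-countUp I reads body n 0 ν₁ r refl I₀)
    where
    n : ℕ
    n = μ 0 0
    trace : ℕ → Memory
    trace zero    = set a 0 μ
    trace (suc i) = set a (suc i) (exec c (trace i))
    a≢0 : (a ≡ᵇ 0) ≡ false
    a≢0 = ≢⇒≡ᵇ {a} {0} λ e → <⇒≱ (≤ᵇ-true 1≤a) (≤-reflexive e)
    unroll : ∀ k i → iter c a k i (trace i) ≡ trace (i + k)
    unroll zero    i = cong trace (sym (+-identityʳ i))
    unroll (suc k) i = trans (unroll k (suc i)) (cong trace (sym (+-suc i k)))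
    trace-0 : ∀ i → trace i 0 0 ≡ n
    trace-0 zero    = if-false a≢0
    trace-0 (suc i) = trans (if-false a≢0) (trans (frame c (no-write-0 c wc) (trace i) 0) (trace-0 i))
    trace-a : ∀ i → trace i a 0 ≡ i
    trace-a zero    = set-0 a 0 μ
    trace-a (suc i) = set-0 a (suc i) (exec c (trace i))
    I : ℕ → Memory → Set
    I i ξ = Agree β (trace i) ξ × ξ a 0 ≡ i
    reads : ∀ i ξ → I i ξ → ξ a 0 ≡ i × ξ 0 0 ≡ n
    reads i ξ (B , e) = e , trans (sym (B 0 1≤β 0)) (trace-0 i)
    body : ∀ i ξ r → i < n → I i ξ → Runs (compile β c) ξ r (costᶜ c n) (λ ζ → ζ a 0 ≡ i × I (suc i) (ζ [ a , 0 ↦ suc i ]))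
    body i ξ r i<n (B , e) =
      runs-weaken (≤-reflexive (cong (costᶜ c) (trace-0 i)))
        (λ {ζ} C → trans (sym (C a (≤ᵇ-true a<β) 0)) (trans (frame c (not-true wac) (trace i) 0) (trace-a i)) ,
                   agree-set a (suc i) C , upd-same ζ a 0 _)
        (correct 1≤β c wc (trace i) ξ r B)

-- Extracting a biclique from many vertices with few non-neighbours.

module Extraction where

  open import Data.Nat
  open import Data.Nat.Properties
  open import Data.Nat.Tactic.RingSolver using (solve-∀)
  open import Defs using (bit)
  open Sums

  *-^ : ∀ j x y → (x * y) ^ j ≡ x ^ j * y ^ j
  *-^ zero    x y = refl
  *-^ (suc j) x y = trans (cong (x * y *_) (*-^ j x y)) ([m*n]*[o*p]≡[m*o]*[n*p] x y (x ^ j) (y ^ j))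

  -- Bernoulli's inequality 1 + j / x ≤ (1 + 1 / x) ^ j, cleared of denominators.
  bernoulli : ∀ x j → x ^ j * (x + j) ≤ suc x ^ j * x
  bernoulli x zero    = ≤-reflexive (cong (1 *_) (+-identityʳ x))
  bernoulli x (suc j) = begin
    x * x ^ j * (x + suc j)                     ≡⟨ lemma x (x ^ j) j ⟩
    x * (x ^ j * (x + j)) + x ^ j * x           ≤⟨ +-monoʳ-≤ (x * (x ^ j * (x + j))) (*-monoʳ-≤ (x ^ j) (m≤m+n x j)) ⟩
    x * (x ^ j * (x + j)) + x ^ j * (x + j)     ≡⟨ +-comm (x * (x ^ j * (x + j))) _ ⟩
    suc x * (x ^ j * (x + j))                   ≤⟨ *-monoʳ-≤ (suc x) (bernoulli x j) ⟩
    suc x * (suc x ^ j * x)                     ≡⟨ sym (*-assoc (suc x) (suc x ^ j) x) ⟩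
    suc x * suc x ^ j * x                       ∎
    where
    open ≤-Reasoning
    lemma : ∀ x p j → x * p * (x + suc j) ≡ x * (p * (x + j)) + p * x
    lemma = solve-∀

  doubling : ∀ x → 1 ≤ x → 2 * x ^ x ≤ suc x ^ x
  doubling x@(suc _) _ = *-cancelʳ-≤ (2 * x ^ x) (suc x ^ x) x (begin
    2 * x ^ x * x       ≡⟨ lemma x (x ^ x) ⟩
    x ^ x * (x + x)     ≤⟨ bernoulli x x ⟩
    suc x ^ x * x       ∎)
    where
    open ≤-Reasoning
    lemma : ∀ x p → 2 * p * x ≡ p * (x + x)
    lemma = solve-∀

  -- Bernoulli's inequality 1 - d / (y + 1) ≤ (1 - 1 / (y + 1)) ^ d, with the negative term moved to
  -- the other side.
  bernoulli′ : ∀ y d → suc y * suc y ^ d ≤ y ^ d * suc y + d * suc y ^ d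
  bernoulli′ y zero    = ≤-reflexive (lemma y)
    where
    lemma : ∀ y → suc y * 1 ≡ 1 * suc y + 0
    lemma = solve-∀
  bernoulli′ y (suc d) = begin
    suc y * (suc y * suc y ^ d)                                       ≤⟨ *-monoʳ-≤ (suc y) (bernoulli′ y d) ⟩
    suc y * (y ^ d * suc y + d * suc y ^ d)                           ≡⟨ lemma y (y ^ d) (suc y ^ d) d ⟩
    y * y ^ d * suc y + (d * (suc y * suc y ^ d) + suc y * y ^ d)     ≤⟨ +-monoʳ-≤ (y * y ^ d * suc y) (+-monoʳ-≤ (d * (suc y * suc y ^ d))
                                                                           (*-monoʳ-≤ (suc y) (^-monoˡ-≤ d (n≤1+n y)))) ⟩
    y * y ^ d * suc y + (d * (suc y * suc y ^ d) + suc y * suc y ^ d) ≡⟨ cong (y * y ^ d * suc y +_) (+-comm (d * (suc y * suc y ^ d)) _) ⟩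
    y * y ^ d * suc y + suc d * (suc y * suc y ^ d)                   ∎
    where
    open ≤-Reasoning
    lemma : ∀ y p q d → suc y * (p * suc y + d * q) ≡ y * p * suc y + (d * (suc y * q) + suc y * p)
    lemma = solve-∀

  -- The case y + 1 = 2 d of `bernoulli′`: (1 - 1 / 2 d) ^ d is at least 1 / 2.
  halving : ∀ d → 1 ≤ d → (2 * d) ^ d ≤ 2 * (2 * d ∸ 1) ^ d
  halving d@(suc d′) _ = *-cancelʳ-≤ (p ^ d) (2 * y ^ d) d (+-cancelʳ-≤ (p ^ d * d) (p ^ d * d) (2 * y ^ d * d) (begin
    p ^ d * d + p ^ d * d               ≡⟨ lemma (p ^ d) d ⟩
    p * p ^ d                           ≡⟨ cong (λ z → z * z ^ d) (sym p≡) ⟩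
    suc y * suc y ^ d                   ≤⟨ bernoulli′ y d ⟩
    y ^ d * suc y + d * suc y ^ d       ≡⟨ cong (λ z → y ^ d * z + d * z ^ d) p≡ ⟩
    y ^ d * p + d * p ^ d               ≡⟨ lemma′ (y ^ d) (p ^ d) d ⟩
    2 * y ^ d * d + p ^ d * d           ∎))
    where
    open ≤-Reasoning
    p y : ℕ
    p = 2 * d
    y = 2 * d ∸ 1
    p≡ : suc y ≡ p
    p≡ = refl
    lemma : ∀ q d → q * d + q * d ≡ 2 * d * q
    lemma = solve-∀
    lemma′ : ∀ u q d → u * (2 * d) + d * q ≡ 2 * u * d + q * d
    lemma′ = solve-∀

  #-weighted : ∀ n p c → sum n (λ i → bit (p i) * c) ≡ # n p * c
  #-weighted n p c = trans (sum-cong n λ i _ → *-comm (bit (p i)) c) (trans (sum-* n c _) (*-comm c (# n p)))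

  #-∧-bit : ∀ n b q → # n (λ i → b ∧ q i) ≡ bit b * # n q
  #-∧-bit n true  q = sym (+-identityʳ (# n q))
  #-∧-bit n false q = #-none n

  -- The product of c and a count, as the algorithm computes it: by repeated addition.
  sumIf : ℕ → ℕ → (ℕ → Bool) → ℕ
  sumIf n c p = sum n (λ i → if p i then c else 0)

  sumIf≡ : ∀ n c p → sumIf n c p ≡ c * # n p
  sumIf≡ n c p = trans (sum-cong n λ i _ → lemma (p i)) (sum-* n c _)
    where
    lemma : ∀ b → (if b then c else 0) ≡ c * bit b
    lemma true  = sym (*-identityʳ c)
    lemma false = sym (*-zeroʳ c)

  -- The names refer to the bipartite complement of the graph with adjacency e.
  module Graph (n : ℕ) (e : ℕ → ℕ → Bool) where

    codegree : (ℕ → Bool) → ℕ → ℕ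
    codegree W x = # n (λ y → W y ∧ not (e x y))

    codegreeʳ : (ℕ → Bool) → ℕ → ℕ
    codegreeʳ C y = # n (λ x → C x ∧ not (e x y))

    double-count : ∀ C W → sum n (λ x → bit (C x) * codegree W x) ≡ sum n (λ y → bit (W y) * codegreeʳ C y)
    double-count C W = begin
      sum n (λ x → bit (C x) * codegree W x)                             ≡⟨ sum-cong n (λ x _ → sym (#-∧-bit n (C x) _)) ⟩
      sum n (λ x → sum n (λ y → bit (C x ∧ W y ∧ not (e x y))))          ≡⟨ sum-swap n n _ ⟩
      sum n (λ y → sum n (λ x → bit (C x ∧ W y ∧ not (e x y))))          ≡⟨ sum-cong n (λ y _ → sum-cong n (λ x _ → cong bit (swap (C x) (W y) _))) ⟩
      sum n (λ y → sum n (λ x → bit (W y ∧ C x ∧ not (e x y))))          ≡⟨ sum-cong n (λ y _ → #-∧-bit n (W y) _) ⟩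
      sum n (λ y → bit (W y) * codegreeʳ C y)                            ∎
      where
      open ≡-Reasoning
      swap : ∀ a b c → a ∧ b ∧ c ≡ b ∧ a ∧ c
      swap true  true  c = refl
      swap true  false c = refl
      swap false true  c = refl
      swap false false c = refl

    #-neighbours : ∀ W x → # n W ≡ # n (λ y → W y ∧ e x y) + codegree W x
    #-neighbours W x = #-split n W (e x)

    -- For D = 16 d the three thresholds are densities of non-neighbours: below 1 / 8 d in `sparse`,
    -- at most 1 / 4 d in `trimmed`, at most 1 / 2 d in `eligible`. Each passage to the next is an
    -- averaging argument that costs a factor of 2.
    sparse : ℕ → (ℕ → Bool) → (ℕ → Bool) → ℕ → Bool
    sparse D C W x = C x ∧ not (sumIf n 2 W ≤ᵇ sumIf n D (λ y → W y ∧ not (e x y)))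

    trimmed : ℕ → (ℕ → Bool) → (ℕ → Bool) → ℕ → Bool
    trimmed D lo W y = W y ∧ (sumIf n D (λ x → lo x ∧ not (e x y)) ≤ᵇ sumIf n 4 lo)

    eligible : ℕ → (ℕ → Bool) → (ℕ → Bool) → (ℕ → Bool) → ℕ → Bool
    eligible D lo S w x = lo x ∧ not (S x) ∧ (sumIf n D (λ y → w y ∧ not (e x y)) ≤ᵇ sumIf n 8 w)

    sparse-true : ∀ {D C W x} → sparse D C W x ≡ true → C x ≡ true × D * codegree W x ≤ 2 * # n W
    sparse-true {D} {C} {W} {x} h with ∧-true {C x} h
    ... | Cx , h′ = Cx , <⇒≤ (subst₂ _<_ (sumIf≡ n D _) (sumIf≡ n 2 W) (≤ᵇ-false (not-true h′)))

    sparse-false : ∀ {D C W x} → sparse D C W x ≡ false → C x ≡ true → 2 * # n W ≤ D * codegree W x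
    sparse-false {D} {C} {W} {x} h Cx with false-or-true (sumIf n 2 W ≤ᵇ sumIf n D (λ y → W y ∧ not (e x y)))
    ... | inj₂ le = subst₂ _≤_ (sumIf≡ n 2 W) (sumIf≡ n D _) (≤ᵇ-true le)
    ... | inj₁ gt with () ← trans (sym (∧-intro Cx (cong not gt))) h

    trimmed-true : ∀ {D lo W y} → trimmed D lo W y ≡ true → W y ≡ true × D * codegreeʳ lo y ≤ 4 * # n lo
    trimmed-true {D} {lo} {W} {y} h with ∧-true {W y} h
    ... | Wy , h′ = Wy , subst₂ _≤_ (sumIf≡ n D _) (sumIf≡ n 4 lo) (≤ᵇ-true h′)

    -- Markov's inequality: at least half of W survives trimming.
    trimmed-large : ∀ D lo W → 1 ≤ # n lo → (∀ x → x < n → lo x ≡ true → D * codegree W x ≤ 2 * # n W) →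
                    # n W ≤ 2 * # n (trimmed D lo W)
    trimmed-large D lo W 1≤lo h = ≮⇒≥ λ lt → contradiction upper (<⇒≱ (<-≤-trans (gap lt) lower))
      where
      open ≤-Reasoning
      bad : ℕ → Bool
      bad y = W y ∧ not (sumIf n D (λ x → lo x ∧ not (e x y)) ≤ᵇ sumIf n 4 lo)
      w t b l : ℕ
      w = # n W
      t = # n (trimmed D lo W)
      b = # n bad
      l = # n lo
      upper : sum n (λ y → bit (W y) * (D * codegreeʳ lo y)) ≤ l * (2 * w)
      upper = begin
        sum n (λ y → bit (W y) * (D * codegreeʳ lo y)) ≡⟨ sum-cong n (λ y _ → shuffle (bit (W y)) D _) ⟩
        sum n (λ y → D * (bit (W y) * codegreeʳ lo y)) ≡⟨ sum-* n D _ ⟩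
        D * sum n (λ y → bit (W y) * codegreeʳ lo y)   ≡⟨ cong (D *_) (sym (double-count lo W)) ⟩
        D * sum n (λ x → bit (lo x) * codegree W x)    ≡⟨ sym (sum-* n D _) ⟩
        sum n (λ x → D * (bit (lo x) * codegree W x))  ≤⟨ sum-mono n (λ x x<n → each x x<n (lo x) refl) ⟩
        sum n (λ x → bit (lo x) * (2 * w))             ≡⟨ #-weighted n lo (2 * w) ⟩
        l * (2 * w)                                    ∎
        where
        shuffle : ∀ a b c → a * (b * c) ≡ b * (a * c)
        shuffle = solve-∀
        each : ∀ x → x < n → ∀ c → lo x ≡ c → D * (bit c * codegree W x) ≤ bit c * (2 * w)
        each x x<n false eq = ≤-reflexive (*-zeroʳ D)
        each x x<n true  eq = ≤-trans (≤-reflexive (cong (D *_) (+-identityʳ _))) (≤-trans (h x x<n eq) (≤-reflexive (sym (+-identityʳ _))))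
      lower : b * (4 * l) ≤ sum n (λ y → bit (W y) * (D * codegreeʳ lo y))
      lower = begin
        b * (4 * l)                                    ≡⟨ sym (#-weighted n bad (4 * l)) ⟩
        sum n (λ y → bit (bad y) * (4 * l))            ≤⟨ sum-mono n (λ y _ → each y (W y) _ refl refl) ⟩
        sum n (λ y → bit (W y) * (D * codegreeʳ lo y)) ∎
        where
        each : ∀ y a c → W y ≡ a → (sumIf n D (λ x → lo x ∧ not (e x y)) ≤ᵇ sumIf n 4 lo) ≡ c →
               bit (a ∧ not c) * (4 * l) ≤ bit a * (D * codegreeʳ lo y)
        each y false c     _ _  = z≤n
        each y true  true  _ _  = z≤n
        each y true  false _ gt = +-monoˡ-≤ 0 (<⇒≤ (subst₂ _<_ (sumIf≡ n 4 lo) (sumIf≡ n D _) (≤ᵇ-false gt)))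
      gap : 2 * t < w → l * (2 * w) < b * (4 * l)
      gap lt = begin-strict
        l * (2 * w)   <⟨ *-monoʳ-< l {{>-nonZero 1≤lo}} (*-monoʳ-< 2 (+-cancelˡ-< w w (b + b) (begin-strict
          w + w             ≡⟨ cong₂ _+_ split split ⟩
          (t + b) + (t + b) ≡⟨ shuffle t b ⟩
          2 * t + (b + b)   <⟨ +-monoˡ-< (b + b) lt ⟩
          w + (b + b)       ∎))) ⟩
        l * (2 * (b + b)) ≡⟨ shuffle′ l b ⟩
        b * (4 * l)   ∎
        where
        split : w ≡ t + b
        split = #-split n W _
        shuffle : ∀ t b → (t + b) + (t + b) ≡ 2 * t + (b + b)
        shuffle = solve-∀
        shuffle′ : ∀ l b → l * (2 * (b + b)) ≡ b * (4 * l)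
        shuffle′ = solve-∀

    insert : ℕ → (ℕ → Bool) → ℕ → Bool
    insert x S y = S y ∨ ((y ≤ᵇ x) ∧ (x ≤ᵇ y))

    #-insert : ∀ S x → x < n → S x ≡ false → # n (insert x S) ≡ suc (# n S)
    #-insert S x x<n Sx = trans (sum-cong n λ y _ → lemma y (S y) refl)
      (trans (sum-+ n _ _) (trans (cong (# n S +_) (#-single n x<n)) (+-comm (# n S) 1)))
      where
      lemma : ∀ y b → S y ≡ b → bit (b ∨ ((y ≤ᵇ x) ∧ (x ≤ᵇ y))) ≡ bit b + bit ((y ≤ᵇ x) ∧ (x ≤ᵇ y))
      lemma y false _ = refl
      lemma y true  Sy with false-or-true ((y ≤ᵇ x) ∧ (x ≤ᵇ y))
      ... | inj₁ eq = cong (λ c → 1 + bit c) (sym eq)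
      ... | inj₂ eq with ∧-true {y ≤ᵇ x} eq
      ...   | y≤x , x≤y with () ← trans (sym (subst (λ z → S z ≡ true) (≤-antisym (≤ᵇ-true {y} {x} y≤x) (≤ᵇ-true x≤y)) Sy)) Sx

    -- Having few non-neighbours in W says nothing about subsets of W, and `w` may be any subset
    -- that earlier choices have left. But each vertex of `w` has few non-neighbours in `lo`.
    -- Counting pairs from that side bounds the total over `lo`, hence over the part outside S,
    -- which contains more than half of `lo`; some vertex there is at most average.
    eligible-exists : ∀ D lo S w → (∀ x → x < n → S x ≡ true → lo x ≡ true) → 2 * suc (# n S) ≤ # n lo →
                      (∀ y → y < n → w y ≡ true → D * codegreeʳ lo y ≤ 4 * # n lo) →
                      ∃[ x ] (x < n × eligible D lo S w x ≡ true)
    eligible-exists D lo S w S⊆lo big small =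
      let x , x<n , h = sum-<⇒∃ n f g (≤-<-trans upper gap) in x , x<n , choose x (lo x) (S x) h
      where
      open ≤-Reasoning
      rest : ℕ → Bool
      rest x = lo x ∧ not (S x)
      f g : ℕ → ℕ
      f x = bit (rest x) * (D * codegree w x)
      -- The successor makes the comparison of the two sums strict, also when `w` is empty.
      g x = bit (rest x) * suc (8 * # n w)
      l r s m : ℕ
      l = # n lo
      r = # n rest
      s = # n S
      m = # n w
      upper : sum n f ≤ m * (4 * l)
      upper = begin
        sum n f                                       ≤⟨ sum-mono n (λ x _ → *-monoˡ-≤ (D * codegree w x) (bit-mono {rest x} {lo x} (λ h → proj₁ (∧-true {lo x} h)))) ⟩
        sum n (λ x → bit (lo x) * (D * codegree w x)) ≡⟨ sum-cong n (λ x _ → shuffle (bit (lo x)) D _) ⟩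
        sum n (λ x → D * (bit (lo x) * codegree w x)) ≡⟨ sum-* n D _ ⟩
        D * sum n (λ x → bit (lo x) * codegree w x)   ≡⟨ cong (D *_) (double-count lo w) ⟩
        D * sum n (λ y → bit (w y) * codegreeʳ lo y)  ≡⟨ sym (sum-* n D _) ⟩
        sum n (λ y → D * (bit (w y) * codegreeʳ lo y)) ≤⟨ sum-mono n (λ y y<n → each y y<n (w y) refl) ⟩
        sum n (λ y → bit (w y) * (4 * l))             ≡⟨ #-weighted n w (4 * l) ⟩
        m * (4 * l)                                   ∎
        where
        shuffle : ∀ a b c → a * (b * c) ≡ b * (a * c)
        shuffle = solve-∀
        each : ∀ y → y < n → ∀ c → w y ≡ c → D * (bit c * codegreeʳ lo y) ≤ bit c * (4 * l)
        each y y<n false eq = ≤-reflexive (*-zeroʳ D)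
        each y y<n true  eq = ≤-trans (≤-reflexive (cong (D *_) (+-identityʳ _))) (≤-trans (small y y<n eq) (≤-reflexive (sym (+-identityʳ _))))
      l≤ : l ≤ s + r
      l≤ = ≤-trans (≤-reflexive (#-split n lo S)) (+-monoˡ-≤ r (#-mono n λ x _ h → proj₂ (∧-true {lo x} h)))
      2+l≤2r : 2 + l ≤ 2 * r
      2+l≤2r = +-cancelˡ-≤ l (2 + l) (2 * r) (begin
        l + (2 + l)                 ≡⟨ shuffle l ⟩
        2 * l + 2                   ≤⟨ +-monoˡ-≤ 2 (*-monoʳ-≤ 2 l≤) ⟩
        2 * (s + r) + 2             ≡⟨ shuffle′ s r ⟩
        2 * suc s + 2 * r           ≤⟨ +-monoˡ-≤ (2 * r) big ⟩
        l + 2 * r                   ∎)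
        where
        shuffle : ∀ l → l + (2 + l) ≡ 2 * l + 2
        shuffle = solve-∀
        shuffle′ : ∀ s r → 2 * (s + r) + 2 ≡ 2 * suc s + 2 * r
        shuffle′ = solve-∀
      gap : m * (4 * l) < sum n g
      gap = begin-strict
        m * (4 * l)             ≤⟨ *-monoʳ-≤ m (*-monoʳ-≤ 4 (≤-trans (m≤n+m l 2) 2+l≤2r)) ⟩
        m * (4 * (2 * r))       <⟨ m<m+n _ (pos r (≤-trans (s≤s z≤n) 2+l≤2r)) ⟩
        m * (4 * (2 * r)) + r   ≡⟨ shuffle m r ⟩
        r * suc (8 * m)         ≡⟨ sym (#-weighted n rest (suc (8 * m))) ⟩
        sum n g                 ∎
        where
        pos : ∀ r → 1 ≤ 2 * r → 0 < r
        pos (suc r) _ = s≤s z≤n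
        shuffle : ∀ m r → m * (4 * (2 * r)) + r ≡ r * suc (8 * m)
        shuffle = solve-∀
      choose : ∀ x a b → bit (a ∧ not b) * (D * codegree w x) < bit (a ∧ not b) * suc (8 * # n w) →
               a ∧ not b ∧ (sumIf n D (λ y → w y ∧ not (e x y)) ≤ᵇ sumIf n 8 w) ≡ true
      choose x true  false h = true-≤ᵇ (subst₂ _≤_ (sym (sumIf≡ n D _)) (sym (sumIf≡ n 8 w)) (s≤s⁻¹ (subst₂ _<_ (+-identityʳ _) (+-identityʳ _) h)))
      choose x true  true  ()
      choose x false b     ()

    -- The state after r greedy choices, for D = 16 d.
    record Greedy (d : ℕ) (lo ws : ℕ → Bool) (r : ℕ) (S w : ℕ → Bool) : Set where
      field
        S⊆lo     : ∀ x → x < n → S x ≡ true → lo x ≡ true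
        w⊆ws     : ∀ y → y < n → w y ≡ true → ws y ≡ true
        count    : # n S ≡ r
        complete : ∀ x y → x < n → y < n → S x ≡ true → w y ≡ true → e x y ≡ true
        large    : (2 * d ∸ 1) ^ r * # n ws ≤ (2 * d) ^ r * # n w
    open Greedy

    greedy-extend : ∀ {d lo ws r S w} x → x < n → eligible (16 * d) lo S w x ≡ true →
                    Greedy d lo ws r S w → Greedy d lo ws (suc r) (insert x S) (λ y → w y ∧ e x y)
    greedy-extend {d} {lo} {ws} {r} {S} {w} x x<n ex G = record
      { S⊆lo     = λ y y<n h → case y (S y) refl h λ Sy → S⊆lo G y y<n Sy
      ; w⊆ws     = λ y y<n h → w⊆ws G y y<n (proj₁ (∧-true h))
      ; count    = trans (#-insert S x x<n (not-true (proj₁ (∧-true (proj₂ (∧-true {lo x} ex)))))) (cong suc (count G))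
      ; complete = λ y z y<n z<n Sy wz → complete′ y z y<n z<n (S y) refl Sy wz
      ; large    = begin
          (2 * d ∸ 1) * (2 * d ∸ 1) ^ r * # n ws     ≡⟨ *-assoc (2 * d ∸ 1) _ _ ⟩
          (2 * d ∸ 1) * ((2 * d ∸ 1) ^ r * # n ws)   ≤⟨ *-monoʳ-≤ (2 * d ∸ 1) (large G) ⟩
          (2 * d ∸ 1) * ((2 * d) ^ r * # n w)        ≡⟨ shuffle (2 * d ∸ 1) ((2 * d) ^ r) (# n w) ⟩
          (2 * d) ^ r * ((2 * d ∸ 1) * # n w)        ≤⟨ *-monoʳ-≤ ((2 * d) ^ r) shrink ⟩
          (2 * d) ^ r * (2 * d * # n w′)             ≡⟨ shuffle′ ((2 * d) ^ r) (2 * d) _ ⟩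
          2 * d * (2 * d) ^ r * # n w′               ∎
      }
      where
      open ≤-Reasoning
      w′ : ℕ → Bool
      w′ y = w y ∧ e x y
      shuffle : ∀ a b c → a * (b * c) ≡ b * (a * c)
      shuffle = solve-∀
      shuffle′ : ∀ a b c → a * (b * c) ≡ b * a * c
      shuffle′ = solve-∀
      lox : lo x ≡ true
      lox = proj₁ (∧-true ex)
      case : ∀ y b → S y ≡ b → b ∨ ((y ≤ᵇ x) ∧ (x ≤ᵇ y)) ≡ true → (S y ≡ true → lo y ≡ true) → lo y ≡ true
      case y true  Sy h k = k Sy
      case y false Sy h k with ∧-true {y ≤ᵇ x} h
      ... | y≤x , x≤y = subst (λ z → lo z ≡ true) (≤-antisym (≤ᵇ-true {x} {y} x≤y) (≤ᵇ-true y≤x)) lox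
      complete′ : ∀ y z → y < n → z < n → ∀ b → S y ≡ b → b ∨ ((y ≤ᵇ x) ∧ (x ≤ᵇ y)) ≡ true → w′ z ≡ true → e y z ≡ true
      complete′ y z y<n z<n true  Sy h wz = complete G y z y<n z<n Sy (proj₁ (∧-true wz))
      complete′ y z y<n z<n false Sy h wz with ∧-true {y ≤ᵇ x} h
      ... | y≤x , x≤y = subst (λ u → e u z ≡ true) (≤-antisym (≤ᵇ-true {x} {y} x≤y) (≤ᵇ-true y≤x)) (proj₂ (∧-true {w z} wz))
      few : 2 * d * codegree w x ≤ # n w
      few = *-cancelˡ-≤ 8 (begin
        8 * (2 * d * codegree w x)                ≡⟨ shuffle″ d _ ⟩
        16 * d * codegree w x                     ≡⟨ sym (sumIf≡ n (16 * d) _) ⟩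
        sumIf n (16 * d) (λ y → w y ∧ not (e x y)) ≤⟨ ≤ᵇ-true (proj₂ (∧-true {not (S x)} (proj₂ (∧-true {lo x} ex)))) ⟩
        sumIf n 8 w                               ≡⟨ sumIf≡ n 8 w ⟩
        8 * # n w                                 ∎)
        where
        shuffle″ : ∀ d c → 8 * (2 * d * c) ≡ 16 * d * c
        shuffle″ = solve-∀
      shrink : (2 * d ∸ 1) * # n w ≤ 2 * d * # n w′
      shrink = begin
        (2 * d ∸ 1) * # n w                        ≡⟨ *-distribʳ-∸ (# n w) (2 * d) 1 ⟩
        2 * d * # n w ∸ 1 * # n w                  ≤⟨ ∸-mono (≤-reflexive (trans (cong (2 * d *_) (#-neighbours w x)) (*-distribˡ-+ (2 * d) _ _)))
                                                              (≤-trans few (≤-reflexive (sym (*-identityˡ (# n w))))) ⟩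
        2 * d * # n w′ + 2 * d * codegree w x ∸ 2 * d * codegree w x ≡⟨ m+n∸n≡m (2 * d * # n w′) (2 * d * codegree w x) ⟩
        2 * d * # n w′                             ∎

    greedy-step : ∀ {d lo ws r S w} → 2 * suc r ≤ # n lo →
                  (∀ y → y < n → ws y ≡ true → 16 * d * codegreeʳ lo y ≤ 4 * # n lo) →
                  Greedy d lo ws r S w →
                  Greedy d lo ws (suc r) (insert (first n (eligible (16 * d) lo S w)) S)
                         (λ y → w y ∧ e (first n (eligible (16 * d) lo S w)) y)
    greedy-step {d} {lo} {ws} {r} {S} {w} big small G = greedy-extend _ (proj₁ found) (proj₂ found) G
      where
      found : first n (eligible (16 * d) lo S w) < n × eligible (16 * d) lo S w (first n (eligible (16 * d) lo S w)) ≡ true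
      found = first-correct n (eligible (16 * d) lo S w) (eligible-exists (16 * d) lo S w (S⊆lo G)
        (subst (λ c → 2 * suc c ≤ # n lo) (sym (count G)) big) (λ y y<n wy → small y y<n (w⊆ws G y y<n wy)))

    -- By `halving`, any d consecutive choices at worst halve the set of common neighbours.
    greedy-large : ∀ {d lo ws l S w} → 1 ≤ d → Greedy d lo ws (d * l) S w → # n ws ≤ 2 ^ l * # n w
    greedy-large {d} {lo} {ws} {l} {S} {w} 1≤d G = *-cancelˡ-≤ ((2 * d) ^ (d * l)) {{m^n≢0 (2 * d) (d * l) {{>-nonZero (≤-trans 1≤d (m≤m+n d _))}}}} (begin
      (2 * d) ^ (d * l) * # n ws                ≡⟨ cong (_* # n ws) (sym (^-*-assoc (2 * d) d l)) ⟩
      ((2 * d) ^ d) ^ l * # n ws                ≤⟨ *-monoˡ-≤ (# n ws) (^-monoˡ-≤ l (halving d 1≤d)) ⟩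
      (2 * (2 * d ∸ 1) ^ d) ^ l * # n ws        ≡⟨ cong (_* # n ws) (*-^ l 2 ((2 * d ∸ 1) ^ d)) ⟩
      2 ^ l * ((2 * d ∸ 1) ^ d) ^ l * # n ws    ≡⟨ cong (λ z → 2 ^ l * z * # n ws) (^-*-assoc (2 * d ∸ 1) d l) ⟩
      2 ^ l * (2 * d ∸ 1) ^ (d * l) * # n ws    ≡⟨ *-assoc (2 ^ l) _ _ ⟩
      2 ^ l * ((2 * d ∸ 1) ^ (d * l) * # n ws)  ≤⟨ *-monoʳ-≤ (2 ^ l) (large G) ⟩
      2 ^ l * ((2 * d) ^ (d * l) * # n w)       ≡⟨ shuffle (2 ^ l) ((2 * d) ^ (d * l)) (# n w) ⟩
      (2 * d) ^ (d * l) * (2 ^ l * # n w)       ∎)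
      where
      open ≤-Reasoning
      shuffle : ∀ a b c → a * (b * c) ≡ b * (a * c)
      shuffle = solve-∀

-- The two phases, relative to a hidden biclique.

module Search where

  open import Data.Nat
  open import Data.Nat.Properties
  open import Data.Nat.Tactic.RingSolver using (solve-∀)
  open import Defs using (bit)
  open Sums
  open Extraction

  interval : ℕ → ℕ → ℕ → Bool
  interval c q v = (c ≤ᵇ v) ∧ (suc v ≤ᵇ c + q)

  #-digits : ∀ q j .{{_ : NonZero q}} (f : ℕ → ℕ → Bool) →
             # (q ^ suc j) (λ x → f (x % q) (x / q)) ≡ sum q (λ d → # (q ^ j) (f d))
  #-digits q j f = begin
    # (q * q ^ j) (λ x → f (x % q) (x / q))                                        ≡⟨ cong (λ m → # m (λ x → f (x % q) (x / q))) (*-comm q (q ^ j)) ⟩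
    -- Writing x = b q + i with i < q separates the lowest digit i from the remaining digits b.
    # (q ^ j * q) (λ x → f (x % q) (x / q))                                        ≡⟨ sum-blocks (q ^ j) q _ ⟩
    sum (q ^ j) (λ b → # q (λ i → f ((b * q + i) % q) ((b * q + i) / q)))          ≡⟨ sum-cong (q ^ j) (λ b _ → #-cong q λ i i<q →
                                                                                        cong₂ f ([bq+i]%q b q i i<q) ([bq+i]/q b q i i<q)) ⟩
    sum (q ^ j) (λ b → sum q (λ i → bit (f i b)))                                  ≡⟨ sum-swap (q ^ j) q _ ⟩
    sum q (λ d → # (q ^ j) (f d))                                                  ∎
    where open ≡-Reasoning

  digit-bound : ∀ {q x j} d → d < q → x < q ^ j → x * q + d < q ^ suc j
  digit-bound {q} {x} {j} d d<q x<q^j = begin-strict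
    x * q + d     <⟨ +-monoʳ-< (x * q) d<q ⟩
    x * q + q     ≡⟨ +-comm (x * q) q ⟩
    suc x * q     ≤⟨ *-monoˡ-≤ q x<q^j ⟩
    q ^ j * q     ≡⟨ *-comm (q ^ j) q ⟩
    q * q ^ j     ∎
    where open ≤-Reasoning

  #-shift : ∀ n e q (p : ℕ → Bool) → (∀ u → u < n → p u ≡ true → interval e q u ≡ true) →
            # n p ≡ # q (λ i → (suc (e + i) ≤ᵇ n) ∧ p (e + i))
  #-shift n e q p sup = begin
    # n p                                                    ≡⟨ #-cong n (λ k k<n → sym (trans (cong (_∧ p k) (true-≤ᵇ k<n)) refl)) ⟩
    # n p′                                                   ≡⟨ sym (+-identityʳ _) ⟩
    -- The range is extended beyond n, because the interval may reach past the last vertex; `p′` is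
    -- false there.
    # n p′ + 0                                               ≡⟨ cong (# n p′ +_) (sym (zeros (e + q) (λ i → n + i) λ i _ → cong (_∧ p (n + i)) (false-≤ᵇ (s≤s (m≤m+n n i))))) ⟩
    # n p′ + # (e + q) (λ i → p′ (n + i))                    ≡⟨ sym (sum-append n (e + q) _) ⟩
    # (n + (e + q)) p′                                       ≡⟨ cong (λ m → # m p′) (+-comm n (e + q)) ⟩
    # (e + q + n) p′                                         ≡⟨ sum-append (e + q) n _ ⟩
    # (e + q) p′ + # n (λ i → p′ (e + q + i))                ≡⟨ cong₂ _+_ (sum-append e q _) (zeros n (λ i → e + q + i) λ i _ → outside (e + q + i) λ h →
                                                                  <⇒≱ (≤ᵇ-true {suc (e + q + i)} {e + q} (proj₂ (∧-true {e ≤ᵇ (e + q + i)} h))) (m≤m+n (e + q) i)) ⟩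
    (# e p′ + # q (λ i → p′ (e + i))) + 0                    ≡⟨ +-identityʳ _ ⟩
    # e p′ + # q (λ i → p′ (e + i))                          ≡⟨ cong (_+ # q (λ i → p′ (e + i))) (zeros e (λ i → i) λ i i<e → outside i λ h →
                                                                  <⇒≱ i<e (≤ᵇ-true {e} {i} (proj₁ (∧-true {e ≤ᵇ i} h)))) ⟩
    # q (λ i → p′ (e + i))                                   ∎
    where
    open ≡-Reasoning
    p′ : ℕ → Bool
    p′ k = (suc k ≤ᵇ n) ∧ p k
    zeros : ∀ m (f : ℕ → ℕ) → (∀ i → i < m → p′ (f i) ≡ false) → # m (λ i → p′ (f i)) ≡ 0
    zeros m f h = trans (#-cong m h) (#-none m)
    outside : ∀ k → ¬ (interval e q k ≡ true) → p′ k ≡ false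
    outside k h with false-or-true (p′ k)
    ... | inj₁ eq = eq
    ... | inj₂ eq with ∧-true {suc k ≤ᵇ n} eq
    ...   | k<n , pk = contradiction (sup k (≤ᵇ-true k<n) pk) h

  -- A biclique A × B, unknown to the algorithm.
  module Hidden (n : ℕ) (g : ℕ → ℕ → Bool) (A B : ℕ → Bool)
                (biclique : ∀ u v → u < n → v < n → A u ≡ true → B v ≡ true → g u v ≡ true)
                (d s : ℕ) (1≤d : 1 ≤ d) where

    D : ℕ
    D = 16 * d

    1≤D : 1 ≤ D
    1≤D = ≤-trans 1≤d (m≤m+n d _)

    gᵀ : ℕ → ℕ → Bool
    gᵀ v u = g u v

    module L = Graph n g
    module R = Graph n gᵀ

    -- The first phase: sets U ⊇ A shrink to common neighbourhoods of vertices
    -- c + x₀ , c + x₁ , … of the right side, xᵢ being the digits of x in base q.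
    module First (c q : ℕ) {{_ : NonZero q}} where

      Q : ℕ → Bool
      Q = interval c q

      narrow : ℕ → (ℕ → Bool) → ℕ → Bool
      narrow i U u = U u ∧ g u (c + i)

      chain : ℕ → ℕ → (ℕ → Bool) → ℕ → Bool
      chain zero    x U = U
      chain (suc j) x U = chain j (x / q) (narrow (x % q) U)

      chain-⊆ : ∀ j x {U u} → chain j x U u ≡ true → U u ≡ true
      chain-⊆ zero    x h = h
      chain-⊆ (suc j) x {U} {u} h = proj₁ (∧-true {U u} (chain-⊆ j (x / q) h))

      -- In the first alternative only the size of the current set is kept instead of its containing
      -- A: extraction just needs it to have at least M vertices, and A has that many.
      Outcome : ℕ → (ℕ → Bool) → ℕ → Set
      Outcome j U x =
        (∃[ i ] (i < j × # n A ≤ # n (chain i x U) × 2 * s ≤ # n (R.sparse D Q (chain i x U)))) ⊎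
        ((∀ u → u < n → A u ≡ true → chain j x U u ≡ true) × D ^ j * # n (chain j x U) ≤ (D ∸ 2) ^ j * # n U)

      outcome : 2 * s ≤ # n (λ v → B v ∧ Q v) → ∀ j U → (∀ u → u < n → A u ≡ true → U u ≡ true) →
                ∃[ x ] (x < q ^ j × Outcome j U x)
      outcome big zero    U A⊆U = 0 , s≤s z≤n , inj₂ (A⊆U , ≤-refl)
      outcome big (suc j) U A⊆U with 2 * s ≤? # n (R.sparse D Q U)
      ... | yes h = 0 , m^n>0 q (suc j) , inj₁ (0 , s≤s z≤n , #-mono n A⊆U , h)
      ... | no  h with #-∃ n (R.sparse D Q U) (λ v → B v ∧ Q v) (<-≤-trans (≰⇒> h) big)
      ...   | v , v<n , dense , BQ with ∧-true {B v} BQ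
      ...     | Bv , Qv with ∧-true {c ≤ᵇ v} Qv
      ...       | c≤v , v<c+q = extend (outcome big j U′ A⊆U′)
        where
        i : ℕ
        i = v ∸ c
        c+i≡v : c + i ≡ v
        c+i≡v = m+[n∸m]≡n (≤ᵇ-true {c} c≤v)
        i<q : i < q
        i<q = +-cancelˡ-< c i q (subst (_< c + q) (sym c+i≡v) (≤ᵇ-true v<c+q))
        U′ : ℕ → Bool
        U′ = narrow i U
        A⊆U′ : ∀ u → u < n → A u ≡ true → U′ u ≡ true
        A⊆U′ u u<n Au = ∧-intro (A⊆U u u<n Au) (subst (λ w → g u w ≡ true) (sym c+i≡v) (biclique u v u<n v<n Au Bv))
        shrink : D * # n U′ ≤ (D ∸ 2) * # n U
        shrink = begin
          D * # n U′                                            ≡⟨ sym (m+n∸n≡m (D * # n U′) (D * R.codegree U v)) ⟩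
          D * # n U′ + D * R.codegree U v ∸ D * R.codegree U v  ≤⟨ ∸-mono (≤-reflexive (trans (sym (*-distribˡ-+ D (# n U′) _)) (cong (D *_) whole)))
                                                                           (R.sparse-false {D} {Q} {U} dense Qv) ⟩
          D * # n U ∸ 2 * # n U                                 ≡⟨ sym (*-distribʳ-∸ (# n U) D 2) ⟩
          (D ∸ 2) * # n U                                       ∎
          where
          open ≤-Reasoning
          whole : # n U′ + R.codegree U v ≡ # n U
          whole = trans (cong (_+ R.codegree U v) (#-cong n λ u _ → cong (λ w → U u ∧ g u w) c+i≡v)) (sym (R.#-neighbours U v))
        extend : ∃[ x ] (x < q ^ j × Outcome j U′ x) → ∃[ x ] (x < q ^ suc j × Outcome (suc j) U x)
        -- The vertex chosen first becomes the lowest digit, since `chain` reads the digits from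
        -- below.
        extend (x , x<q^j , o) = x * q + i , digit-bound {q} {x} {j} i i<q x<q^j , lift o
          where
          unfold : ∀ k → chain (suc k) (x * q + i) U ≡ chain k x U′
          unfold k = cong₂ (λ y r → chain k y (narrow r U)) ([bq+i]/q x q i i<q) ([bq+i]%q x q i i<q)
          lift : Outcome j U′ x → Outcome (suc j) U (x * q + i)
          lift (inj₁ (k , k<j , large , many)) = inj₁ (suc k , s≤s k<j ,
            subst (λ C → # n A ≤ # n C) (sym (unfold k)) large ,
            subst (λ C → 2 * s ≤ # n (R.sparse D Q C)) (sym (unfold k)) many)
          lift (inj₂ (A⊆ , small)) = inj₂
            ( (λ u u<n Au → subst (λ C → C u ≡ true) (sym (unfold j)) (A⊆ u u<n Au))
            , subst (λ C → D ^ suc j * # n C ≤ (D ∸ 2) ^ suc j * # n U) (sym (unfold j)) (begin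
                D * D ^ j * # n (chain j x U′)          ≡⟨ *-assoc D _ _ ⟩
                D * (D ^ j * # n (chain j x U′))        ≤⟨ *-monoʳ-≤ D small ⟩
                D * ((D ∸ 2) ^ j * # n U′)              ≡⟨ shuffle D ((D ∸ 2) ^ j) (# n U′) ⟩
                (D ∸ 2) ^ j * (D * # n U′)              ≤⟨ *-monoʳ-≤ ((D ∸ 2) ^ j) shrink ⟩
                (D ∸ 2) ^ j * ((D ∸ 2) * # n U)         ≡⟨ shuffle′ ((D ∸ 2) ^ j) (D ∸ 2) _ ⟩
                (D ∸ 2) * (D ∸ 2) ^ j * # n U           ∎) )
            where
            open ≤-Reasoning
            shuffle : ∀ a b c → a * (b * c) ≡ b * (a * c)
            shuffle = solve-∀
            shuffle′ : ∀ a b c → a * (b * c) ≡ b * a * c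
            shuffle′ = solve-∀

    -- The second phase: x encodes vertices e + x₀ , e + x₁ , … of P, and W
    -- shrinks to their common non-neighbourhood. If one of them lies in A, the
    -- result is disjoint from B.
    module Second (e q : ℕ) {{_ : NonZero q}} (P : ℕ → Bool)
                  (P⊆ : ∀ u → u < n → P u ≡ true → interval e q u ≡ true) where

      inside : ℕ → Bool
      inside u = (suc u ≤ᵇ n) ∧ P u

      -- A digit that names no vertex of P empties the set, so that such a sequence removes nothing
      -- later.
      narrow : ℕ → (ℕ → Bool) → ℕ → Bool
      narrow i W v = W v ∧ not (g (e + i) v) ∧ inside (e + i)

      chain : ℕ → ℕ → (ℕ → Bool) → ℕ → Bool
      chain zero    x W = W
      chain (suc j) x W = chain j (x / q) (narrow (x % q) W)

      chain-⊆ : ∀ j x {W v} → chain j x W v ≡ true → W v ≡ true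
      chain-⊆ zero    x h = h
      chain-⊆ (suc j) x {W} {v} h = proj₁ (∧-true {W v} (chain-⊆ j (x / q) h))

      misses : ℕ → Bool
      misses i = (suc (e + i) ≤ᵇ n) ∧ P (e + i) ∧ not (A (e + i))

      avoids : ℕ → ℕ → Bool
      avoids zero    x = true
      avoids (suc j) x = misses (x % q) ∧ avoids j (x / q)

      chain-avoids : ∀ j x {W v} → v < n → B v ≡ true → chain j x W v ≡ true → avoids j x ≡ true
      chain-avoids zero    x v<n Bv h = refl
      chain-avoids (suc j) x {W} {v} v<n Bv h with ∧-true {W v} (chain-⊆ j (x / q) h)
      ... | _ , h′ with ∧-true {not (g (e + x % q) v)} h′
      ...   | ¬g , ok with ∧-true {suc (e + x % q) ≤ᵇ n} ok
      ...     | u<n , Pu = ∧-intro (∧-intro u<n (∧-intro Pu ¬A)) (chain-avoids j (x / q) v<n Bv h)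
        where
        ¬A : not (A (e + x % q)) ≡ true
        ¬A with false-or-true (A (e + x % q))
        ... | inj₁ eq = cong not eq
        ... | inj₂ eq with () ← trans (sym (biclique _ v (≤ᵇ-true u<n) v<n eq Bv)) (not-true ¬g)

      outsiders : ℕ
      outsiders = # n (λ u → P u ∧ not (A u))

      -- Membership in P is part of `misses`, so every digit has exactly `outsiders` admissible
      -- values, independently of the others.
      avoids-few : ∀ j → # (q ^ j) (avoids j) ≡ outsiders ^ j
      avoids-few zero    = refl
      avoids-few (suc j) = begin
        # (q ^ suc j) (λ x → misses (x % q) ∧ avoids j (x / q)) ≡⟨ #-digits q j (λ i y → misses i ∧ avoids j y) ⟩
        sum q (λ i → # (q ^ j) (λ y → misses i ∧ avoids j y))   ≡⟨ sum-cong q (λ i _ → #-∧-bit (q ^ j) (misses i) (avoids j)) ⟩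
        sum q (λ i → bit (misses i) * # (q ^ j) (avoids j))     ≡⟨ #-weighted q misses _ ⟩
        # q misses * # (q ^ j) (avoids j)                       ≡⟨ cong₂ _*_ (sym (#-shift n e q (λ u → P u ∧ not (A u)) λ u u<n h → P⊆ u u<n (proj₁ (∧-true h)))) (avoids-few j) ⟩
        outsiders * outsiders ^ j                               ∎
        where open ≡-Reasoning

      Barren : ℕ → ℕ → ℕ → (ℕ → Bool) → Set
      Barren M j x W = ∀ i → i < j → M ≤ # n (chain i x W) → # n (L.sparse D P (chain i x W)) ≤ 2 * s

      -- A vertex of P that is not sparse leaves at least a fraction 1 / D of W, and by barrenness
      -- at most 2 s vertices are sparse. So at least |P| - 2 s values of the first digit admit the
      -- induction hypothesis. The factor D ^ j in the assumption on W pays for the j losses and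
      -- keeps every stage at M or more, where barrenness applies.
      many-large : ∀ M j W → (∀ x → x < q ^ j → Barren M j x W) → D ^ j * M ≤ # n W →
                   (# n P ∸ 2 * s) ^ j ≤ # (q ^ j) (λ x → M ≤ᵇ # n (chain j x W))
      many-large M zero    W barren big = ≤-reflexive (cong bit (sym (true-≤ᵇ (≤-trans (≤-reflexive (sym (*-identityˡ M))) big))))
      many-large M (suc j) W barren big = begin
        (# n P ∸ 2 * s) * g^j                                               ≤⟨ *-monoˡ-≤ g^j enough ⟩
        # q good * g^j                                                      ≡⟨ sym (#-weighted q good g^j) ⟩
        sum q (λ i → bit (good i) * g^j)                                    ≤⟨ sum-mono q (λ i i<q → each i i<q (good i) refl) ⟩
        sum q (λ i → # (q ^ j) (λ y → M ≤ᵇ # n (chain j y (narrow i W))))   ≡⟨ sym (#-digits q j (λ i y → M ≤ᵇ # n (chain j y (narrow i W)))) ⟩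
        # (q ^ suc j) (λ x → M ≤ᵇ # n (chain (suc j) x W))                  ∎
        where
        open ≤-Reasoning
        g^j : ℕ
        g^j = (# n P ∸ 2 * s) ^ j
        M≤W : M ≤ # n W
        M≤W = ≤-trans (m≤n*m M (D ^ suc j) {{m^n≢0 D (suc j) {{>-nonZero 1≤D}}}}) big
        keep : ℕ → Bool
        keep u = P u ∧ not (L.sparse D P W u)
        good : ℕ → Bool
        good i = (suc (e + i) ≤ᵇ n) ∧ keep (e + i)
        enough : # n P ∸ 2 * s ≤ # q good
        enough = begin
          # n P ∸ 2 * s                        ≤⟨ ∸-monoʳ-≤ (# n P) (≤-trans (#-mono n {q = L.sparse D P W} λ u _ h → proj₂ (∧-true {P u} h)) (barren 0 (m^n>0 q (suc j)) 0 (s≤s z≤n) M≤W)) ⟩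
          # n P ∸ # n (λ u → P u ∧ L.sparse D P W u) ≡⟨ cong (_∸ # n (λ u → P u ∧ L.sparse D P W u)) (#-split n P (L.sparse D P W)) ⟩
          # n (λ u → P u ∧ L.sparse D P W u) + # n keep ∸ # n (λ u → P u ∧ L.sparse D P W u) ≡⟨ m+n∸m≡n (# n (λ u → P u ∧ L.sparse D P W u)) _ ⟩
          # n keep                             ≡⟨ #-shift n e q keep (λ u u<n h → P⊆ u u<n (proj₁ (∧-true h))) ⟩
          # q good                             ∎
        each : ∀ i → i < q → ∀ b → good i ≡ b → bit b * g^j ≤ # (q ^ j) (λ y → M ≤ᵇ # n (chain j y (narrow i W)))
        each i i<q false _  = z≤n
        each i i<q true  gi with ∧-true {suc (e + i) ≤ᵇ n} gi
        ... | u<n , ki with ∧-true {P (e + i)} ki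
        ...   | Pu , ns = ≤-trans (≤-reflexive (+-identityʳ g^j)) (many-large M j (narrow i W) barren′ big′)
          where
          dense : # n W ≤ D * # n (narrow i W)
          dense = begin
            # n W                        ≤⟨ m≤n*m (# n W) 2 ⟩
            2 * # n W                    ≤⟨ L.sparse-false {D} {P} {W} (not-true ns) Pu ⟩
            D * L.codegree W (e + i)     ≡⟨ cong (D *_) (#-cong n λ v _ → cong (W v ∧_) (sym (trans (cong (not (g (e + i) v) ∧_) (∧-intro u<n Pu)) (∧-true-r _)))) ⟩
            D * # n (narrow i W)         ∎
            where
            ∧-true-r : ∀ b → b ∧ true ≡ b
            ∧-true-r true  = refl
            ∧-true-r false = refl
          big′ : D ^ j * M ≤ # n (narrow i W)
          big′ = *-cancelˡ-≤ D {{>-nonZero 1≤D}} (≤-trans (≤-reflexive (sym (*-assoc D (D ^ j) M))) (≤-trans big dense))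
          barren′ : ∀ y → y < q ^ j → Barren M j y (narrow i W)
          barren′ y y<q^j k k<j large = subst (λ C → # n (L.sparse D P C) ≤ 2 * s) (unfold k)
            (barren (y * q + i) (digit-bound {q} {y} {j} i i<q y<q^j) (suc k) (s≤s k<j)
              (subst (λ C → M ≤ # n C) (sym (unfold k)) large))
            where
            unfold : ∀ k → chain (suc k) (y * q + i) W ≡ chain k y (narrow i W)
            unfold k = cong₂ (λ z r → chain k z (narrow r W)) ([bq+i]/q y q i i<q) ([bq+i]%q y q i i<q)

      -- Removing, for one x after the other, one vertex of the final W from V.
      remove : ℕ → (ℕ → Bool) → (ℕ → Bool) → ℕ → Bool
      remove j W V v = V v ∧ not ((v ≤ᵇ f) ∧ (f ≤ᵇ v))
        where
        f : ℕ
        f = first n (λ v → W v ∧ V v)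

      -- The invariant after the sequences below x. `few` says that each of them removes at most one
      -- vertex. As there are fewer than M removals, a final set with M vertices still has one left
      -- to remove, which yields `gain`.
      record Pruned (M j : ℕ) (V₀ : ℕ → Bool) (x : ℕ) (V : ℕ → Bool) : Set where
        field
          V⊆V₀   : ∀ v → v < n → V v ≡ true → V₀ v ≡ true
          few    : # n V₀ ≤ # n V + x
          gain   : # n V + # x (λ y → M ≤ᵇ # n (chain j y V₀)) ≤ # n V₀
          loss   : # n (λ v → B v ∧ V₀ v) ≤ # n (λ v → B v ∧ V v) + # x (avoids j)

      module _ {M j : ℕ} {V₀ : ℕ → Bool} {x : ℕ} {V : ℕ → Bool} (x<M : x < M) (G : Pruned M j V₀ x V) where
        open Pruned G
        private
          W V′ : ℕ → Bool
          W = chain j x V₀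
          V′ = remove j W V
          f : ℕ
          f = first n (λ v → W v ∧ V v)
          isf : ℕ → Bool
          isf v = (v ≤ᵇ f) ∧ (f ≤ᵇ v)

          isf-true : ∀ {v} → isf v ≡ true → v ≡ f
          isf-true {v} h = ≤-antisym (≤ᵇ-true {v} {f} (proj₁ (∧-true h))) (≤ᵇ-true (proj₂ (∧-true {v ≤ᵇ f} h)))

          sizes : ∀ (p : ℕ → Bool) → # n (λ v → p v ∧ V v) ≡ # n (λ v → (p v ∧ V v) ∧ isf v) + # n (λ v → p v ∧ V′ v)
          sizes p = trans (#-split n (λ v → p v ∧ V v) isf)
            (cong (# n (λ v → (p v ∧ V v) ∧ isf v) +_) (#-cong n λ v _ → ∧-assoc (p v) (V v) (not (isf v))))

          at-most-one : ∀ (p : ℕ → Bool) → # n (λ v → p v ∧ isf v) ≤ 1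
          at-most-one p with f <? n
          ... | yes f<n = ≤-trans (#-mono n λ v _ h → proj₂ (∧-true {p v} h)) (≤-reflexive (#-single n f<n))
          ... | no  f≮n = ≤-trans (#-mono n {q = λ _ → false} λ v v<n h → contradiction (subst (_< n) (isf-true {v} (proj₂ (∧-true {p v} h))) v<n) f≮n)
                                  (≤-trans (≤-reflexive (#-none n)) z≤n)

          -- If V no longer meets W, then all of W is among the at most x < M vertices removed so
          -- far.
          nothing : (∀ i → i < n → W i ∧ V i ≡ false) → (M ≤ᵇ # n W) ≡ false
          nothing none = false-≤ᵇ (≤-<-trans (begin
            # n W                          ≤⟨ +-cancelʳ-≤ (# n V) (# n W) x (begin
              # n W + # n V                ≡⟨ cong (_+ # n V) (#-cong n λ v v<n → disjoint v v<n) ⟩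
              # n (λ v → V₀ v ∧ W v ∧ not (V v)) + # n V ≤⟨ +-monoˡ-≤ (# n V) (#-mono n λ v v<n h → ∧-intro (proj₁ (∧-true h)) (proj₂ (∧-true {W v} (proj₂ (∧-true {V₀ v} h))))) ⟩
              # n (λ v → V₀ v ∧ not (V v)) + # n V ≡⟨ +-comm _ (# n V) ⟩
              # n V + # n (λ v → V₀ v ∧ not (V v)) ≤⟨ +-monoˡ-≤ _ (#-mono n λ v v<n Vv → ∧-intro (V⊆V₀ v v<n Vv) Vv) ⟩
              # n (λ v → V₀ v ∧ V v) + # n (λ v → V₀ v ∧ not (V v)) ≡⟨ sym (#-split n V₀ V) ⟩
              # n V₀                       ≤⟨ few ⟩
              # n V + x                    ≡⟨ +-comm (# n V) x ⟩
              x + # n V                    ∎) ⟩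
            x                              ∎) x<M)
            where
            open ≤-Reasoning
            disjoint : ∀ v → v < n → W v ≡ V₀ v ∧ W v ∧ not (V v)
            disjoint v v<n with false-or-true (W v)
            ... | inj₁ eq rewrite eq = sym (∧-zeroʳ (V₀ v))
            ... | inj₂ eq rewrite eq with false-or-true (V v)
            ...   | inj₁ eq′ rewrite eq′ | chain-⊆ j x {V₀} {v} eq = refl
            ...   | inj₂ eq′ with () ← trans (sym (∧-intro eq eq′)) (none v v<n)

        prune : Pruned M j V₀ (suc x) V′
        prune = record
          { V⊆V₀ = λ v v<n h → V⊆V₀ v v<n (proj₁ (∧-true h))
          ; few  = begin
              # n V₀                                        ≤⟨ few ⟩
              # n V + x                                     ≡⟨ cong (_+ x) (sizes (λ _ → true)) ⟩
              # n (λ v → V v ∧ isf v) + # n V′ + x          ≤⟨ +-monoˡ-≤ x (+-monoˡ-≤ (# n V′) (at-most-one V)) ⟩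
              suc (# n V′) + x                              ≡⟨ sym (+-suc (# n V′) x) ⟩
              # n V′ + suc x                                ∎
          ; gain = begin
              # n V′ + (count + bit (M ≤ᵇ # n W))           ≤⟨ +-monoʳ-≤ (# n V′) (+-monoʳ-≤ count hit) ⟩
              # n V′ + (count + removed)                    ≡⟨ shuffle (# n V′) count removed ⟩
              removed + # n V′ + count                      ≡⟨ cong (_+ count) (sym (sizes (λ _ → true))) ⟩
              # n V + count                                 ≤⟨ gain ⟩
              # n V₀                                        ∎
          ; loss = begin
              # n (λ v → B v ∧ V₀ v)                        ≤⟨ loss ⟩
              # n (λ v → B v ∧ V v) + # x (avoids j)        ≡⟨ cong (_+ # x (avoids j)) (sizes B) ⟩
              # n (λ v → (B v ∧ V v) ∧ isf v) + # n (λ v → B v ∧ V′ v) + # x (avoids j)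
                                                            ≤⟨ +-monoˡ-≤ (# x (avoids j)) (+-monoˡ-≤ (# n (λ v → B v ∧ V′ v)) lost) ⟩
              bit (avoids j x) + # n (λ v → B v ∧ V′ v) + # x (avoids j)
                                                            ≡⟨ shuffle′ (bit (avoids j x)) (# n (λ v → B v ∧ V′ v)) (# x (avoids j)) ⟩
              # n (λ v → B v ∧ V′ v) + (# x (avoids j) + bit (avoids j x)) ∎
          }
          where
          open ≤-Reasoning
          count removed : ℕ
          count = # x (λ y → M ≤ᵇ # n (chain j y V₀))
          removed = # n (λ v → V v ∧ isf v)
          shuffle : ∀ a b c → a + (b + c) ≡ c + a + b
          shuffle = solve-∀
          shuffle′ : ∀ a b c → a + b + c ≡ b + (c + a)
          shuffle′ = solve-∀
          hit : bit (M ≤ᵇ # n W) ≤ removed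
          hit with least n (λ v → W v ∧ V v)
          ... | inj₁ none = ≤-trans (≤-reflexive (cong bit (nothing none))) z≤n
          ... | inj₂ (i , i<n , WVi , _) with first-correct n (λ v → W v ∧ V v) (i , i<n , WVi)
          ...   | f<n , WVf = ≤-trans (bit≤1 (M ≤ᵇ # n W)) (≤-trans
            (≤-reflexive (cong bit (sym (∧-intro (proj₂ (∧-true {W f} WVf)) (∧-intro (true-≤ᵇ (≤-refl {f})) (true-≤ᵇ (≤-refl {f}))))))) (term≤sum n _ f<n))
          lost : # n (λ v → (B v ∧ V v) ∧ isf v) ≤ bit (avoids j x)
          lost with # n (λ v → (B v ∧ V v) ∧ isf v) in eq
          ... | zero  = z≤n
          ... | suc k with #-pos n _ (≤-trans (s≤s z≤n) (≤-reflexive (sym eq)))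
          ...   | v , v<n , h with ∧-true {B v ∧ V v} h
          ...     | BVv , isfv with ∧-true {B v} BVv
          ...       | Bv , Vv with least n (λ v → W v ∧ V v)
          -- Without a candidate, `first` returns n, whereas the vertex at hand lies below n.
          ...         | inj₁ none = contradiction (subst (_< n) (trans (isf-true isfv) (first-none n (λ v → W v ∧ V v) none)) v<n) (<-irrefl refl)
          ...         | inj₂ (i , i<n , WVi , _) = ≤-trans (≤-reflexive (sym eq)) (≤-trans (at-most-one (λ v → B v ∧ V v))
            (≤-reflexive (cong bit (sym (chain-avoids j x {V₀} {v} v<n Bv Wv)))))
            where
            Wv : W v ≡ true
            Wv = subst (λ u → W u ≡ true) (sym (isf-true isfv))
                   (proj₁ (∧-true (proj₂ (first-correct n (λ v → W v ∧ V v) (i , i<n , WVi)))))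

-- Choice of the parameters and the inequalities between them.

module Params where

  open import Data.Nat
  open import Data.Nat.DivMod using (m≡m%n+[m/n]*n; m%n<n; m/n*n≤m; m<n*o⇒m/o<n; m*n/n≡m; /-monoˡ-≤; n/n≡1; m/n≤m)
  open import Data.Nat.Properties
  open import Data.Nat.Tactic.RingSolver using (solve-∀)
  open import Defs using (bit)
  open Sums
  open Extraction
  open Search

  bool-ext : ∀ {a b} → (a ≡ true → b ≡ true) → (b ≡ true → a ≡ true) → a ≡ b
  bool-ext {true}  {true}  f g = refl
  bool-ext {false} {false} f g = refl
  bool-ext {true}  {false} f g with () ← f refl
  bool-ext {false} {true}  f g with () ← g refl

  m<[1+m/n]*n : ∀ m n .{{_ : NonZero n}} → m < suc (m / n) * n
  m<[1+m/n]*n m n = begin-strict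
    m                     ≡⟨ m≡m%n+[m/n]*n m n ⟩
    m % n + m / n * n     <⟨ +-monoˡ-< (m / n * n) (m%n<n m n) ⟩
    n + m / n * n         ∎
    where open ≤-Reasoning

  interval-block : ∀ q b u .{{_ : NonZero q}} → interval (b * q) q u ≡ (b ≤ᵇ u / q) ∧ (u / q ≤ᵇ b)
  interval-block q b u = bool-ext forth back
    where
    forth : interval (b * q) q u ≡ true → (b ≤ᵇ u / q) ∧ (u / q ≤ᵇ b) ≡ true
    forth h with ∧-true {b * q ≤ᵇ u} h
    ... | lo , hi = ∧-intro
      (true-≤ᵇ (≤-trans (≤-reflexive (sym (m*n/n≡m b q))) (/-monoˡ-≤ q (≤ᵇ-true lo))))
      (true-≤ᵇ (s≤s⁻¹ (m<n*o⇒m/o<n (subst (u <_) (+-comm (b * q) q) (≤ᵇ-true hi)))))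
    back : (b ≤ᵇ u / q) ∧ (u / q ≤ᵇ b) ≡ true → interval (b * q) q u ≡ true
    back h with ∧-true {b ≤ᵇ u / q} h
    ... | le , ge with ≤-antisym (≤ᵇ-true {b} le) (≤ᵇ-true ge)
    ...   | refl = ∧-intro (true-≤ᵇ (m/n*n≤m u q)) (true-≤ᵇ (subst (suc u ≤_) (+-comm q (u / q * q)) (m<[1+m/n]*n u q)))

  #-partition : ∀ n q r (p : ℕ → Bool) .{{_ : NonZero q}} → n ≤ r * q →
                # n p ≡ sum r (λ b → # n (λ u → p u ∧ interval (b * q) q u))
  #-partition n q r p n≤rq = sym (begin
    sum r (λ b → # n (λ u → p u ∧ interval (b * q) q u))             ≡⟨ sum-swap r n _ ⟩
    sum n (λ u → # r (λ b → p u ∧ interval (b * q) q u))             ≡⟨ sum-cong n (λ u u<n → trans (#-∧-bit r (p u) _) (cong (bit (p u) *_) (one u u<n))) ⟩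
    sum n (λ u → bit (p u) * 1)                                              ≡⟨ sum-cong n (λ u _ → *-identityʳ _) ⟩
    # n p                                                            ∎)
    where
    open ≡-Reasoning
    one : ∀ u → u < n → # r (λ b → interval (b * q) q u) ≡ 1
    one u u<n = trans (#-cong r λ b _ → interval-block q b u) (#-single r (m<n*o⇒m/o<n (<-≤-trans u<n n≤rq)))

  block-start : ∀ n q b (p : ℕ → Bool) → 0 < # n (λ u → p u ∧ interval (b * q) q u) → b * q < n
  block-start n q b p h with #-pos n _ h
  ... | u , u<n , pI with ∧-true {p u} pI
  ...   | _ , I = ≤-<-trans (≤ᵇ-true (proj₁ (∧-true {b * q ≤ᵇ u} I))) u<n

  block : ∀ n q r s (B : ℕ → Bool) .{{_ : NonZero q}} → n ≤ r * q → r * s < # n B →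
          ∃[ c ] (c < n × s ≤ # n (λ v → B v ∧ interval c q v))
  block n q r s B n≤rq big with sum-<⇒∃ r (λ _ → s) (λ b → # n (λ v → B v ∧ interval (b * q) q v))
    (subst₂ _<_ (sym (sum-const r s)) (#-partition n q r B n≤rq) big)
  ... | b , _ , s< = b * q , block-start n q b B (≤-<-trans z≤n s<) , <⇒≤ s<

  -- A single average gives both properties. Summed over the r blocks, m p + 8 s u amounts to m u +
  -- 8 r s u, less than 2 u m, the sum of 2 u a. In a block where m p + 8 s u < 2 u a, dropping one
  -- term on the left gives the density, dropping the other 4 s < a.
  dense-block : ∀ n q r s (A U : ℕ → Bool) .{{_ : NonZero q}} → n ≤ r * q → r * (8 * s) < # n A →
                (∀ u → u < n → A u ≡ true → U u ≡ true) →
                ∃[ e ] (e < n × # n A * # n (λ u → U u ∧ interval e q u) ≤ 2 * # n U * # n (λ u → A u ∧ interval e q u) ×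
                        4 * s < # n (λ u → A u ∧ interval e q u))
  dense-block n q r s A U n≤rq big A⊆U with sum-<⇒∃ r f g gap
    where
    open ≤-Reasoning
    m u : ℕ
    m = # n A
    u = # n U
    p a f g : ℕ → ℕ
    p b = # n (λ x → U x ∧ interval (b * q) q x)
    a b = # n (λ x → A x ∧ interval (b * q) q x)
    f b = m * p b + 8 * s * u
    g b = 2 * u * a b
    1≤u : 1 ≤ u
    1≤u = ≤-trans (≤-trans (s≤s z≤n) big) (#-mono n A⊆U)
    gap : sum r f < sum r g
    gap = begin-strict
      sum r f                                          ≡⟨ sum-+ r (λ b → m * p b) (λ _ → 8 * s * u) ⟩
      sum r (λ b → m * p b) + sum r (λ _ → 8 * s * u)  ≡⟨ cong₂ _+_ (trans (sum-* r m p) (cong (m *_) (sym (#-partition n q r U n≤rq)))) (sum-const r (8 * s * u)) ⟩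
      m * u + r * (8 * s * u)                          ≡⟨ shuffle m u r s ⟩
      u * m + u * (r * (8 * s))                        <⟨ +-monoʳ-< (u * m) (*-monoʳ-< u {{>-nonZero 1≤u}} big) ⟩
      u * m + u * m                                    ≡⟨ shuffle′ u m ⟩
      2 * u * m                                        ≡⟨ cong (2 * u *_) (#-partition n q r A n≤rq) ⟩
      2 * u * sum r a                                  ≡⟨ sym (sum-* r (2 * u) a) ⟩
      sum r g                                          ∎
      where
      shuffle : ∀ m u r s → m * u + r * (8 * s * u) ≡ u * m + u * (r * (8 * s))
      shuffle = solve-∀
      shuffle′ : ∀ u m → u * m + u * m ≡ 2 * u * m
      shuffle′ = solve-∀
  ... | b , _ , lt = b * q , block-start n q b A (≤-<-trans z≤n 4s<) , ≤-trans (m≤m+n _ _) (<⇒≤ lt) , 4s<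
    where
    4s< : 4 * s < # n (λ x → A x ∧ interval (b * q) q x)
    4s< = *-cancelˡ-< (2 * # n U) _ _ (≤-<-trans (≤-trans (≤-reflexive (shuffle (# n U) s)) (m≤n+m _ _)) lt)
      where
      shuffle : ∀ u s → 2 * u * (4 * s) ≡ 8 * s * u
      shuffle = solve-∀

  -- Among the j factors 1 + 1 / y there are c groups of y, each contributing at least 2 by
  -- `doubling`; the remaining o factors are at least 1.
  growth : ∀ y c j → 1 ≤ y → y * c ≤ j → 2 ^ c * y ^ j ≤ suc y ^ j
  growth y c j 1≤y yc≤j with m≤n⇒∃[o]m+o≡n yc≤j
  ... | o , refl = begin
    2 ^ c * y ^ (y * c + o)             ≡⟨ cong (2 ^ c *_) (^-distribˡ-+-* y (y * c) o) ⟩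
    2 ^ c * (y ^ (y * c) * y ^ o)       ≡⟨ sym (*-assoc (2 ^ c) _ _) ⟩
    2 ^ c * y ^ (y * c) * y ^ o         ≡⟨ cong (λ z → 2 ^ c * z * y ^ o) (sym (^-*-assoc y y c)) ⟩
    2 ^ c * (y ^ y) ^ c * y ^ o         ≡⟨ cong (_* y ^ o) (sym (*-^ c 2 (y ^ y))) ⟩
    (2 * y ^ y) ^ c * y ^ o             ≤⟨ *-mono-≤ (^-monoˡ-≤ c (doubling y 1≤y)) (^-monoˡ-≤ o (n≤1+n y)) ⟩
    (suc y ^ y) ^ c * suc y ^ o         ≡⟨ cong (_* suc y ^ o) (^-*-assoc (suc y) y c) ⟩
    suc y ^ (y * c) * suc y ^ o         ≡⟨ sym (^-distribˡ-+-* (suc y) (y * c) o) ⟩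
    suc y ^ (y * c + o)                 ∎
    where open ≤-Reasoning

  -- Rephrases the shrinking of U by factors 1 - 1 / x as one by 1 / (1 + 1 / x).
  shrunk : ∀ x j u n → 1 ≤ x → (2 * x) ^ j * u ≤ (2 * x ∸ 2) ^ j * n → suc x ^ j * u ≤ x ^ j * n
  shrunk x@(suc w) j u n _ h = *-cancelˡ-≤ ((2 * x) ^ j) {{m^n≢0 (2 * x) j}} (begin
    (2 * x) ^ j * (suc x ^ j * u)             ≡⟨ shuffle ((2 * x) ^ j) (suc x ^ j) u ⟩
    suc x ^ j * ((2 * x) ^ j * u)             ≤⟨ *-monoʳ-≤ (suc x ^ j) h ⟩
    suc x ^ j * ((2 * x ∸ 2) ^ j * n)         ≡⟨ sym (*-assoc (suc x ^ j) _ n) ⟩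
    suc x ^ j * (2 * x ∸ 2) ^ j * n           ≡⟨ cong (_* n) (sym (*-^ j (suc x) (2 * x ∸ 2))) ⟩
    (suc x * (2 * x ∸ 2)) ^ j * n             ≤⟨ *-monoˡ-≤ n (^-monoˡ-≤ j base) ⟩
    (2 * x * x) ^ j * n                       ≡⟨ cong (_* n) (*-^ j (2 * x) x) ⟩
    (2 * x) ^ j * x ^ j * n                   ≡⟨ *-assoc ((2 * x) ^ j) (x ^ j) n ⟩
    (2 * x) ^ j * (x ^ j * n)                 ∎)
    where
    open ≤-Reasoning
    shuffle : ∀ a b c → a * (b * c) ≡ b * (a * c)
    shuffle = solve-∀
    base : suc x * (2 * x ∸ 2) ≤ 2 * x * x
    base = begin
      suc x * (2 * x ∸ 2)     ≡⟨ cong (λ z → suc x * (z ∸ 2)) (*-suc 2 w) ⟩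
      suc x * (2 * w)         ≤⟨ m≤m+n _ 2 ⟩
      suc x * (2 * w) + 2     ≡⟨ square w ⟩
      2 * x * x               ∎
      where
      square : ∀ w → suc (suc w) * (2 * w) + 2 ≡ 2 * suc w * suc w
      square = solve-∀

  -- With r = a / 2 p, the density of A inside P, (1 + r) (p - a) ≤ p - 2 s.
  amplify : ∀ n m u p a s j → 1 ≤ u → 1 ≤ p → a ≤ p → 4 * s ≤ a → m * p ≤ 2 * u * a →
            2 * n * (4 * u) ^ j ≤ m * (4 * u + m) ^ j →
            2 * n * (p ∸ a) ^ j ≤ m * (p ∸ 2 * s) ^ j
  amplify n m u p a s j 1≤u 1≤p a≤p 4s≤a dens h = *-cancelˡ-≤ ((2 * p) ^ j * (4 * u) ^ j) {{nz}} (begin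
    (2 * p) ^ j * (4 * u) ^ j * (2 * n * (p ∸ a) ^ j)       ≡⟨ shuffle₁ ((2 * p) ^ j) ((4 * u) ^ j) (2 * n) ((p ∸ a) ^ j) ⟩
    (2 * n * (4 * u) ^ j) * ((2 * p) ^ j * (p ∸ a) ^ j)     ≤⟨ *-monoˡ-≤ _ h ⟩
    (m * (4 * u + m) ^ j) * ((2 * p) ^ j * (p ∸ a) ^ j)     ≡⟨ shuffle₂ m ((4 * u + m) ^ j) ((2 * p) ^ j) ((p ∸ a) ^ j) ⟩
    m * ((p ∸ a) ^ j * ((2 * p) ^ j * (4 * u + m) ^ j))     ≡⟨ cong (λ z → m * ((p ∸ a) ^ j * z)) (sym (*-^ j (2 * p) (4 * u + m))) ⟩
    m * ((p ∸ a) ^ j * (2 * p * (4 * u + m)) ^ j)           ≤⟨ *-monoʳ-≤ m (*-monoʳ-≤ ((p ∸ a) ^ j) (^-monoˡ-≤ j denser)) ⟩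
    m * ((p ∸ a) ^ j * ((2 * p + a) * (4 * u)) ^ j)         ≡⟨ cong (λ z → m * ((p ∸ a) ^ j * z)) (*-^ j (2 * p + a) (4 * u)) ⟩
    m * ((p ∸ a) ^ j * ((2 * p + a) ^ j * (4 * u) ^ j))     ≡⟨ shuffle₃ m ((p ∸ a) ^ j) ((2 * p + a) ^ j) ((4 * u) ^ j) ⟩
    (p ∸ a) ^ j * (2 * p + a) ^ j * (m * (4 * u) ^ j)       ≡⟨ cong (_* (m * (4 * u) ^ j)) (sym (*-^ j (p ∸ a) (2 * p + a))) ⟩
    ((p ∸ a) * (2 * p + a)) ^ j * (m * (4 * u) ^ j)         ≤⟨ *-monoˡ-≤ (m * (4 * u) ^ j) (^-monoˡ-≤ j fewer) ⟩
    (2 * p * (p ∸ 2 * s)) ^ j * (m * (4 * u) ^ j)           ≡⟨ cong (_* (m * (4 * u) ^ j)) (*-^ j (2 * p) (p ∸ 2 * s)) ⟩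
    (2 * p) ^ j * (p ∸ 2 * s) ^ j * (m * (4 * u) ^ j)       ≡⟨ shuffle₄ ((2 * p) ^ j) ((p ∸ 2 * s) ^ j) m ((4 * u) ^ j) ⟩
    (2 * p) ^ j * (4 * u) ^ j * (m * (p ∸ 2 * s) ^ j)       ∎)
    where
    open ≤-Reasoning
    nz : NonZero ((2 * p) ^ j * (4 * u) ^ j)
    nz = m*n≢0 ((2 * p) ^ j) ((4 * u) ^ j) {{m^n≢0 (2 * p) j {{m*n≢0 2 p {{_}} {{>-nonZero 1≤p}}}}}} {{m^n≢0 (4 * u) j {{m*n≢0 4 u {{_}} {{>-nonZero 1≤u}}}}}}
    shuffle₁ : ∀ a b c d → a * b * (c * d) ≡ c * b * (a * d)
    shuffle₁ = solve-∀
    shuffle₂ : ∀ a b c d → a * b * (c * d) ≡ a * (d * (c * b))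
    shuffle₂ = solve-∀
    shuffle₃ : ∀ a b c d → a * (b * (c * d)) ≡ b * c * (a * d)
    shuffle₃ = solve-∀
    shuffle₄ : ∀ a b c d → a * b * (c * d) ≡ a * d * (c * b)
    shuffle₄ = solve-∀
    -- That is, 1 + m / 4 u ≤ 1 + a / 2 p.
    denser : 2 * p * (4 * u + m) ≤ (2 * p + a) * (4 * u)
    denser = begin
      2 * p * (4 * u + m)             ≡⟨ expand p u m ⟩
      8 * p * u + 2 * (m * p)         ≤⟨ +-monoʳ-≤ (8 * p * u) (*-monoʳ-≤ 2 dens) ⟩
      8 * p * u + 2 * (2 * u * a)     ≡⟨ expand′ p u a ⟩
      (2 * p + a) * (4 * u)           ∎
      where
      expand : ∀ p u m → 2 * p * (4 * u + m) ≡ 8 * p * u + 2 * (m * p)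
      expand = solve-∀
      expand′ : ∀ p u a → 8 * p * u + 2 * (2 * u * a) ≡ (2 * p + a) * (4 * u)
      expand′ = solve-∀
    fewer : (p ∸ a) * (2 * p + a) ≤ 2 * p * (p ∸ 2 * s)
    fewer with m≤n⇒∃[o]m+o≡n a≤p
    ... | o , refl = begin
      (a + o ∸ a) * (2 * (a + o) + a)   ≡⟨ cong (_* (2 * (a + o) + a)) (m+n∸m≡n a o) ⟩
      o * (2 * (a + o) + a)             ≤⟨ +-cancelʳ-≤ (2 * (a + o) * (2 * s)) _ _ (begin
        o * (2 * (a + o) + a) + 2 * (a + o) * (2 * s) ≡⟨ cong (o * (2 * (a + o) + a) +_) (quad (a + o) s) ⟩
        o * (2 * (a + o) + a) + (a + o) * (4 * s)     ≤⟨ +-monoʳ-≤ (o * (2 * (a + o) + a)) (*-monoʳ-≤ (a + o) 4s≤a) ⟩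
        o * (2 * (a + o) + a) + (a + o) * a           ≤⟨ m≤m+n _ (a * a) ⟩
        o * (2 * (a + o) + a) + (a + o) * a + a * a   ≡⟨ expand a o ⟩
        2 * (a + o) * (a + o)                         ≡⟨ cong (2 * (a + o) *_) (sym (m∸n+n≡m 2s≤)) ⟩
        2 * (a + o) * (a + o ∸ 2 * s + 2 * s)         ≡⟨ *-distribˡ-+ (2 * (a + o)) _ (2 * s) ⟩
        2 * (a + o) * (a + o ∸ 2 * s) + 2 * (a + o) * (2 * s) ∎) ⟩
      2 * (a + o) * (a + o ∸ 2 * s)     ∎
      where
      quad : ∀ p s → 2 * p * (2 * s) ≡ p * (4 * s)
      quad = solve-∀
      expand : ∀ a o → o * (2 * (a + o) + a) + (a + o) * a + a * a ≡ 2 * (a + o) * (a + o)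
      expand = solve-∀
      2s≤ : 2 * s ≤ a + o
      2s≤ = ≤-trans (*-monoˡ-≤ s {2} {4} (s≤s (s≤s z≤n))) (≤-trans 4s≤a (m≤m+n a o))

  logarithm : ∀ n → 1 ≤ n → ∃[ L ] (2 ^ L ≤ n × n < 2 ^ suc L)
  logarithm (suc zero)    _ = 0 , ≤-refl , ≤-refl
  logarithm (suc (suc n)) _ with logarithm (suc n) (s≤s z≤n)
  ... | L , lo , hi with suc (suc n) <? 2 ^ suc L
  ...   | yes lt = L , m≤n⇒m≤1+n lo , lt
  ...   | no  ge = suc L , ≮⇒≥ ge , <-≤-trans (s≤s hi) (begin
    suc (2 ^ suc L)           ≤⟨ +-monoˡ-≤ (2 ^ suc L) (m^n>0 2 (suc L)) ⟩
    2 ^ suc L + 2 ^ suc L     ≡⟨ cong (2 ^ suc L +_) (sym (+-identityʳ _)) ⟩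
    2 ^ suc (suc L)           ∎)
    where open ≤-Reasoning

  exponential-step : ∀ c l → 3 ≤ l → c * (l * l) ≤ 2 ^ l → c * (suc l * suc l) ≤ 2 ^ suc l
  exponential-step c l 3≤l h = begin
    c * (suc l * suc l)      ≤⟨ *-monoʳ-≤ c square ⟩
    c * (2 * (l * l))        ≡⟨ shuffle c (l * l) ⟩
    2 * (c * (l * l))        ≤⟨ *-monoʳ-≤ 2 h ⟩
    2 * 2 ^ l                ∎
    where
    open ≤-Reasoning
    shuffle : ∀ c x → c * (2 * x) ≡ 2 * (c * x)
    shuffle = solve-∀
    square : suc l * suc l ≤ 2 * (l * l)
    square = begin
      suc l * suc l           ≡⟨ expand l ⟩
      l * l + (2 * l + 1)     ≤⟨ +-monoʳ-≤ (l * l) (begin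
        2 * l + 1             ≤⟨ +-monoʳ-≤ (2 * l) (≤-trans (s≤s z≤n) 3≤l) ⟩
        2 * l + l             ≡⟨ triple l ⟩
        3 * l                 ≤⟨ *-monoˡ-≤ l 3≤l ⟩
        l * l                 ∎) ⟩
      l * l + l * l           ≡⟨ cong (l * l +_) (sym (+-identityʳ (l * l))) ⟩
      2 * (l * l)             ∎
      where
      expand : ∀ l → suc l * suc l ≡ l * l + (2 * l + 1)
      expand = solve-∀
      triple : ∀ l → 2 * l + l ≡ 3 * l
      triple = solve-∀

  exponential-beats-square : ∀ c → c * (21 * 21) ≤ 2 ^ 21 → ∀ o → c * ((o + 21) * (o + 21)) ≤ 2 ^ (o + 21)
  exponential-beats-square c base zero    = base
  exponential-beats-square c base (suc o) =
    exponential-step c (o + 21) (≤-trans (≤ᵇ⇒≤ 3 21 _) (m≤n+m 21 o)) (exponential-beats-square c base o)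

  -- What the analysis needs of the parameters, given a biclique of size m.
  record Parameters (n m d E : ℕ) : Set where
    field
      j q M r : ℕ
      {{q≢0}} : NonZero q
      1≤d     : 1 ≤ d
      D<n     : 16 * d < n
      q<n     : q < n
      j<n     : j < n
      q^j<n   : q ^ j < n
      q^j<M   : q ^ j < M
      enough  : 2 * (2 ^ E * (d * E)) ≤ M
      M≤m     : M ≤ m
      descend : 2 * ((16 * d) ^ j * M) ≤ m
      cover   : n ≤ r * q
      blocks  : r * (8 * (d * E)) < m
      boost   : ∀ u a p → m ≤ u → (16 * d) ^ j * u ≤ (16 * d ∸ 2) ^ j * n → 1 ≤ p → a ≤ p → 4 * (d * E) ≤ a → m * p ≤ 2 * u * a →
                2 * n * (p ∸ a) ^ j ≤ m * (p ∸ 2 * (d * E)) ^ j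

  module Choose (C₀ : ℕ) (C₀-large : 128 * (128 * 128) * 384 * 2 ≤ C₀) (n m L ℓ : ℕ) (1≤m : 1 ≤ m) (2^L≤n : 2 ^ L ≤ n) (L<2^ℓ : L < 2 ^ ℓ) (large : 1536 * (ℓ * ℓ) ≤ L)
                (4≤ℓ : 4 ≤ ℓ) (few : n < m * (L * (L * L))) where

    open ≤-Reasoning

    instance
      ℓ≢0 : NonZero ℓ
      ℓ≢0 = >-nonZero (≤-trans (s≤s z≤n) 4≤ℓ)
      64ℓ≢0 : NonZero (64 * ℓ)
      64ℓ≢0 = m*n≢0 64 ℓ
      m≢0 : NonZero m
      m≢0 = >-nonZero 1≤m

    1≤ℓ : 1 ≤ ℓ
    1≤ℓ = ≤-trans (s≤s z≤n) 4≤ℓ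

    -- The constant 64 gives n ≥ 2 ^ (64 E), which leaves room for q ^ j = 2 ^ (7 E), M = 2 ^ (8 E),
    -- D ^ j ≤ 2 ^ (2 E) and k ≤ 2 ^ (3 E), the last of which makes m > 2 ^ (61 E). `k` is n / m
    -- rounded up past equality, and `y` is chosen for (1 + 1 / y) ^ j ≥ 2 ^ (2 ℓ + 1).
    j E k y : ℕ
    j = L / (64 * ℓ)
    E = ℓ * j
    k = suc (n / m)
    y = j / suc (2 * ℓ)

    64E≤L : 64 * E ≤ L
    64E≤L = ≤-trans (≤-reflexive (shuffle 64 ℓ j)) (m/n*n≤m L (64 * ℓ))
      where
      shuffle : ∀ c l j → c * (l * j) ≡ j * (c * l)
      shuffle = solve-∀

    24ℓ≤j : 24 * ℓ ≤ j
    24ℓ≤j = ≤-trans (≤-reflexive (sym (m*n/n≡m (24 * ℓ) (64 * ℓ)))) (/-monoˡ-≤ (64 * ℓ) (≤-trans (≤-reflexive (shuffle 24 64 ℓ)) large))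
      where
      shuffle : ∀ a b l → a * l * (b * l) ≡ a * b * (l * l)
      shuffle = solve-∀

    1≤j : 1 ≤ j
    1≤j = ≤-trans (≤-trans 1≤ℓ (m≤n*m ℓ 24)) 24ℓ≤j

    ℓ≤E : ℓ ≤ E
    ℓ≤E = m≤m*n ℓ j {{>-nonZero 1≤j}}

    1≤E : 1 ≤ E
    1≤E = ≤-trans 1≤ℓ ℓ≤E

    j≤E : j ≤ E
    j≤E = m≤n*m j ℓ

    64j≤L : 64 * j ≤ L
    64j≤L = ≤-trans (*-monoʳ-≤ 64 j≤E) 64E≤L

    L≤128E : L ≤ 128 * E
    L≤128E = begin
      L                       ≤⟨ <⇒≤ (m<[1+m/n]*n L (64 * ℓ)) ⟩
      suc j * (64 * ℓ)        ≡⟨ shuffle 64 ℓ j ⟩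
      64 * (ℓ * j) + 64 * ℓ   ≤⟨ +-monoʳ-≤ (64 * E) (*-monoʳ-≤ 64 ℓ≤E) ⟩
      64 * E + 64 * E         ≡⟨ sym (*-distribʳ-+ E 64 64) ⟩
      128 * E                 ∎
      where
      shuffle : ∀ c l j → suc j * (c * l) ≡ c * (l * j) + c * l
      shuffle = solve-∀

    2^-≤ : ∀ {a b} → a ≤ b → 2 ^ a ≤ 2 ^ b
    2^-≤ = ^-monoʳ-≤ 2

    L²≤ : L * L ≤ 2 ^ (2 * ℓ)
    L²≤ = ≤-trans (*-mono-≤ (<⇒≤ L<2^ℓ) (<⇒≤ L<2^ℓ)) (≤-reflexive (trans (sym (^-distribˡ-+-* 2 ℓ ℓ)) (cong (2 ^_) (shuffle ℓ))))
      where
      shuffle : ∀ l → l + l ≡ 2 * l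
      shuffle = solve-∀

    L³≤ : L * (L * L) ≤ 2 ^ (3 * ℓ)
    L³≤ = ≤-trans (*-mono-≤ (<⇒≤ L<2^ℓ) L²≤) (≤-reflexive (sym (^-distribˡ-+-* 2 ℓ (2 * ℓ))))

    n<km : n < k * m
    n<km = m<[1+m/n]*n n m

    n/m<L³ : n / m < L * (L * L)
    n/m<L³ = m<n*o⇒m/o<n (subst (n <_) (*-comm m _) few)

    k≤2^3ℓ : k ≤ 2 ^ (3 * ℓ)
    k≤2^3ℓ = ≤-trans n/m<L³ L³≤

    2^61E<m : 2 ^ (61 * E) < m
    2^61E<m = *-cancelˡ-< (2 ^ (3 * E)) _ _ (begin-strict
      2 ^ (3 * E) * 2 ^ (61 * E)    ≡⟨ sym (^-distribˡ-+-* 2 (3 * E) (61 * E)) ⟩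
      2 ^ (3 * E + 61 * E)          ≡⟨ cong (2 ^_) (sym (*-distribʳ-+ E 3 61)) ⟩
      2 ^ (64 * E)                  ≤⟨ 2^-≤ 64E≤L ⟩
      2 ^ L                         ≤⟨ 2^L≤n ⟩
      n                             <⟨ n<km ⟩
      k * m                         ≤⟨ *-monoˡ-≤ m (≤-trans k≤2^3ℓ (2^-≤ (*-monoʳ-≤ 3 ℓ≤E))) ⟩
      2 ^ (3 * E) * m               ∎)

    module WithRate (d : ℕ) (1≤d : 1 ≤ d) (d≤j² : d ≤ j * j)
                    (boost : ∀ u → m ≤ u → suc (8 * d) ^ j * u ≤ (8 * d) ^ j * n →
                             2 * n * (4 * u) ^ j ≤ m * (4 * u + m) ^ j) where

      -- Both 16 s and k are at most 2 ^ (3 ℓ), so `q` exceeds 16 s k; this makes the blocks long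
      -- enough to contain more than 8 s vertices of A on average. `M` exceeds q ^ j, the number of
      -- vertices that one pruning can remove.
      s q M r : ℕ
      s = d * E
      q = 2 ^ (7 * ℓ)
      M = 2 ^ (8 * E)

      instance
        q≢0 : NonZero q
        q≢0 = m^n≢0 2 (7 * ℓ)

      r = suc (n / q)

      1≤s : 1 ≤ s
      1≤s = *-mono-≤ 1≤d 1≤E

      16d≤ : 16 * d ≤ 2 ^ (2 * ℓ)
      16d≤ = begin
        16 * d                ≤⟨ *-mono-≤ {16} {64 * 64} (≤ᵇ⇒≤ 16 4096 _) d≤j² ⟩
        64 * 64 * (j * j)     ≡⟨ [m*n]*[o*p]≡[m*o]*[n*p] 64 64 j j ⟩
        64 * j * (64 * j)     ≤⟨ *-mono-≤ 64j≤L 64j≤L ⟩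
        L * L                 ≤⟨ L²≤ ⟩
        2 ^ (2 * ℓ)           ∎

      16s≤ : 16 * s ≤ 2 ^ (3 * ℓ)
      16s≤ = begin
        16 * (d * E)          ≡⟨ sym (*-assoc 16 d E) ⟩
        16 * d * E            ≤⟨ *-mono-≤ 16d≤ (≤-trans (≤-trans (m≤n*m E 64) 64E≤L) (<⇒≤ L<2^ℓ)) ⟩
        2 ^ (2 * ℓ) * 2 ^ ℓ   ≡⟨ sym (^-distribˡ-+-* 2 (2 * ℓ) ℓ) ⟩
        2 ^ (2 * ℓ + ℓ)       ≡⟨ cong (2 ^_) (shuffle ℓ) ⟩
        2 ^ (3 * ℓ)           ∎
        where
        shuffle : ∀ l → 2 * l + l ≡ 3 * l
        shuffle = solve-∀

      s≤2^3E : s ≤ 2 ^ (3 * E)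
      s≤2^3E = ≤-trans (m≤n*m s 16) (≤-trans 16s≤ (2^-≤ (*-monoʳ-≤ 3 ℓ≤E)))

      below-n : ∀ {x} c → c < 64 → x ≤ 2 ^ (c * E) → x < n
      below-n {x} c c<64 x≤ = begin-strict
        x                 ≤⟨ x≤ ⟩
        2 ^ (c * E)       <⟨ ^-monoʳ-< 2 (s≤s (s≤s z≤n)) (*-monoˡ-< E {{>-nonZero 1≤E}} c<64) ⟩
        2 ^ (64 * E)      ≤⟨ 2^-≤ 64E≤L ⟩
        2 ^ L             ≤⟨ 2^L≤n ⟩
        n                 ∎

      j<2^j : ∀ j → j ≤ 2 ^ j
      j<2^j zero    = z≤n
      j<2^j (suc j) = ≤-trans (+-mono-≤ (m^n>0 2 j) (j<2^j j)) (≤-reflexive (cong (2 ^ j +_) (sym (+-identityʳ _))))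

      q^j≡ : q ^ j ≡ 2 ^ (7 * E)
      q^j≡ = trans (^-*-assoc 2 (7 * ℓ) j) (cong (2 ^_) (*-assoc 7 ℓ j))

      D^j≤ : (16 * d) ^ j ≤ 2 ^ (2 * E)
      D^j≤ = ≤-trans (^-monoˡ-≤ j 16d≤) (≤-reflexive (trans (^-*-assoc 2 (2 * ℓ) j) (cong (2 ^_) (*-assoc 2 ℓ j))))

      parameters : Parameters n m d E
      parameters = record
        { j = j ; q = q ; M = M ; r = r
        ; q≢0 = q≢0
        ; 1≤d = 1≤d
        ; D<n = below-n 2 (≤ᵇ⇒≤ 3 64 _) (≤-trans 16d≤ (2^-≤ (*-monoʳ-≤ 2 ℓ≤E)))
        ; q<n = below-n 7 (≤ᵇ⇒≤ 8 64 _) (2^-≤ (*-monoʳ-≤ 7 ℓ≤E))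
        ; j<n = below-n 1 (≤ᵇ⇒≤ 2 64 _) (≤-trans (j<2^j j) (2^-≤ (≤-trans j≤E (≤-reflexive (sym (*-identityˡ E))))))
        ; q^j<n = below-n 7 (≤ᵇ⇒≤ 8 64 _) (≤-reflexive q^j≡)
        ; q^j<M = subst (_< M) (sym q^j≡) (^-monoʳ-< 2 (s≤s (s≤s z≤n)) (*-monoˡ-< E {{>-nonZero 1≤E}} (≤ᵇ⇒≤ 8 8 _)))
        ; enough = begin
            2 * (2 ^ E * s)                 ≤⟨ *-monoʳ-≤ 2 (*-monoʳ-≤ (2 ^ E) s≤2^3E) ⟩
            2 * (2 ^ E * 2 ^ (3 * E))       ≡⟨ cong (2 *_) (sym (^-distribˡ-+-* 2 E (3 * E))) ⟩
            2 ^ suc (E + 3 * E)             ≤⟨ 2^-≤ (≤-trans (+-monoˡ-≤ (E + 3 * E) 1≤E) (≤-trans (≤-reflexive (five E)) (*-monoˡ-≤ E (≤ᵇ⇒≤ 5 8 _)))) ⟩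
            2 ^ (8 * E)                     ∎
        ; M≤m = <⇒≤ (≤-<-trans (2^-≤ (*-monoˡ-≤ E (≤ᵇ⇒≤ 8 61 _))) 2^61E<m)
        ; descend = begin
            2 * ((16 * d) ^ j * M)          ≤⟨ *-monoʳ-≤ 2 (*-monoˡ-≤ M D^j≤) ⟩
            2 * (2 ^ (2 * E) * M)           ≡⟨ cong (2 *_) (sym (^-distribˡ-+-* 2 (2 * E) (8 * E))) ⟩
            2 ^ suc (2 * E + 8 * E)         ≤⟨ 2^-≤ (≤-trans (+-monoˡ-≤ (2 * E + 8 * E) 1≤E) (≤-trans (≤-reflexive (eleven E)) (*-monoˡ-≤ E (≤ᵇ⇒≤ 11 61 _)))) ⟩
            2 ^ (61 * E)                    ≤⟨ <⇒≤ 2^61E<m ⟩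
            m                               ∎
        ; cover = <⇒≤ (m<[1+m/n]*n n q)
        -- After multiplication by 2 q, the two parts of r q ≤ q + n are compared with q m
        -- separately.
        ; blocks = *-cancelˡ-< (2 * q) _ _ (begin-strict
            2 * q * (r * (8 * s))           ≡⟨ regroup q r s ⟩
            16 * s * (r * q)                ≤⟨ *-monoʳ-≤ (16 * s) (+-monoʳ-≤ q (m/n*n≤m n q)) ⟩
            16 * s * (q + n)                ≡⟨ *-distribˡ-+ (16 * s) q n ⟩
            16 * s * q + 16 * s * n         <⟨ +-mono-≤-< sq≤ sn< ⟩
            q * m + q * m                   ≡⟨ twice q m ⟩
            2 * q * m                       ∎)
        ; boost = λ u a p m≤u h 1≤p a≤p 4s≤a dens →
            amplify n m u p a s j (≤-trans 1≤m m≤u) 1≤p a≤p 4s≤a dens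
              (boost u m≤u (shrunk (8 * d) j u n (≤-trans 1≤d (m≤n*m d 8))
                (subst (λ z → z ^ j * u ≤ (z ∸ 2) ^ j * n) (*-assoc 2 8 d) h)))
        }
        where
        five : ∀ e → e + (e + 3 * e) ≡ 5 * e
        five = solve-∀
        eleven : ∀ e → e + (2 * e + 8 * e) ≡ 11 * e
        eleven = solve-∀
        regroup : ∀ q r s → 2 * q * (r * (8 * s)) ≡ 16 * s * (r * q)
        regroup = solve-∀
        twice : ∀ q m → q * m + q * m ≡ 2 * q * m
        twice = solve-∀
        sq≤ : 16 * s * q ≤ q * m
        sq≤ = ≤-trans (≤-reflexive (*-comm (16 * s) q)) (*-monoʳ-≤ q (≤-trans 16s≤ (≤-trans (2^-≤ (*-mono-≤ {3} {61} (≤ᵇ⇒≤ 3 61 _) ℓ≤E)) (<⇒≤ 2^61E<m))))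
        sn< : 16 * s * n < q * m
        sn< = begin-strict
          16 * s * n                        <⟨ *-monoʳ-< (16 * s) {{m*n≢0 16 s {{_}} {{>-nonZero 1≤s}}}} n<km ⟩
          16 * s * (k * m)                  ≡⟨ sym (*-assoc (16 * s) k m) ⟩
          16 * s * k * m                    ≤⟨ *-monoˡ-≤ m (*-mono-≤ 16s≤ k≤2^3ℓ) ⟩
          2 ^ (3 * ℓ) * 2 ^ (3 * ℓ) * m     ≡⟨ cong (_* m) (sym (^-distribˡ-+-* 2 (3 * ℓ) (3 * ℓ))) ⟩
          2 ^ (3 * ℓ + 3 * ℓ) * m           ≤⟨ *-monoˡ-≤ m (2^-≤ (≤-trans (≤-reflexive (six ℓ)) (*-monoˡ-≤ ℓ (≤ᵇ⇒≤ 6 7 _)))) ⟩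
          q * m                             ∎
          where
          six : ∀ l → 3 * l + 3 * l ≡ 6 * l
          six = solve-∀

    private
      Target : ℕ → Set
      Target s = m * (L * (L * L)) ≤ C₀ * (n * (ℓ * (ℓ * ℓ)) * s)

      Chosen : Set
      Chosen = ∃[ d ] ∃[ E ] (Parameters n m d E × Target (d * E))

    1+2ℓ≤3ℓ : suc (2 * ℓ) ≤ 3 * ℓ
    1+2ℓ≤3ℓ = +-monoˡ-≤ (2 * ℓ) 1≤ℓ

    1≤y : 1 ≤ y
    1≤y = ≤-trans (≤-reflexive (sym (n/n≡1 (suc (2 * ℓ))))) (/-monoˡ-≤ (suc (2 * ℓ)) (≤-trans 1+2ℓ≤3ℓ (≤-trans (*-monoˡ-≤ ℓ (≤ᵇ⇒≤ 3 24 _)) 24ℓ≤j)))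

    j≤6ℓy : j ≤ 6 * ℓ * y
    j≤6ℓy = begin
      j                         ≤⟨ <⇒≤ (m<[1+m/n]*n j (suc (2 * ℓ))) ⟩
      suc y * suc (2 * ℓ)       ≤⟨ *-mono-≤ (+-monoˡ-≤ y 1≤y) 1+2ℓ≤3ℓ ⟩
      (y + y) * (3 * ℓ)         ≡⟨ shuffle y ℓ ⟩
      6 * ℓ * y                 ∎
      where
      shuffle : ∀ y l → (y + y) * (3 * l) ≡ 6 * l * y
      shuffle = solve-∀

    y≤j : y ≤ j
    y≤j = m/n≤m j (suc (2 * ℓ))

    km≤2n : m ≤ n → k * m ≤ 2 * n
    km≤2n m≤n = +-mono-≤ m≤n (≤-trans (m/n*n≤m n m) (≤-reflexive (sym (+-identityʳ n))))

    -- The factor 128 ^ 3 comes from the cube of L ≤ 128 E, 384 from the hypothesis, and 2 from k m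
    -- ≤ 2 n. The 384 itself is 6 * 2 * 32: j ≤ 6 ℓ y, rounding d down loses at most 2, and d has
    -- denominator 32 k.
    target : ∀ s → m ≤ n → j * (j * j) ≤ 384 * (k * s) → Target s
    target s m≤n h = begin
      m * (L * (L * L))                                             ≤⟨ *-monoʳ-≤ m (*-mono-≤ L≤128E (*-mono-≤ L≤128E L≤128E)) ⟩
      m * (128 * E * (128 * E * (128 * E)))                         ≡⟨ cube m 128 ℓ j ⟩
      m * (128 * (128 * 128)) * (ℓ * (ℓ * ℓ)) * (j * (j * j))       ≤⟨ *-monoʳ-≤ (m * (128 * (128 * 128)) * (ℓ * (ℓ * ℓ))) h ⟩
      m * (128 * (128 * 128)) * (ℓ * (ℓ * ℓ)) * (384 * (k * s))     ≡⟨ regroup m (128 * (128 * 128)) (ℓ * (ℓ * ℓ)) 384 k s ⟩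
      128 * (128 * 128) * 384 * (k * m * (ℓ * (ℓ * ℓ)) * s)         ≤⟨ *-monoʳ-≤ (128 * (128 * 128) * 384) (*-monoˡ-≤ s (*-monoˡ-≤ (ℓ * (ℓ * ℓ)) (km≤2n m≤n))) ⟩
      128 * (128 * 128) * 384 * (2 * n * (ℓ * (ℓ * ℓ)) * s)         ≡⟨ double (128 * (128 * 128) * 384) n (ℓ * (ℓ * ℓ)) s ⟩
      128 * (128 * 128) * 384 * 2 * (n * (ℓ * (ℓ * ℓ)) * s)         ≤⟨ *-monoˡ-≤ (n * (ℓ * (ℓ * ℓ)) * s) C₀-large ⟩
      C₀ * (n * (ℓ * (ℓ * ℓ)) * s)                              ∎
      where
      cube : ∀ m c l j → m * (c * (l * j) * (c * (l * j) * (c * (l * j)))) ≡ m * (c * (c * c)) * (l * (l * l)) * (j * (j * j))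
      cube = solve-∀
      regroup : ∀ m c l b k s → m * c * l * (b * (k * s)) ≡ c * b * (k * m * l * s)
      regroup = solve-∀
      double : ∀ c n l s → c * (2 * n * l * s) ≡ c * 2 * (n * l * s)
      double = solve-∀

    -- k ≤ j y / 32
    module Moderate (32k≤ : 32 * k ≤ j * y) where

      instance
        32k≢0 : NonZero (32 * k)
        32k≢0 = _

      d : ℕ
      -- The largest d with 32 d k ≤ j y, which is what 4 u ≤ y m requires below.
      d = (j * y) / (32 * k)

      1≤d : 1 ≤ d
      1≤d = ≤-trans (≤-reflexive (sym (n/n≡1 (32 * k)))) (/-monoˡ-≤ (32 * k) 32k≤)

      d≤j² : d ≤ j * j
      d≤j² = ≤-trans (m/n≤m (j * y) (32 * k)) (*-monoʳ-≤ j y≤j)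

      k≤2^2ℓ : k ≤ 2 ^ (2 * ℓ)
      k≤2^2ℓ = ≤-trans (m≤n*m k 32) (≤-trans 32k≤ (≤-trans (*-mono-≤ (≤-trans (m≤n*m j 64) 64j≤L) (≤-trans y≤j (≤-trans (m≤n*m j 64) 64j≤L))) L²≤))

      -- Bernoulli's inequality turns the shrinking of U into j u ≤ 8 d n, and the choice of d then
      -- gives 4 u ≤ y m. Hence (1 + m / 4 u) ^ j ≥ (1 + 1 / y) ^ j ≥ 2 ^ (2 ℓ + 1), while 2 n ≤ 2 k
      -- m and k ≤ 2 ^ (2 ℓ).
      boost : ∀ u → m ≤ u → suc (8 * d) ^ j * u ≤ (8 * d) ^ j * n → 2 * n * (4 * u) ^ j ≤ m * (4 * u + m) ^ j
      boost u m≤u h = *-cancelˡ-≤ (y ^ j) {{m^n≢0 y j {{>-nonZero 1≤y}}}} (begin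
        y ^ j * (2 * n * (4 * u) ^ j)                   ≤⟨ *-monoʳ-≤ (y ^ j) (*-monoˡ-≤ ((4 * u) ^ j) (*-monoʳ-≤ 2 (≤-trans (<⇒≤ n<km) (*-monoˡ-≤ m k≤2^2ℓ)))) ⟩
        y ^ j * (2 * (2 ^ (2 * ℓ) * m) * (4 * u) ^ j)   ≡⟨ regroup (y ^ j) (2 ^ (2 * ℓ)) m ((4 * u) ^ j) ⟩
        m * (2 ^ suc (2 * ℓ) * y ^ j * (4 * u) ^ j)     ≤⟨ *-monoʳ-≤ m (*-monoˡ-≤ ((4 * u) ^ j) (growth y (suc (2 * ℓ)) j 1≤y (m/n*n≤m j (suc (2 * ℓ))))) ⟩
        m * (suc y ^ j * (4 * u) ^ j)                   ≡⟨ cong (m *_) (sym (*-^ j (suc y) (4 * u))) ⟩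
        m * (suc y * (4 * u)) ^ j                       ≤⟨ *-monoʳ-≤ m (^-monoˡ-≤ j (≤-trans (+-monoˡ-≤ (y * (4 * u)) 4u≤ym) (≤-reflexive (distribute y m (4 * u))))) ⟩
        m * (y * (4 * u + m)) ^ j                       ≡⟨ cong (m *_) (*-^ j y (4 * u + m)) ⟩
        m * (y ^ j * (4 * u + m) ^ j)                   ≡⟨ swap m (y ^ j) ((4 * u + m) ^ j) ⟩
        y ^ j * (m * (4 * u + m) ^ j)                   ∎)
        where
        regroup : ∀ a b m c → a * (2 * (b * m) * c) ≡ m * (2 * b * a * c)
        regroup = solve-∀
        distribute : ∀ y m v → y * m + y * v ≡ y * (v + m)
        distribute = solve-∀
        swap : ∀ a b c → a * (b * c) ≡ b * (a * c)
        swap = solve-∀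
        ju≤ : j * u ≤ 8 * d * n
        ju≤ = ≤-trans (≤-trans (m≤n+m (j * u) (8 * d * u)) (≤-reflexive (sym (*-distribʳ-+ u (8 * d) j)))) (*-cancelˡ-≤ ((8 * d) ^ j) {{m^n≢0 (8 * d) j {{>-nonZero (≤-trans 1≤d (m≤n*m d 8))}}}} (begin
          (8 * d) ^ j * ((8 * d + j) * u)       ≡⟨ sym (*-assoc ((8 * d) ^ j) (8 * d + j) u) ⟩
          (8 * d) ^ j * (8 * d + j) * u         ≤⟨ *-monoˡ-≤ u (bernoulli (8 * d) j) ⟩
          suc (8 * d) ^ j * (8 * d) * u         ≡⟨ rotate (suc (8 * d) ^ j) (8 * d) u ⟩
          8 * d * (suc (8 * d) ^ j * u)         ≤⟨ *-monoʳ-≤ (8 * d) h ⟩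
          8 * d * ((8 * d) ^ j * n)             ≡⟨ swap (8 * d) ((8 * d) ^ j) n ⟩
          (8 * d) ^ j * (8 * d * n)             ∎))
          where
          rotate : ∀ a b c → a * b * c ≡ b * (a * c)
          rotate = solve-∀
        4u≤ym : 4 * u ≤ y * m
        4u≤ym = *-cancelˡ-≤ j {{>-nonZero 1≤j}} (begin
          j * (4 * u)                ≡⟨ swap j 4 u ⟩
          4 * (j * u)                ≤⟨ *-monoʳ-≤ 4 ju≤ ⟩
          4 * (8 * d * n)            ≤⟨ *-monoʳ-≤ 4 (*-monoʳ-≤ (8 * d) (<⇒≤ n<km)) ⟩
          4 * (8 * d * (k * m))      ≡⟨ collect 4 8 d k m ⟩
          d * (32 * k) * m           ≤⟨ *-monoˡ-≤ m (m/n*n≤m (j * y) (32 * k)) ⟩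
          j * y * m                  ≡⟨ *-assoc j y m ⟩
          j * (y * m)                ∎)
          where
          collect : ∀ a b d k m → a * (b * d * (k * m)) ≡ d * (a * b * k) * m
          collect = solve-∀

      chosen : m ≤ n → Chosen
      chosen m≤n = d , E , WithRate.parameters d 1≤d d≤j² boost , target (d * E) m≤n (begin
        j * (j * j)                                 ≤⟨ *-monoʳ-≤ j (*-monoʳ-≤ j j≤6ℓy) ⟩
        j * (j * (6 * ℓ * y))                       ≡⟨ collect j 6 ℓ y ⟩
        6 * ℓ * j * (j * y)                         ≤⟨ *-monoʳ-≤ (6 * ℓ * j) (≤-trans (<⇒≤ (m<[1+m/n]*n (j * y) (32 * k))) (*-monoˡ-≤ (32 * k) (+-monoˡ-≤ d 1≤d))) ⟩
        6 * ℓ * j * ((d + d) * (32 * k))            ≡⟨ collect′ 384 E 6 ℓ j d 32 k refl refl ⟩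
        384 * (k * (d * E))                         ∎)
        where
        collect : ∀ j a l y → j * (j * (a * l * y)) ≡ a * l * j * (j * y)
        collect = solve-∀
        collect″ : ∀ a l j d b k → a * l * j * ((d + d) * (b * k)) ≡ a * 2 * b * (k * (d * (l * j)))
        collect″ = solve-∀
        collect′ : ∀ c e a l j d b k → c ≡ a * 2 * b → e ≡ l * j → a * l * j * ((d + d) * (b * k)) ≡ c * (k * (d * e))
        collect′ _ _ a l j d b k refl refl = collect″ a l j d b k

    -- k > j y / 32, when already d = 1 suffices.
    module Extreme (32k> : j * y < 32 * k) where

      -- The two assumptions contradict each other: (9 / 8) ^ j ≥ 2 ^ (3 ℓ) ≥ k would make U smaller
      -- than m. So for such k the first phase always ends in an extraction.
      boost : ∀ u → m ≤ u → suc (8 * 1) ^ j * u ≤ (8 * 1) ^ j * n → 2 * n * (4 * u) ^ j ≤ m * (4 * u + m) ^ j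
      boost u m≤u h = contradiction (begin-strict
        2 ^ (3 * ℓ) * u          ≤⟨ *-cancelˡ-≤ (8 ^ j) {{m^n≢0 8 j}} (begin
          8 ^ j * (2 ^ (3 * ℓ) * u)     ≡⟨ rotate (8 ^ j) (2 ^ (3 * ℓ)) u ⟩
          2 ^ (3 * ℓ) * 8 ^ j * u       ≤⟨ *-monoˡ-≤ u (growth 8 (3 * ℓ) j (s≤s z≤n) (≤-trans (≤-reflexive (sym (*-assoc 8 3 ℓ))) 24ℓ≤j)) ⟩
          9 ^ j * u                     ≤⟨ h ⟩
          8 ^ j * n                     ∎) ⟩
        n                        <⟨ n<km ⟩
        k * m                    ≤⟨ *-mono-≤ k≤2^3ℓ m≤u ⟩
        2 ^ (3 * ℓ) * u          ∎) (<-irrefl refl)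
        where
        rotate : ∀ a b c → a * (b * c) ≡ b * a * c
        rotate = solve-∀

      chosen : m ≤ n → Chosen
      chosen m≤n = 1 , E , WithRate.parameters 1 ≤-refl (*-mono-≤ 1≤j 1≤j) boost , target (1 * E) m≤n (begin
        j * (j * j)                   ≤⟨ *-monoʳ-≤ j (*-monoʳ-≤ j j≤6ℓy) ⟩
        j * (j * (6 * ℓ * y))         ≡⟨ collect j 6 ℓ y ⟩
        6 * ℓ * j * (j * y)           ≤⟨ *-monoʳ-≤ (6 * ℓ * j) (<⇒≤ 32k>) ⟩
        6 * ℓ * j * (32 * k)          ≡⟨ collect′ 192 E 6 ℓ j 32 k refl refl ⟩
        192 * (k * (1 * E))           ≤⟨ *-monoˡ-≤ (k * (1 * E)) (≤ᵇ⇒≤ 192 384 _) ⟩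
        384 * (k * (1 * E))           ∎)
        where
        collect : ∀ j a l y → j * (j * (a * l * y)) ≡ a * l * j * (j * y)
        collect = solve-∀
        collect″ : ∀ a l j b k → a * l * j * (b * k) ≡ a * b * (k * (1 * (l * j)))
        collect″ = solve-∀
        collect′ : ∀ c e a l j b k → c ≡ a * b → e ≡ l * j → a * l * j * (b * k) ≡ c * (k * (1 * e))
        collect′ _ _ a l j b k refl refl = collect″ a l j b k

    chosen : m ≤ n → Chosen
    chosen m≤n = case (32 * k ≤? j * y)
      where
      case : Dec (32 * k ≤ j * y) → Chosen
      case (yes le) = Moderate.chosen le m≤n
      case (no gt)  = Extreme.chosen (≰⇒> gt) m≤n

  -- Otherwise m L ^ 3 ≤ n N ^ 3 ≤ C₀ n.
  large-logarithm : ∀ C₀ N n m L → N * (N * N) ≤ C₀ → m ≤ n → C₀ * n < m * (L * (L * L)) → N ≤ L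
  large-logarithm C₀ N n m L N³≤ m≤n few = ≮⇒≥ λ L< → contradiction few (≤⇒≯ (begin
    m * (L * (L * L))         ≤⟨ *-mono-≤ m≤n (*-mono-≤ (<⇒≤ L<) (*-mono-≤ (<⇒≤ L<) (<⇒≤ L<))) ⟩
    n * (N * (N * N))         ≤⟨ *-monoʳ-≤ n N³≤ ⟩
    n * C₀                    ≡⟨ *-comm n C₀ ⟩
    C₀ * n                    ∎))
    where open ≤-Reasoning

  half-square : ∀ a b ℓ x → b ≡ 2 * a → b * (ℓ * ℓ) ≤ 2 * x → a * (ℓ * ℓ) ≤ x
  half-square a b ℓ x refl h = *-cancelˡ-≤ 2 (≤-trans (≤-reflexive (sym (*-assoc 2 a (ℓ * ℓ)))) h)

  choose : ∀ C₀ → 1 ≤ C₀ → 128 * (128 * 128) * 384 * 2 ≤ C₀ → (∀ N → N ≡ 2 ^ 20 → N * (N * N) ≤ C₀) →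
           ∀ n m L ℓ → 1 ≤ m → m ≤ n → 2 ^ L ≤ n → L < 2 ^ ℓ → 2 ^ ℓ ≤ 2 * L →
           m * (L * (L * L)) ≤ C₀ * (n * (ℓ * (ℓ * ℓ)) * 1) ⊎
           ∃[ d ] ∃[ E ] (Parameters n m d E × m * (L * (L * L)) ≤ C₀ * (n * (ℓ * (ℓ * ℓ)) * (d * E)))
  choose C₀ 1≤C₀ C₀-large C₀-larger n m L ℓ 1≤m m≤n 2^L≤n L<2^ℓ 2^ℓ≤2L = case (m * (L * (L * L)) ≤? C₀ * (n * (ℓ * (ℓ * ℓ)) * 1))
    where
    1≤ℓ : 1 ≤ ℓ
    1≤ℓ = n≢0⇒n>0 λ ℓ≡0 → zero-case L (subst (λ l → L < 2 ^ l) ℓ≡0 L<2^ℓ) (subst (λ l → 2 ^ l ≤ 2 * L) ℓ≡0 2^ℓ≤2L)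
      where
      zero-case : ∀ L → L < 1 → 1 ≤ 2 * L → ⊥
      zero-case zero _ ()
      zero-case (suc L) (s≤s ()) _
    n≤nℓ³ : n ≤ n * (ℓ * (ℓ * ℓ)) * 1
    n≤nℓ³ = ≤-trans (≤-reflexive (sym (*-identityʳ n))) (≤-trans (*-monoʳ-≤ n (*-mono-≤ 1≤ℓ (*-mono-≤ 1≤ℓ 1≤ℓ))) (≤-reflexive (sym (*-identityʳ _))))
    case : Dec (m * (L * (L * L)) ≤ C₀ * (n * (ℓ * (ℓ * ℓ)) * 1)) → _
    case (yes le) = inj₁ le
    case (no gt)  = inj₂ (Choose.chosen C₀ C₀-large n m L ℓ 1≤m 2^L≤n L<2^ℓ large (≤-trans (≤ᵇ⇒≤ 4 21 _) 21≤ℓ) few m≤n)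
      where
      few′ : C₀ * n < m * (L * (L * L))
      few′ = ≤-<-trans (*-monoʳ-≤ C₀ n≤nℓ³) (≰⇒> gt)
      few : n < m * (L * (L * L))
      few = ≤-<-trans (≤-trans (≤-reflexive (sym (*-identityˡ n))) (*-monoˡ-≤ n 1≤C₀)) few′
      2^20≤L : ∀ N → N ≡ 2 ^ 20 → N ≤ L
      2^20≤L N eq = large-logarithm C₀ N n m L (C₀-larger N eq) m≤n few′
      -- From 21 on, 3072 ℓ ^ 2 ≤ 2 ^ ℓ. As L < 2 ^ ℓ, it suffices that L ≥ 2 ^ 20, which is why C₀
      -- is required to be at least (2 ^ 20) ^ 3.
      21≤ℓ : 21 ≤ ℓ
      21≤ℓ = ≮⇒≥ λ ℓ<21 → contradiction (<-≤-trans L<2^ℓ (^-monoʳ-≤ 2 (s≤s⁻¹ ℓ<21))) (≤⇒≯ (2^20≤L (2 ^ 20) refl))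
      -- Here 1536 = 64 * 24, so that j ≥ 24 ℓ; and 24 ℓ = 8 * 3 ℓ factors 9 / 8 are enough for 3 ℓ
      -- doublings.
      large : 1536 * (ℓ * ℓ) ≤ L
      large = half-square 1536 3072 ℓ L refl (≤-trans
        (subst (λ z → 3072 * (z * z) ≤ 2 ^ z) (m∸n+n≡m 21≤ℓ) (exponential-beats-square 3072 (≤ᵇ⇒≤ (3072 * (21 * 21)) (2 ^ 21) _) (ℓ ∸ 21))) 2^ℓ≤2L)

-- The algorithm, and the soundness of whatever it records.

module Algorithm where

  open import Data.Fin using (Fin; zero; suc)
  open import Data.List using ([]; _∷_)
  open import Data.Nat hiding (_!)
  open import Data.Nat.Properties
  open import Data.Vec using ([]; _∷_)
  open import Defs using (bit; Memory)
  open Sums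
  open Lang

  v0 : ∀ {m} → Tm (suc m)
  v0 = var zero

  v1 : ∀ {m} → Tm (2 + m)
  v1 = var (suc zero)

  cell : ∀ {m} → ℕ → Tm m
  cell a = a at num 0

  count : ∀ {m} → BT (suc m) → Tm m
  count b = Σ[ if b ‵ num 1 ‵ num 0 ]

  addUp : ∀ {m} → Tm (suc m) → BT (suc m) → Tm m
  addUp t b = Σ[ if b ‵ t ‵ num 0 ]

  never : ∀ {m} → BT m
  never = ~ (num 0 ≼ num 0)

  Vertex : ℕ → Set
  Vertex m = Fin m ⊎ ℕ

  tm : ∀ {m} → Vertex m → Tm m
  tm (inj₁ x) = var x
  tm (inj₂ a) = cell a

  up : ∀ {m} → Vertex m → Vertex (suc m)
  up (inj₁ x) = inj₁ (suc x)
  up (inj₂ a) = inj₂ a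

  -- The orientation is true for the graph itself and false if the two sides
  -- are exchanged.
  edge : ∀ {m} → Bool → Vertex m → Vertex m → BT m
  edge true  x y = nz (1 at (Σ[ tm (up x) ] ⊞ tm y))
  edge false x y = edge true y x

  x0 : ∀ {m} → Vertex (suc m)
  x0 = inj₁ zero

  x1 : ∀ {m} → Vertex (2 + m)
  x1 = inj₁ (suc zero)

  best D′ q′ j′ z′ c′ e′ t′ i′ y′ U′ Q′ P′ V′ V₀′ r′ x′ W′ lo′ ws′ S′ f′ g′ a′ b′ h′ k′ m′ base : ℕ
  best = 4
  D′ = 5
  q′ = 6
  j′ = 7
  z′ = 8
  c′ = 9
  e′ = 10
  t′ = 11
  i′ = 12
  y′ = 13
  U′ = 14
  Q′ = 15
  P′ = 16
  V′ = 17
  V₀′ = 18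
  r′ = 19
  x′ = 20
  W′ = 21
  lo′ = 22
  ws′ = 23
  S′ = 24
  f′ = 25
  g′ = 26
  a′ = 27
  b′ = 28
  h′ = 29
  k′ = 30
  m′ = 31
  base = 32

  -- Records S × W, trimmed to a balanced pair, if it is a biclique larger
  -- than the best one found so far.
  record-trimmed : ℕ → ℕ → Cmd
  record-trimmed target a = target ⟵ᵇ nz (a at v0) & (num 1 ⊞ count (num 1 ⊞ v0 ≼ v1 & nz (a at v0)) ≼ cell m′)

  submit : ℕ → ℕ → Cmd
  submit a b =
    -- With truncated subtraction, x - (x - y) is the minimum of x and y.
    m′ ⟵ count (nz (a at v0)) ⊟ (count (nz (a at v0)) ⊟ count (nz (b at v0))) ⨟
    when (Σ[ count (nz (a at v1) & nz (b at v0) & ~ edge true x1 x0) ] ≼ num 0 & num 1 ⊞ cell best ≼ cell m′)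
      (record-trimmed 2 a ⨟ record-trimmed 3 b ⨟ best ⟵ cell m′)

  submitOriented : Bool → ℕ → ℕ → Cmd
  submitOriented true  a b = submit a b
  submitOriented false a b = submit b a

  eligibleᵇ : ∀ {m} → Bool → BT (suc m)
  eligibleᵇ o = nz (lo′ at v0) & ~ nz (S′ at v0) &
    (addUp (cell D′) (nz (ws′ at v0) & ~ edge o x1 x0) ≼ addUp (num 8) (nz (ws′ at v0)))

  firstᵗ : ∀ {m} → BT (2 + m) → Tm m
  firstᵗ b = count (count (v0 ≼ v1 & b) ≼ num 0)

  -- The current pair is submitted after every choice, so s does not have to be known; the n rounds
  -- include the s-th.
  extract : Bool → ℕ → ℕ → Cmd
  extract o C W =
    lo′ ⟵ᵇ nz (C at v0) & ~ (addUp (num 2) (nz (W at v0)) ≼ addUp (cell D′) (nz (W at v0) & ~ edge o x1 x0)) ⨟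
    ws′ ⟵ᵇ nz (W at v0) & (addUp (cell D′) (nz (lo′ at v0) & ~ edge o x0 x1) ≼ addUp (num 4) (nz (lo′ at v0))) ⨟
    S′ ⟵ᵇ never ⨟
    for g′
      (f′ ⟵ firstᵗ (eligibleᵇ o) ⨟
       S′ ⟵ᵇ ~ (~ nz (S′ at v0) & ~ (v0 ≼ cell f′ & cell f′ ≼ v0)) ⨟
       ws′ ⟵ᵇ nz (ws′ at v0) & edge o (inj₂ f′) x0 ⨟
       submitOriented o S′ ws′)

  -- k′ becomes s + y mod q, and then y becomes y div q.
  nextDigit : ℕ → Cmd
  nextDigit s =
    h′ ⟵ count (addUp (cell q′) (v0 ≼ v1) ≼ cell y′) ⨟
    k′ ⟵ cell s ⊞ (cell y′ ⊟ addUp (cell q′) (num 1 ⊞ v0 ≼ cell h′)) ⨟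
    y′ ⟵ cell h′

  -- A loop always makes n rounds; the guard makes those from the j-th on idle.
  firstPhase : Cmd
  firstPhase =
    U′ ⟵ᵇ ~ never ⨟
    Q′ ⟵ᵇ cell c′ ≼ v0 & num 1 ⊞ v0 ≼ cell c′ ⊞ cell q′ ⨟
    y′ ⟵ cell t′ ⨟
    for i′ (when (num 1 ⊞ cell i′ ≼ cell j′)
      (extract false Q′ U′ ⨟ nextDigit c′ ⨟ U′ ⟵ᵇ nz (U′ at v0) & edge true x0 (inj₂ k′)))

  descent : Cmd
  descent =
    W′ ⟵ V₀′ at v0 ⨟
    y′ ⟵ cell x′ ⨟
    for i′ (when (num 1 ⊞ cell i′ ≼ cell j′)
      (extract true P′ W′ ⨟ nextDigit e′ ⨟
       W′ ⟵ᵇ nz (W′ at v0) & ~ edge true (inj₂ k′) x0 & num 1 ⊞ cell k′ ≼ cell 0 & nz (P′ at cell k′)))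

  pruning : Cmd
  pruning =
    for x′ (when (num 1 ⊞ cell x′ ≼ cell z′)
      (descent ⨟
       f′ ⟵ firstᵗ (nz (W′ at v0) & nz (V′ at v0)) ⨟
       V′ ⟵ᵇ nz (V′ at v0) & ~ (v0 ≼ cell f′ & cell f′ ≼ v0)))

  secondPhase : Cmd
  secondPhase =
    P′ ⟵ᵇ nz (U′ at v0) & cell e′ ≼ v0 & num 1 ⊞ v0 ≼ cell e′ ⊞ cell q′ ⨟
    V′ ⟵ᵇ ~ never ⨟
    for r′ (V₀′ ⟵ V′ at v0 ⨟ pruning)

  -- The number z = q ^ j of sequences is guessed too, instead of being computed. Since loops run
  -- below n, each intended value has to be less than n.
  search : Cmd
  search = for D′ (for q′ (for j′ (for z′ (for c′ (for e′ (for t′ (firstPhase ⨟ secondPhase)))))))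

  singleEdges : Cmd
  singleEdges = for a′ (for b′
    (U′ ⟵ᵇ v0 ≼ cell a′ & cell a′ ≼ v0 ⨟
     V′ ⟵ᵇ v0 ≼ cell b′ & cell b′ ≼ v0 ⨟
     submit U′ V′))

  algorithm : Cmd
  algorithm = singleEdges ⨟ search

  algorithm-wellFormed : wellFormed base algorithm ≡ true
  algorithm-wellFormed = refl

  mem : Memory → ℕ → ℕ → Bool
  mem μ a i = nonzero (μ a i)

  -- The sum of n copies of u is the offset n * u of a row of the matrix, obtained without
  -- multiplication.
  adj : ℕ → Memory → ℕ → ℕ → Bool
  adj n μ u v = nonzero (μ 1 (sum n (λ _ → u) + v))

  orient : Bool → (ℕ → ℕ → Bool) → ℕ → ℕ → Bool
  orient true  e x y = e x y
  orient false e x y = e y x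

  nonzero-if : ∀ b → nonzero (if b then 1 else 0) ≡ b
  nonzero-if true  = refl
  nonzero-if false = refl

  assign-cell : ∀ a t μ {n i} → μ 0 0 ≡ n → i < n → exec (a ⟵ t) μ a i ≡ evalₙ n t μ (i ∷ [])
  assign-cell a t μ refl i<n = trans (if-true (≡ᵇ-refl a)) (if-true (true-≤ᵇ i<n))

  assign-mem : ∀ a b μ {n i} → μ 0 0 ≡ n → i < n → mem (exec (a ⟵ᵇ b) μ) a i ≡ evalᵇₙ n b μ (i ∷ [])
  assign-mem a b μ {n} {i} e i<n = trans (cong nonzero (assign-cell a (if b ‵ num 1 ‵ num 0) μ e i<n)) (nonzero-if (evalᵇₙ n b μ (i ∷ [])))

  #-prefix : ∀ n u a → u ≤ n → # n (λ k → (suc k ≤ᵇ u) ∧ a k) ≡ # u a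
  #-prefix n u a u≤n with m≤n⇒∃[o]m+o≡n u≤n
  ... | o , refl = trans (sum-append u o _) (trans (cong₂ _+_
    (#-cong u λ k k<u → cong (_∧ a k) (true-≤ᵇ k<u))
    (trans (#-cong o λ i _ → cong (_∧ a (u + i)) (false-≤ᵇ (s≤s (m≤m+n u i)))) (#-none o))) (+-identityʳ (# u a)))

  #-trim : ∀ n a m → m ≤ # n a → # n (λ u → a u ∧ (suc (# u a) ≤ᵇ m)) ≡ m
  #-trim n a m m≤ = trans (go n) (m≤n⇒m⊓n≡m m≤)
    where
    go : ∀ n → # n (λ u → a u ∧ (suc (# u a) ≤ᵇ m)) ≡ m ⊓ # n a
    go zero    = sym (⊓-zeroʳ m)
    go (suc n) with a n
    ... | false = trans (+-identityʳ _) (trans (go n) (cong (m ⊓_) (sym (+-identityʳ (# n a)))))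
    ... | true with # n a <? m
    ...   | yes lt = trans (cong₂ _+_ (trans (go n) (m≥n⇒m⊓n≡n (<⇒≤ lt))) (cong bit (true-≤ᵇ lt)))
                       (sym (m≥n⇒m⊓n≡n (≤-trans (≤-reflexive (+-comm (# n a) 1)) lt)))
    ...   | no  ge = trans (cong₂ _+_ (trans (go n) (m≤n⇒m⊓n≡m (≮⇒≥ ge))) (cong bit (false-≤ᵇ (s≤s (≮⇒≥ ge)))))
                       (trans (+-identityʳ m) (sym (m≤n⇒m⊓n≡m (≤-trans (≮⇒≥ ge) (m≤m+n (# n a) 1)))))

  m∸[m∸n]≡m⊓n : ∀ m n → m ∸ (m ∸ n) ≡ m ⊓ n
  m∸[m∸n]≡m⊓n m n with ≤-total m n
  ... | inj₁ m≤n = trans (cong (m ∸_) (m≤n⇒m∸n≡0 m≤n)) (sym (m≤n⇒m⊓n≡m m≤n))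
  ... | inj₂ n≤m = trans (m∸[m∸n]≡n n≤m) (sym (m≥n⇒m⊓n≡n n≤m))

  module Run (n : ℕ) (0<n : 0 < n) (μ₀ : Memory) where

    g : ℕ → ℕ → Bool
    g = adj n μ₀

    -- This holds at every moment and for all values of the parameters, so the output is a biclique
    -- of size `best` however the search went.
    record Sound (μ : Memory) : Set where
      field
        size  : μ 0 0 ≡ n
        graph : ∀ i → μ 1 i ≡ μ₀ 1 i
        left  : # n (mem μ 2) ≡ μ best 0
        right : # n (mem μ 3) ≡ μ best 0
        valid : ∀ u v → u < n → v < n → mem μ 2 u ≡ true → mem μ 3 v ≡ true → g u v ≡ true
    open Sound public

    adj≡ : ∀ {μ} → Sound μ → ∀ u v → adj n μ u v ≡ g u v
    adj≡ S u v = cong nonzero (graph S _)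

    usable : ℕ → Bool
    usable a = (5 ≤ᵇ a) ∧ not (m′ ≡ᵇ a)

    -- Arrays below 5 are only written by `submit`; `usable` keeps its arguments apart from those
    -- arrays and from `m′`, which `submit` overwrites before reading them again.
    data Safe : Cmd → Set where
      submits : ∀ {a b} → usable a ≡ true → usable b ≡ true → Safe (submit a b)
      assigns : ∀ {a t} → (5 ≤ᵇ a) ≡ true → Safe (a ⟵ t)
      _then_  : ∀ {c d} → Safe c → Safe d → Safe (c ⨟ d)
      whens   : ∀ {b c} → Safe c → Safe (when b c)
      fors    : ∀ {a c} → (5 ≤ᵇ a) ≡ true → Safe c → Safe (for a c)
    infixr 2 _then_

    record Improves (μ ν : Memory) : Set where
      constructor _,_
      field
        sound : Sound ν
        grows : μ best 0 ≤ ν best 0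
    open Improves public

    unaffected : ∀ a f μ → (5 ≤ᵇ a) ≡ true → Sound μ → Improves μ (store a f μ)
    unaffected (suc (suc (suc (suc (suc a))))) f μ _ S = record
      { size = size S ; graph = graph S ; left = left S ; right = right S ; valid = valid S } , ≤-refl

    record Submitted (a b : ℕ) (μ ν : Memory) : Set where
      field
        improves : Improves μ ν
        best≥    : (∀ u v → u < n → v < n → mem μ a u ≡ true → mem μ b v ≡ true → g u v ≡ true) →
                   # n (mem μ a) ⊓ # n (mem μ b) ≤ ν best 0

    submit-spec : ∀ a b μ → usable a ≡ true → usable b ≡ true → Sound μ → Submitted a b μ (exec (submit a b) μ)
    submit-spec a@(suc (suc (suc (suc (suc _))))) b@(suc (suc (suc (suc (suc _))))) μ ua ub S = go _ refl
      where
      μ₁ μ₂ μ₃ : Memory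
      μ₁ = exec (m′ ⟵ count (nz (a at v0)) ⊟ (count (nz (a at v0)) ⊟ count (nz (b at v0)))) μ
      μ₂ = exec (record-trimmed 2 a) μ₁
      μ₃ = exec (record-trimmed 3 b) μ₂
      m : ℕ
      m = # n (mem μ a) ⊓ # n (mem μ b)
      keepᵃ : ∀ i → mem μ₁ a i ≡ mem μ a i
      keepᵃ i = cong nonzero (if-false {m′ ≡ᵇ a} (not-true ua))
      keepᵇ : ∀ i → mem μ₁ b i ≡ mem μ b i
      keepᵇ i = cong nonzero (if-false {m′ ≡ᵇ b} (not-true ub))
      m≡ : μ₁ m′ 0 ≡ m
      m≡ = trans (assign-cell m′ (count (nz (a at v0)) ⊟ (count (nz (a at v0)) ⊟ count (nz (b at v0)))) μ (size S) 0<n)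
        (m∸[m∸n]≡m⊓n (# n (mem μ a)) (# n (mem μ b)))
      left′ : ∀ u → u < n → mem μ₂ 2 u ≡ mem μ a u ∧ (suc (# u (mem μ a)) ≤ᵇ m)
      left′ u u<n = trans (assign-mem 2 (nz (a at v0) & (num 1 ⊞ count (num 1 ⊞ v0 ≼ v1 & nz (a at v0)) ≼ cell m′)) μ₁ (size S) u<n)
        (cong₂ _∧_ (keepᵃ u) (cong₂ _≤ᵇ_ (cong suc (trans (#-prefix n u (mem μ₁ a) (<⇒≤ u<n)) (#-cong u λ k _ → keepᵃ k))) m≡))
      right′ : ∀ v → v < n → mem μ₃ 3 v ≡ mem μ b v ∧ (suc (# v (mem μ b)) ≤ᵇ m)
      right′ v v<n = trans (assign-mem 3 (nz (b at v0) & (num 1 ⊞ count (num 1 ⊞ v0 ≼ v1 & nz (b at v0)) ≼ cell m′)) μ₂ (size S) v<n)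
        (cong₂ _∧_ (keepᵇ v) (cong₂ _≤ᵇ_ (cong suc (trans (#-prefix n v (mem μ₁ b) (<⇒≤ v<n)) (#-cong v λ k _ → keepᵇ k))) m≡))
      best′ : exec (best ⟵ cell m′) μ₃ best 0 ≡ m
      best′ = trans (assign-cell best (cell m′) μ₃ (size S) 0<n) m≡
      bad : ℕ
      bad = sum n (λ u → # n (λ v → mem μ₁ a u ∧ mem μ₁ b v ∧ not (adj n μ₁ u v)))
      test : evalᵇ (Σ[ count (nz (a at v1) & nz (b at v0) & ~ edge true x1 x0) ] ≼ num 0 & num 1 ⊞ cell best ≼ cell m′) μ₁ []
             ≡ (bad ≤ᵇ 0) ∧ (suc (μ best 0) ≤ᵇ m)
      test = trans (cong (λ k → evalᵇₙ k (Σ[ count (nz (a at v1) & nz (b at v0) & ~ edge true x1 x0) ] ≼ num 0 & num 1 ⊞ cell best ≼ cell m′) μ₁ []) (size S))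
        (cong (λ k → (bad ≤ᵇ 0) ∧ (suc (μ best 0) ≤ᵇ k)) m≡)
      ok? : (∀ u v → u < n → v < n → mem μ a u ≡ true → mem μ b v ≡ true → g u v ≡ true) → (bad ≤ᵇ 0) ≡ true
      ok? complete = true-≤ᵇ (≤-trans (sum-mono n λ u u<n → ≤-trans (#-mono n {q = λ _ → false} λ v v<n h → absurd u v u<n v<n h) (≤-reflexive (#-none n)))
        (≤-reflexive (trans (sum-const n 0) (*-zeroʳ n))))
        where
        absurd : ∀ u v → u < n → v < n → mem μ₁ a u ∧ mem μ₁ b v ∧ not (adj n μ₁ u v) ≡ true → false ≡ true
        absurd u v u<n v<n h with ∧-true {mem μ₁ a u} h
        ... | au , h′ with ∧-true {mem μ₁ b v} h′
        ...   | bv , ne = trans (sym (not-true ne)) (trans (adj≡ S u v)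
          (complete u v u<n v<n (trans (sym (keepᵃ u)) au) (trans (sym (keepᵇ v)) bv)))
      go : ∀ c → evalᵇ (Σ[ count (nz (a at v1) & nz (b at v0) & ~ edge true x1 x0) ] ≼ num 0 & num 1 ⊞ cell best ≼ cell m′) μ₁ [] ≡ c →
           Submitted a b μ (if c then exec (best ⟵ cell m′) μ₃ else μ₁)
      go false eq = record
        { improves = unaffected m′ _ μ refl S
        -- For a complete pair, the test can only fail because `best` is already as large.
        ; best≥ = λ complete → s≤s⁻¹ (≤ᵇ-false (trans (sym (cong (_∧ (suc (μ best 0) ≤ᵇ m)) (ok? complete))) (trans (sym test) eq))) }
      go true eq with ∧-true {bad ≤ᵇ 0} (trans (sym test) eq)
      ... | none , better = record
        { improves = record
            { size  = size S
            ; graph = graph S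
            ; left  = trans (#-cong n left′) (trans (#-trim n (mem μ a) m (m⊓n≤m (# n (mem μ a)) (# n (mem μ b)))) (sym best′))
            ; right = trans (#-cong n right′) (trans (#-trim n (mem μ b) m (m⊓n≤n (# n (mem μ a)) (# n (mem μ b)))) (sym best′))
            ; valid = λ u v u<n v<n hu hv → adjacent u v u<n v<n (proj₁ (∧-true (trans (sym (left′ u u<n)) hu))) (proj₁ (∧-true (trans (sym (right′ v v<n)) hv))) }
          , ≤-trans (<⇒≤ (≤ᵇ-true better)) (≤-reflexive (sym best′))
        ; best≥ = λ _ → ≤-reflexive (sym best′) }
        where
        adjacent : ∀ u v → u < n → v < n → mem μ a u ≡ true → mem μ b v ≡ true → g u v ≡ true
        adjacent u v u<n v<n au bv with false-or-true (g u v)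
        ... | inj₂ e = e
        ... | inj₁ e = contradiction (≤-trans (≤-trans (≤-reflexive (cong bit (sym (∧-intro (trans (keepᵃ u) au)
          (∧-intro (trans (keepᵇ v) bv) (cong not (trans (adj≡ S u v) e))))))) (term≤sum n _ v<n)) (≤-trans (term≤sum n _ u<n) (≤ᵇ-true none))) (<⇒≱ (s≤s z≤n))

    improves-refl : ∀ {μ} → Sound μ → Improves μ μ
    improves-refl S = S , ≤-refl

    improves-trans : ∀ {μ ν ξ} → Improves μ ν → Improves ν ξ → Improves μ ξ
    improves-trans (_ , p) (S , q) = S , ≤-trans p q

    safe-improves : ∀ {c} → Safe c → ∀ μ → Sound μ → Improves μ (exec c μ)
    safe-iter     : ∀ {c a} → Safe c → (5 ≤ᵇ a) ≡ true → ∀ k i μ → Sound μ → Improves μ (iter c a k i μ)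
    safe-improves (submits {a} {b} ua ub) μ S = Submitted.improves (submit-spec a b μ ua ub S)
    safe-improves (assigns {a} 5≤a) μ S = unaffected a _ μ 5≤a S
    safe-improves (p then q)        μ S with safe-improves p μ S
    ... | I = improves-trans I (safe-improves q _ (sound I))
    safe-improves (whens {b} p)     μ S with evalᵇ b μ []
    ... | true  = safe-improves p μ S
    ... | false = improves-refl S
    safe-improves (fors {a} 5≤a p)  μ S with unaffected a (λ i → if i ≡ᵇ 0 then 0 else μ a i) μ 5≤a S
    ... | I = improves-trans I (safe-iter p 5≤a (μ 0 0) 0 _ (sound I))
    safe-iter p 5≤a zero    i μ S = improves-refl S
    safe-iter {c} {a} p 5≤a (suc k) i μ S with safe-improves p μ S
    ... | I with unaffected a (λ l → if l ≡ᵇ 0 then suc i else exec c μ a l) (exec c μ) 5≤a (sound I)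
    ...   | J = improves-trans I (improves-trans J (safe-iter p 5≤a k (suc i) _ (sound J)))

    extract-safe : ∀ o C W → Safe (extract o C W)
    extract-safe o C W = assigns refl then assigns refl then assigns refl then
      fors refl (assigns refl then assigns refl then assigns refl then oriented o)
      where
      oriented : ∀ o → Safe (submitOriented o S′ ws′)
      oriented true  = submits refl refl
      oriented false = submits refl refl

    nextDigit-safe : ∀ s → Safe (nextDigit s)
    nextDigit-safe s = assigns refl then assigns refl then assigns refl

    firstPhase-safe : Safe firstPhase
    firstPhase-safe = assigns refl then assigns refl then assigns refl then
      fors refl (whens (extract-safe false Q′ U′ then nextDigit-safe c′ then assigns refl))

    descent-safe : Safe descent
    descent-safe = assigns refl then assigns refl then
      fors refl (whens (extract-safe true P′ W′ then nextDigit-safe e′ then assigns refl))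

    pruning-safe : Safe pruning
    pruning-safe = fors refl (whens (descent-safe then assigns refl then assigns refl))

    secondPhase-safe : Safe secondPhase
    secondPhase-safe = assigns refl then assigns refl then fors refl (assigns refl then pruning-safe)

    search-safe : Safe search
    search-safe = fors refl (fors refl (fors refl (fors refl (fors refl (fors refl (fors refl
      (firstPhase-safe then secondPhase-safe)))))))

    singleEdges-safe : Safe singleEdges
    singleEdges-safe = fors refl (fors refl (assigns refl then assigns refl then submits refl refl))

-- Extraction as carried out by the program.

module Extracting where

  open import Data.Fin using (suc)
  open import Data.Nat hiding (_!)
  open import Data.Nat.Properties
  open import Data.Vec using ([]; _∷_)
  open import Defs using (Memory)
  open Sums
  open Lang
  open Extraction
  open Algorithm

  sumIf-cong : ∀ n {c d p q} → c ≡ d → (∀ i → i < n → p i ≡ q i) → sumIf n c p ≡ sumIf n d q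
  sumIf-cong n refl h = sum-cong n λ i i<n → cong (λ b → if b then _ else 0) (h i i<n)

  first-cong : ∀ n {p q} → (∀ i → i < n → p i ≡ q i) → first n p ≡ first n q
  first-cong n h = #-cong n λ i _ → cong (_≤ᵇ 0) (#-cong n λ k k<n → cong ((k ≤ᵇ i) ∧_) (h k k<n))

  module _ {n : ℕ} {e e′ : ℕ → ℕ → Bool} {D D₁ : ℕ} (e≡ : ∀ x y → e x y ≡ e′ x y) (D≡ : D ≡ D₁) where

    private
      module G = Graph n e
      module G′ = Graph n e′

    sparse-cong : ∀ {C C₁ W W₁} → (∀ x → x < n → C x ≡ C₁ x) → (∀ y → y < n → W y ≡ W₁ y) →
                  ∀ x → x < n → G.sparse D C W x ≡ G′.sparse D₁ C₁ W₁ x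
    sparse-cong hC hW x x<n = cong₂ _∧_ (hC x x<n) (cong not (cong₂ _≤ᵇ_ (sumIf-cong n refl hW)
      (sumIf-cong n D≡ λ y y<n → cong₂ _∧_ (hW y y<n) (cong not (e≡ x y)))))

    trimmed-cong : ∀ {C C₁ W W₁} → (∀ x → x < n → C x ≡ C₁ x) → (∀ y → y < n → W y ≡ W₁ y) →
                   ∀ y → y < n → G.trimmed D C W y ≡ G′.trimmed D₁ C₁ W₁ y
    trimmed-cong hC hW y y<n = cong₂ _∧_ (hW y y<n) (cong₂ _≤ᵇ_
      (sumIf-cong n D≡ λ x x<n → cong₂ _∧_ (hC x x<n) (cong not (e≡ x y))) (sumIf-cong n refl hC))

    eligible-cong : ∀ {L L₁ S S₁ W W₁} → (∀ x → x < n → L x ≡ L₁ x) → (∀ x → x < n → S x ≡ S₁ x) →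
                    (∀ y → y < n → W y ≡ W₁ y) → ∀ x → x < n → G.eligible D L S W x ≡ G′.eligible D₁ L₁ S₁ W₁ x
    eligible-cong hL hS hW x x<n = cong₂ _∧_ (hL x x<n) (cong₂ _∧_ (cong not (hS x x<n)) (cong₂ _≤ᵇ_
      (sumIf-cong n D≡ λ y y<n → cong₂ _∧_ (hW y y<n) (cong not (e≡ x y))) (sumIf-cong n refl hW)))

  de-morgan : ∀ a b → not (not a ∧ not b) ≡ a ∨ b
  de-morgan true  b     = refl
  de-morgan false true  = refl
  de-morgan false false = refl

  module Extracts (n : ℕ) (0<n : 0 < n) (μ₀ : Memory) where

    open Run n 0<n μ₀ public

    Holds : Memory → ℕ → (ℕ → Bool) → Set
    Holds μ a S = ∀ i → i < n → mem μ a i ≡ S i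

    orient-cong : ∀ o {μ} → Sound μ → ∀ x y → orient o (adj n μ) x y ≡ orient o g x y
    orient-cong true  S x y = adj≡ S x y
    orient-cong false S x y = adj≡ S y x

    loTerm wsTerm : Bool → ℕ → ℕ → BT 1
    loTerm o C W = nz (C at v0) & ~ (addUp (num 2) (nz (W at v0)) ≼ addUp (cell D′) (nz (W at v0) & ~ edge o x1 x0))
    wsTerm o C W = nz (W at v0) & (addUp (cell D′) (nz (lo′ at v0) & ~ edge o x0 x1) ≼ addUp (num 4) (nz (lo′ at v0)))

    lo-eval : ∀ o C W μ x → evalᵇₙ n (loTerm o C W) μ (x ∷ []) ≡
              Graph.sparse n (orient o (adj n μ)) (μ D′ 0) (mem μ C) (mem μ W) x
    lo-eval true  C W μ x = refl
    lo-eval false C W μ x = refl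

    ws-eval : ∀ o C W μ x → evalᵇₙ n (wsTerm o C W) μ (x ∷ []) ≡
              Graph.trimmed n (orient o (adj n μ)) (μ D′ 0) (mem μ lo′) (mem μ W) x
    ws-eval true  C W μ x = refl
    ws-eval false C W μ x = refl

    first-eval : ∀ o μ ε → evalₙ n (firstᵗ {1} (eligibleᵇ o)) μ ε ≡
                 first n (Graph.eligible n (orient o (adj n μ)) (μ D′ 0) (mem μ lo′) (mem μ S′) (mem μ ws′))
    first-eval true  μ ε = refl
    first-eval false μ ε = refl

    edge-eval : ∀ o μ x → evalᵇₙ n (edge {1} o (inj₂ f′) x0) μ (x ∷ []) ≡ orient o (adj n μ) (μ f′ 0) x
    edge-eval true  μ x = refl
    edge-eval false μ x = refl

    greedyBody : Bool → Cmd
    greedyBody o =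
      f′ ⟵ firstᵗ (eligibleᵇ o) ⨟
      S′ ⟵ᵇ ~ (~ nz (S′ at v0) & ~ (v0 ≼ cell f′ & cell f′ ≼ v0)) ⨟
      ws′ ⟵ᵇ nz (ws′ at v0) & edge o (inj₂ f′) x0 ⨟
      submitOriented o S′ ws′

    oriented-spec : ∀ o a b μ → usable a ≡ true → usable b ≡ true → Sound μ →
                    Improves μ (exec (submitOriented o a b) μ) ×
                    ((∀ x y → x < n → y < n → mem μ a x ≡ true → mem μ b y ≡ true → orient o g x y ≡ true) →
                     # n (mem μ a) ⊓ # n (mem μ b) ≤ exec (submitOriented o a b) μ best 0)
    oriented-spec true  a b μ ua ub S = Submitted.improves T , Submitted.best≥ T
      where
      T : Submitted a b μ (exec (submit a b) μ)
      T = submit-spec a b μ ua ub S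
    oriented-spec false a b μ ua ub S = Submitted.improves T , λ h →
      subst (_≤ exec (submit b a) μ best 0) (⊓-comm (# n (mem μ b)) (# n (mem μ a)))
        (Submitted.best≥ T λ u v u<n v<n hu hv → h v u v<n u<n hv hu)
      where
      T : Submitted b a μ (exec (submit b a) μ)
      T = submit-spec b a μ ub ua S

    module _ (o : Bool) {C W : ℕ} (lo≢W : (lo′ ≡ᵇ W) ≡ false) (μ : Memory) (Cs Ws : ℕ → Bool) (d E : ℕ)
             (1≤d : 1 ≤ d) (S : Sound μ) (D≡ : μ D′ 0 ≡ 16 * d)
             (hC : Holds μ C Cs) (hW : Holds μ W Ws)
             (large : 2 * (2 ^ E * (d * E)) ≤ # n Ws)
             (many : 2 * (d * E) ≤ # n (Graph.sparse n (orient o g) (16 * d) Cs Ws)) where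

      private
        module G = Graph n (orient o g)
        open G using (Greedy)
        s : ℕ
        s = d * E
        lo ws : ℕ → Bool
        lo = G.sparse (16 * d) Cs Ws
        ws = G.trimmed (16 * d) lo Ws
        μ₁ μ₂ μ₃ : Memory
        μ₁ = exec (lo′ ⟵ᵇ loTerm o C W) μ
        μ₂ = exec (ws′ ⟵ᵇ wsTerm o C W) μ₁
        μ₃ = exec (S′ ⟵ᵇ never) μ₂
        S₁ : Sound μ₁
        S₁ = sound (unaffected lo′ _ μ refl S)
        S₂ : Sound μ₂
        S₂ = sound (unaffected ws′ _ μ₁ refl S₁)
        S₃ : Sound μ₃
        S₃ = sound (unaffected S′ _ μ₂ refl S₂)
        holds-lo : Holds μ₁ lo′ lo
        holds-lo x x<n = trans (assign-mem lo′ (loTerm o C W) μ (size S) x<n)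
          (trans (lo-eval o C W μ x) (sparse-cong (orient-cong o S) D≡ hC hW x x<n))
        holds-ws : Holds μ₂ ws′ ws
        holds-ws x x<n = trans (assign-mem ws′ (wsTerm o C W) μ₁ (size S₁) x<n)
          (trans (ws-eval o C W μ₁ x) (trimmed-cong (orient-cong o S₁) D≡ holds-lo
            (λ y y<n → trans (still y) (hW y y<n)) x x<n))
          where
          -- `W` is read a second time after `lo′` has been overwritten.
          still : ∀ y → mem μ₁ W y ≡ mem μ W y
          still y = cong nonzero (if-false {lo′ ≡ᵇ W} lo≢W)
        holds-∅ : Holds μ₃ S′ (λ _ → false)
        holds-∅ x x<n = assign-mem S′ never μ₂ (size S₂) x<n
        s≤n : s ≤ n
        s≤n = ≤-trans (m≤m+n s _) (≤-trans many (#≤n n lo))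

        -- `greedy` describes the rounds up to the s-th. From then on only `won` is kept: the rounds
        -- that follow may choose anything, as `best` never decreases.
        record Inv (r : ℕ) (ν : Memory) : Set where
          field
            sound′ : Sound ν
            rate   : ν D′ 0 ≡ 16 * d
            lo-ok  : Holds ν lo′ lo
            greedy : r ≤ s → ∃[ S ] ∃[ w ] (Holds ν S′ S × Holds ν ws′ w × Greedy d lo ws r S w)
            won    : s ≤ r → s ≤ ν best 0
        open Inv

        ws-small : ∀ y → y < n → ws y ≡ true → 16 * d * G.codegreeʳ lo y ≤ 4 * # n lo
        ws-small y _ h = proj₂ (G.trimmed-true {16 * d} {lo} {Ws} {y} h)

        initial : Inv 0 (set g′ 0 μ₃)
        initial = record
          { sound′ = sound (unaffected g′ _ μ₃ refl S₃)
          ; rate = D≡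
          ; lo-ok = holds-lo
          ; greedy = λ _ → (λ _ → false) , ws , holds-∅ , holds-ws , record
              { S⊆lo = λ _ _ () ; w⊆ws = λ _ _ h → h ; count = #-none n ; complete = λ _ _ _ _ () ; large = ≤-refl }
          ; won = λ s≤0 → ≤-trans s≤0 z≤n
          }

        body : Cmd
        body = greedyBody o

        body-safe : ∀ o → Safe (greedyBody o)
        body-safe true  = assigns refl then assigns refl then assigns refl then submits refl refl
        body-safe false = assigns refl then assigns refl then assigns refl then submits refl refl

        no-write : ∀ o → writes g′ (greedyBody o) ≡ false × writes 0 (greedyBody o) ≡ false ×
                   writes D′ (greedyBody o) ≡ false × writes lo′ (greedyBody o) ≡ false
        no-write true  = refl , refl , refl , refl
        no-write false = refl , refl , refl , refl

        no-write′ : ∀ o → writes S′ (submitOriented o S′ ws′) ≡ false × writes ws′ (submitOriented o S′ ws′) ≡ false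
        no-write′ true  = refl , refl
        no-write′ false = refl , refl

        module Step (r : ℕ) (ν : Memory) (I : Inv r ν) where
          f : ℕ
          f = exec (f′ ⟵ firstᵗ (eligibleᵇ o)) ν f′ 0
          ν₁ ν₂ ν₃ : Memory
          ν₁ = exec (f′ ⟵ firstᵗ (eligibleᵇ o)) ν
          ν₂ = exec (S′ ⟵ᵇ ~ (~ nz (S′ at v0) & ~ (v0 ≼ cell f′ & cell f′ ≼ v0))) ν₁
          ν₃ = exec (ws′ ⟵ᵇ nz (ws′ at v0) & edge o (inj₂ f′) x0) ν₂
          T₁ : Sound ν₁
          T₁ = sound (unaffected f′ _ ν refl (sound′ I))
          T₂ : Sound ν₂
          T₂ = sound (unaffected S′ _ ν₁ refl T₁)
          T₃ : Sound ν₃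
          T₃ = sound (unaffected ws′ _ ν₂ refl T₂)

          module Next (r<s : suc r ≤ s) (A w : ℕ → Bool) (hA : Holds ν S′ A) (hw : Holds ν ws′ w)
                      (G : Greedy d lo ws r A w) where
            x : ℕ
            x = first n (G.eligible (16 * d) lo A w)
            A⁺ w⁺ : ℕ → Bool
            A⁺ = G.insert x A
            w⁺ y = w y ∧ orient o g x y
            f≡ : f ≡ x
            f≡ = trans (assign-cell f′ (firstᵗ (eligibleᵇ o)) ν (size (sound′ I)) 0<n)
              (trans (first-eval o ν _) (first-cong n (eligible-cong (orient-cong o (sound′ I)) (rate I) (lo-ok I) hA hw)))
            hA⁺ : Holds ν₃ S′ A⁺
            hA⁺ y y<n = trans (assign-mem S′ (~ (~ nz (S′ at v0) & ~ (v0 ≼ cell f′ & cell f′ ≼ v0))) ν₁ (size T₁) y<n)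
              (trans (de-morgan (mem ν S′ y) _) (cong₂ _∨_ (hA y y<n) (cong₂ (λ a b → (y ≤ᵇ a) ∧ (b ≤ᵇ y)) f≡ f≡)))
            hw⁺ : Holds ν₃ ws′ w⁺
            hw⁺ y y<n = trans (assign-mem ws′ (nz (ws′ at v0) & edge o (inj₂ f′) x0) ν₂ (size T₂) y<n)
              (cong₂ _∧_ (hw y y<n) (trans (edge-eval o ν₂ y) (trans (orient-cong o T₂ f y) (cong (λ z → orient o g z y) f≡))))
            G⁺ : Greedy d lo ws (suc r) A⁺ w⁺
            G⁺ = G.greedy-step (≤-trans (*-monoʳ-≤ 2 r<s) many) ws-small G

            -- Of the bound 2 * 2 ^ E * s on W, the 2 pays for trimming and 2 ^ E for the d E
            -- choices, so that s common neighbours remain.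
            win : s ≤ suc r → s ≤ exec body ν best 0
            win s≤1+r = ≤-trans (⊓-glb (≤-reflexive (sym A-size)) w-size) (proj₂ (oriented-spec o S′ ws′ ν₃ refl refl T₃)
              λ u v u<n v<n hu hv → G.Greedy.complete G⁺ u v u<n v<n (trans (sym (hA⁺ u u<n)) hu) (trans (sym (hw⁺ v v<n)) hv))
              where
              1+r≡s : suc r ≡ s
              1+r≡s = ≤-antisym r<s s≤1+r
              A-size : # n (mem ν₃ S′) ≡ s
              A-size = trans (#-cong n hA⁺) (trans (G.Greedy.count G⁺) 1+r≡s)
              w-size : s ≤ # n (mem ν₃ ws′)
              w-size = *-cancelˡ-≤ (2 ^ E) {{m^n≢0 2 E}} (*-cancelˡ-≤ 2 (begin
                2 * (2 ^ E * s)                   ≤⟨ large ⟩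
                # n Ws                            ≤⟨ G.trimmed-large (16 * d) lo Ws lo-nonempty (λ x _ h → proj₂ (G.sparse-true {16 * d} {Cs} {Ws} {x} h)) ⟩
                2 * # n ws                        ≤⟨ *-monoʳ-≤ 2 (G.greedy-large 1≤d (subst (λ k → Greedy d lo ws k A⁺ w⁺) 1+r≡s G⁺)) ⟩
                2 * (2 ^ E * # n w⁺)              ≡⟨ cong (λ k → 2 * (2 ^ E * k)) (sym (#-cong n hw⁺)) ⟩
                2 * (2 ^ E * # n (mem ν₃ ws′))    ∎))
                where
                open ≤-Reasoning
                lo-nonempty : 1 ≤ # n lo
                lo-nonempty = ≤-trans (≤-trans (s≤s z≤n) r<s) (≤-trans (m≤m+n s _) many)

          step : Inv (suc r) (set g′ (suc r) (exec body ν))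
          step = record
            { sound′ = sound (unaffected g′ _ (exec body ν) refl (sound imp))
            ; rate   = trans (frame body {D′} (proj₁ (proj₂ (proj₂ (no-write o)))) ν 0) (rate I)
            ; lo-ok  = λ y y<n → trans (cong nonzero (frame body {lo′} (proj₂ (proj₂ (proj₂ (no-write o)))) ν y)) (lo-ok I y y<n)
            ; greedy = λ r<s → grow r<s (greedy I (<⇒≤ r<s))
            ; won    = λ s≤1+r → case s≤1+r (s ≤? r)
            }
            where
            imp : Improves ν (exec body ν)
            imp = safe-improves (body-safe o) ν (sound′ I)
            grow : suc r ≤ s → ∃[ A ] ∃[ w ] (Holds ν S′ A × Holds ν ws′ w × Greedy d lo ws r A w) →
                   ∃[ A ] ∃[ w ] (Holds (exec body ν) S′ A × Holds (exec body ν) ws′ w × Greedy d lo ws (suc r) A w)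
            grow r<s (A , w , hA , hw , G) = A⁺ , w⁺ ,
              (λ y y<n → trans (cong nonzero (frame (submitOriented o S′ ws′) {S′} (proj₁ (no-write′ o)) ν₃ y)) (hA⁺ y y<n)) ,
              (λ y y<n → trans (cong nonzero (frame (submitOriented o S′ ws′) {ws′} (proj₂ (no-write′ o)) ν₃ y)) (hw⁺ y y<n)) , G⁺
              where open Next r<s A w hA hw G
            case : s ≤ suc r → Dec (s ≤ r) → s ≤ exec body ν best 0
            case s≤1+r (yes s≤r) = ≤-trans (won I s≤r) (grows imp)
            case s≤1+r (no s≰r)  = finish (greedy I (<⇒≤ (≰⇒> s≰r)))
              where
              finish : ∃[ A ] ∃[ w ] (Holds ν S′ A × Holds ν ws′ w × Greedy d lo ws r A w) → s ≤ exec body ν best 0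
              finish (A , w , hA , hw , G) = Next.win (≰⇒> s≰r) A w hA hw G s≤1+r

      extract-wins : d * E ≤ exec (extract o C W) μ best 0
      extract-wins = won (for-ind {g′} {body} (proj₁ (no-write o)) (proj₁ (proj₂ (no-write o))) refl Inv μ₃ (size S₃) initial
        λ r ν _ _ _ I → Step.step r ν I) s≤n

-- The two phases as carried out by the program.

module Searching where

  open import Data.Fin using (zero; suc)
  open import Data.List using (List; []; _∷_)
  open import Data.Nat hiding (_!)
  open import Data.Nat.DivMod using (m≡m%n+[m/n]*n; m/n≤m; m/n*n≤m)
  open import Data.Nat.Properties
  open import Data.Vec using ([]; _∷_)
  open import Defs using (Memory)
  open Sums
  open Lang
  open Extraction
  open Search
  open Params
  open Algorithm
  open Extracting

  #-upto : ∀ n m → m ≤ n → # n (λ i → suc i ≤ᵇ m) ≡ m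
  #-upto n m m≤n = trans (#-cong n λ i _ → flip i) (#-below n m≤n)
    where
    flip : ∀ i → (suc i ≤ᵇ m) ≡ not (m ≤ᵇ i)
    flip i with i <? m
    ... | yes i<m = trans (true-≤ᵇ i<m) (cong not (sym (false-≤ᵇ i<m)))
    ... | no  i≮m = trans (false-≤ᵇ (s≤s (≮⇒≥ i≮m))) (cong not (sym (true-≤ᵇ (≮⇒≥ i≮m))))

  -- q (t + 1) ≤ y holds exactly for t < y / q, so counting such t divides by q.
  quotient : ∀ n q y .{{_ : NonZero q}} → y < n → # n (λ t → sumIf n q (λ i → i ≤ᵇ t) ≤ᵇ y) ≡ y / q
  quotient n q y y<n = trans (#-cong n each) (#-upto n (y / q) (≤-trans (m/n≤m y q) (<⇒≤ y<n)))
    where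
    total : ∀ t → t < n → sumIf n q (λ i → i ≤ᵇ t) ≡ q * suc t
    total t t<n = trans (sumIf≡ n q _) (cong (q *_) (trans (#-cong n λ i _ → shift i) (#-upto n (suc t) t<n)))
      where
      shift : ∀ i → (i ≤ᵇ t) ≡ (suc i ≤ᵇ suc t)
      shift i with i ≤? t
      ... | yes i≤t = trans (true-≤ᵇ i≤t) (sym (true-≤ᵇ (s≤s i≤t)))
      ... | no  i≰t = trans (false-≤ᵇ (≰⇒> i≰t)) (sym (false-≤ᵇ (s≤s (≰⇒> i≰t))))
    each : ∀ t → t < n → (sumIf n q (λ i → i ≤ᵇ t) ≤ᵇ y) ≡ (suc t ≤ᵇ y / q)
    each t t<n rewrite total t t<n with t <? y / q
    ... | yes t< = trans (true-≤ᵇ (≤-trans (≤-reflexive (*-comm q (suc t))) (≤-trans (*-monoˡ-≤ q t<) (m/n*n≤m y q)))) (sym (true-≤ᵇ t<))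
    ... | no  t≮ = trans (false-≤ᵇ (<-≤-trans (m<[1+m/n]*n y q) (≤-trans (*-monoˡ-≤ q (s≤s (≮⇒≥ t≮))) (≤-reflexive (*-comm (suc t) q)))))
                         (sym (false-≤ᵇ (s≤s (≮⇒≥ t≮))))

  remainder : ∀ n q y .{{_ : NonZero q}} → y < n → y ∸ sumIf n q (λ i → suc i ≤ᵇ y / q) ≡ y % q
  remainder n q y y<n = begin
    y ∸ sumIf n q (λ i → suc i ≤ᵇ y / q) ≡⟨ cong (y ∸_) (trans (sumIf≡ n q _) (cong (q *_) (#-upto n (y / q) (≤-trans (m/n≤m y q) (<⇒≤ y<n))))) ⟩
    y ∸ q * (y / q)                      ≡⟨ cong₂ _∸_ (m≡m%n+[m/n]*n y q) (*-comm q (y / q)) ⟩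
    (y % q + y / q * q) ∸ y / q * q      ≡⟨ m+n∸n≡m (y % q) (y / q * q) ⟩
    y % q                                ∎
    where open ≡-Reasoning

  Regs : List (ℕ × ℕ) → Memory → Set
  Regs []             μ = ⊤
  Regs ((a , v) ∷ ps) μ = μ a 0 ≡ v × Regs ps μ

  -- A Boolean, so that for a concrete command the preservation of all listed registers is settled
  -- by computation.
  untouched : List (ℕ × ℕ) → Cmd → Bool
  untouched []             c = true
  untouched ((a , _) ∷ ps) c = not (writes a c) ∧ untouched ps c

  regs-exec : ∀ ps c μ → untouched ps c ≡ true → Regs ps μ → Regs ps (exec c μ)
  regs-exec []             c μ u R = tt
  regs-exec ((a , v) ∷ ps) c μ u (e , R) with ∧-true {not (writes a c)} u
  ... | ua , ups = trans (frame c (not-true ua) μ 0) e , regs-exec ps c μ ups R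

  distinct : ℕ → List (ℕ × ℕ) → Bool
  distinct b []             = true
  distinct b ((a , _) ∷ ps) = not (b ≡ᵇ a) ∧ distinct b ps

  regs-set : ∀ ps b v μ → distinct b ps ≡ true → Regs ps μ → Regs ps (set b v μ)
  regs-set []             b v μ u R = tt
  regs-set ((a , _) ∷ ps) b v μ u (e , R) with ∧-true {not (b ≡ᵇ a)} u
  ... | ua , ups = trans (if-false (not-true ua)) e , regs-set ps b v μ ups R

  module Searches (n : ℕ) (0<n : 0 < n) (μ₀ : Memory) where

    open Extracts n 0<n μ₀ public

    Holds-frame : ∀ c {a A} μ → writes a c ≡ false → Holds μ a A → Holds (exec c μ) a A
    Holds-frame c μ w h i i<n = trans (cong nonzero (frame c w μ i)) (h i i<n)

    assign-improves : ∀ a b μ → (5 ≤ᵇ a) ≡ true → Sound μ → Improves μ (exec (a ⟵ᵇ b) μ)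
    assign-improves a b μ 5≤a S = unaffected a _ μ 5≤a S

    module Digits (q : ℕ) {{_ : NonZero q}} where

      rest : ℕ → ℕ → ℕ
      rest zero    x = x
      rest (suc i) x = rest i (x / q)

      rest-suc : ∀ i x → rest (suc i) x ≡ rest i x / q
      rest-suc zero    x = refl
      rest-suc (suc i) x = rest-suc i (x / q)

      rest≤ : ∀ i x → rest i x ≤ x
      rest≤ zero    x = ≤-refl
      rest≤ (suc i) x = ≤-trans (rest≤ i (x / q)) (m/n≤m x q)

      nextDigit-spec : ∀ s μ y → (h′ ≡ᵇ s) ≡ false → (5 ≤ᵇ s) ≡ true → Sound μ → μ q′ 0 ≡ q → μ y′ 0 ≡ y → y < n →
                       exec (nextDigit s) μ k′ 0 ≡ μ s 0 + y % q × exec (nextDigit s) μ y′ 0 ≡ y / q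
      nextDigit-spec s μ y hs 5≤s S eq ey y<n = k-value , trans (assign-cell y′ (cell h′) μ₂ (size S) 0<n) h-value
        where
        μ₁ μ₂ : Memory
        μ₁ = exec (h′ ⟵ count (addUp (cell q′) (v0 ≼ v1) ≼ cell y′)) μ
        μ₂ = exec (k′ ⟵ cell s ⊞ (cell y′ ⊟ addUp (cell q′) (num 1 ⊞ v0 ≼ cell h′))) μ₁
        h-value : μ₁ h′ 0 ≡ y / q
        h-value = trans (assign-cell h′ (count (addUp (cell q′) (v0 ≼ v1) ≼ cell y′)) μ (size S) 0<n)
          (trans (cong₂ (λ q y → # n (λ t → sumIf n q (λ i → i ≤ᵇ t) ≤ᵇ y)) eq ey) (quotient n q y y<n))
        s-same : μ₁ s 0 ≡ μ s 0
        s-same = if-false hs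
        k-value : μ₂ k′ 0 ≡ μ s 0 + y % q
        k-value = trans (assign-cell k′ (cell s ⊞ (cell y′ ⊟ addUp (cell q′) (num 1 ⊞ v0 ≼ cell h′))) μ₁ (size S) 0<n)
          (cong₂ _+_ s-same (trans (cong₂ _∸_ ey (cong₂ (λ q h → sumIf n q (λ i → suc i ≤ᵇ h)) eq h-value)) (remainder n q y y<n)))

    module Phases (A B : ℕ → Bool) (biclique : ∀ u v → u < n → v < n → A u ≡ true → B v ≡ true → g u v ≡ true)
                  (d E : ℕ) (1≤d : 1 ≤ d) (q : ℕ) {{_ : NonZero q}} (j M : ℕ)
                  (enough : 2 * (2 ^ E * (d * E)) ≤ M) where

      open Digits q
      module H = Hidden n g A B biclique d (d * E) 1≤d

      s : ℕ
      s = d * E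

      suc-⊓ : ∀ {i} → i < j → suc i ⊓ j ≡ suc (i ⊓ j)
      suc-⊓ i<j = trans (m≤n⇒m⊓n≡m i<j) (cong suc (sym (m≤n⇒m⊓n≡m (<⇒≤ i<j))))

      suc-⊓′ : ∀ {i} → ¬ i < j → suc i ⊓ j ≡ i ⊓ j
      suc-⊓′ i≮j = trans (m≥n⇒m⊓n≡n (m≤n⇒m≤1+n (≮⇒≥ i≮j))) (sym (m≥n⇒m⊓n≡n (≮⇒≥ i≮j)))

      module One (c e t z : ℕ) (t<n : t < n) where

        open H.First c q

        chain-suc : ∀ i x U → chain (suc i) x U ≡ narrow (rest i x % q) (chain i x U)
        chain-suc zero    x U = refl
        chain-suc (suc i) x U = chain-suc i (x / q) (narrow (x % q) U)

        all : ℕ → Bool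
        all _ = true

        regs : List (ℕ × ℕ)
        regs = (D′ , 16 * d) ∷ (q′ , q) ∷ (j′ , j) ∷ (z′ , z) ∷ (c′ , c) ∷ (e′ , e) ∷ (t′ , t) ∷ []

        Won : ℕ → Memory → Set
        Won k μ = M ≤ # n (chain k t all) → 2 * s ≤ # n (H.R.sparse (16 * d) Q (chain k t all)) → s ≤ μ best 0

        -- Rounds from the j-th on are idle, so after i rounds the state is that of stage `i ⊓ j`.
        -- `won` remembers every stage at which extraction was bound to succeed.
        record Inv (i : ℕ) (μ : Memory) : Set where
          field
            sound′ : Sound μ
            fixed  : Regs regs μ
            Q-ok   : Holds μ Q′ Q
            U-ok   : Holds μ U′ (chain (i ⊓ j) t all)
            y-ok   : μ y′ 0 ≡ rest (i ⊓ j) t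
            won    : ∀ k → k < i → k < j → Won k μ
        open Inv

        body : Cmd
        body = extract false Q′ U′ ⨟ nextDigit c′ ⨟ U′ ⟵ᵇ nz (U′ at v0) & edge true x0 (inj₂ k′)

        body-safe : Safe body
        body-safe = extract-safe false Q′ U′ then nextDigit-safe c′ then assigns refl

        intersect-spec : ∀ ν C k → Sound ν → ν k′ 0 ≡ k → Holds ν U′ C → ∀ u → u < n →
                         mem (exec (U′ ⟵ᵇ nz (U′ at v0) & edge true x0 (inj₂ k′)) ν) U′ u ≡ C u ∧ g u k
        intersect-spec ν C k S k≡ hU u u<n = trans (assign-mem U′ (nz (U′ at v0) & edge true x0 (inj₂ k′)) ν (size S) u<n)
          (cong₂ _∧_ (hU u u<n) (trans (adj≡ S u (ν k′ 0)) (cong (g u) k≡)))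

        step : ∀ i μ → μ i′ 0 ≡ i → Inv i μ → Inv (suc i) (set i′ (suc i) (exec (when (num 1 ⊞ cell i′ ≼ cell j′) body) μ))
        step i μ ei I = case (i <? j)
          where
          test : ∀ b → (suc i ≤ᵇ j) ≡ b → evalᵇ (num 1 ⊞ cell i′ ≼ cell j′) μ [] ≡ b
          test b eq = trans (cong₂ (λ a b → suc a ≤ᵇ b) ei (proj₁ (proj₂ (proj₂ (fixed I))))) eq
          case : Dec (i < j) → Inv (suc i) (set i′ (suc i) (exec (when (num 1 ⊞ cell i′ ≼ cell j′) body) μ))
          case (no i≮j) = subst (λ ν → Inv (suc i) (set i′ (suc i) ν)) (when-false (num 1 ⊞ cell i′ ≼ cell j′) body μ (test false (false-≤ᵇ (s≤s (≮⇒≥ i≮j))))) record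
            { sound′ = sound (unaffected i′ _ μ refl (sound′ I))
            ; fixed = regs-set regs i′ (suc i) μ refl (fixed I)
            ; Q-ok = Q-ok I
            ; U-ok = λ u u<n → trans (U-ok I u u<n) (cong (λ k → chain k t all u) (sym (suc-⊓′ i≮j)))
            ; y-ok = trans (y-ok I) (cong (λ k → rest k t) (sym (suc-⊓′ i≮j)))
            ; won = λ k k≤i k<j → won I k (<-≤-trans k<j (≮⇒≥ i≮j)) k<j
            }
          case (yes i<j) = subst (λ ν → Inv (suc i) (set i′ (suc i) ν)) (when-true (num 1 ⊞ cell i′ ≼ cell j′) body μ (test true (true-≤ᵇ i<j))) record
            { sound′ = sound (unaffected i′ _ (exec body μ) refl (sound imp))
            ; fixed = regs-set regs i′ (suc i) (exec body μ) refl (regs-exec regs body μ refl (fixed I))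
            ; Q-ok = Holds-frame body μ refl (Q-ok I)
            ; U-ok = λ u u<n → trans (new u u<n) (cong (λ k → chain k t all u) (sym (suc-⊓ i<j)))
            ; y-ok = trans (proj₂ digit) (trans (sym (rest-suc (i ⊓ j) t)) (cong (λ k → rest k t) (sym (suc-⊓ i<j))))
            ; won = λ k k≤i k<j → wins k (m≤n⇒m<n∨m≡n (s≤s⁻¹ k≤i)) k<j
            }
            where
            imp : Improves μ (exec body μ)
            imp = safe-improves body-safe μ (sound′ I)
            μ₁ μ₂ : Memory
            μ₁ = exec (extract false Q′ U′) μ
            μ₂ = exec (nextDigit c′) μ₁
            imp₁ : Improves μ μ₁
            imp₁ = safe-improves (extract-safe false Q′ U′) μ (sound′ I)
            imp₂ : Improves μ₁ μ₂
            imp₂ = safe-improves (nextDigit-safe c′) μ₁ (sound imp₁)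
            fixed₁ : Regs regs μ₁
            fixed₁ = regs-exec regs (extract false Q′ U′) μ refl (fixed I)
            y₁ : μ₁ y′ 0 ≡ rest (i ⊓ j) t
            y₁ = trans (frame (extract false Q′ U′) {y′} refl μ 0) (y-ok I)
            digit : μ₂ k′ 0 ≡ μ₁ c′ 0 + rest (i ⊓ j) t % q × μ₂ y′ 0 ≡ rest (i ⊓ j) t / q
            digit = nextDigit-spec c′ μ₁ (rest (i ⊓ j) t) refl refl (sound imp₁) (proj₁ (proj₂ fixed₁)) y₁ (≤-<-trans (rest≤ (i ⊓ j) t) t<n)
            k≡ : μ₂ k′ 0 ≡ c + rest (i ⊓ j) t % q
            k≡ = trans (proj₁ digit) (cong (_+ rest (i ⊓ j) t % q) (proj₁ (proj₂ (proj₂ (proj₂ (proj₂ fixed₁))))))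
            U₂ : Holds μ₂ U′ (chain (i ⊓ j) t all)
            U₂ = Holds-frame (nextDigit c′) μ₁ refl (Holds-frame (extract false Q′ U′) μ refl (U-ok I))
            new : ∀ u → u < n → mem (exec body μ) U′ u ≡ chain (suc (i ⊓ j)) t all u
            new u u<n = trans (intersect-spec μ₂ (chain (i ⊓ j) t all) (c + rest (i ⊓ j) t % q) (sound imp₂) k≡ U₂ u u<n)
              (cong (λ C → C u) (sym (chain-suc (i ⊓ j) t all)))
            wins : ∀ k → k < i ⊎ k ≡ i → k < j → Won k (exec body μ)
            wins k (inj₁ k<i) k<j large many = ≤-trans (won I k k<i k<j large many) (grows imp)
            wins k (inj₂ refl) k<j large many = ≤-trans
              (extract-wins false {Q′} {U′} refl μ Q (chain (k ⊓ j) t all) d E 1≤d (sound′ I) (proj₁ (fixed I)) (Q-ok I) (U-ok I)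
                (subst (λ l → 2 * (2 ^ E * s) ≤ # n (chain l t all)) (sym (m≤n⇒m⊓n≡m (<⇒≤ k<j))) (≤-trans enough large))
                (subst (λ l → 2 * s ≤ # n (H.R.sparse (16 * d) Q (chain l t all))) (sym (m≤n⇒m⊓n≡m (<⇒≤ k<j))) many))
              (≤-trans (grows imp₂) (grows (assign-improves U′ (nz (U′ at v0) & edge true x0 (inj₂ k′)) μ₂ refl (sound imp₂))))

        record Result (μ : Memory) : Set where
          field
            sound″ : Sound μ
            fixed″ : Regs regs μ
            U-ok″  : Holds μ U′ (chain j t all)
            won″   : ∀ k → k < j → Won k μ

        firstPhase-spec : j < n → ∀ μ → Sound μ → Regs regs μ → Result (exec firstPhase μ)
        firstPhase-spec j<n μ S R = record
          { sound″ = sound′ final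
          ; fixed″ = fixed final
          ; U-ok″ = subst (λ k → Holds (exec firstPhase μ) U′ (chain k t all)) (m≥n⇒m⊓n≡n (<⇒≤ j<n)) (U-ok final)
          ; won″ = λ k k<j → won final k (<-trans k<j j<n) k<j
          }
          where
          μ₁ μ₂ μ₃ : Memory
          μ₁ = exec (U′ ⟵ᵇ ~ never) μ
          μ₂ = exec (Q′ ⟵ᵇ cell c′ ≼ v0 & num 1 ⊞ v0 ≼ cell c′ ⊞ cell q′) μ₁
          μ₃ = exec (y′ ⟵ cell t′) μ₂
          S₁ : Sound μ₁
          S₁ = sound (unaffected U′ _ μ refl S)
          S₂ : Sound μ₂
          S₂ = sound (unaffected Q′ _ μ₁ refl S₁)
          S₃ : Sound μ₃
          S₃ = sound (unaffected y′ _ μ₂ refl S₂)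
          c≡ : μ c′ 0 ≡ c
          c≡ = proj₁ (proj₂ (proj₂ (proj₂ (proj₂ R))))
          initial : Inv 0 (set i′ 0 μ₃)
          initial = record
            { sound′ = sound (unaffected i′ _ μ₃ refl S₃)
            ; fixed = R
            ; Q-ok = λ v v<n → trans (assign-mem Q′ (cell c′ ≼ v0 & num 1 ⊞ v0 ≼ cell c′ ⊞ cell q′) μ₁ (size S) v<n)
                (cong₂ (λ c q → (c ≤ᵇ v) ∧ (suc v ≤ᵇ c + q)) c≡ (proj₁ (proj₂ R)))
            ; U-ok = λ u u<n → assign-mem U′ (~ never) μ (size S) u<n
            ; y-ok = trans (assign-cell y′ (cell t′) μ₂ (size S) 0<n) (proj₁ (proj₂ (proj₂ (proj₂ (proj₂ (proj₂ (proj₂ R)))))))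
            ; won = λ _ ()
            }
          final : Inv n (exec firstPhase μ)
          final = for-ind {i′} {when (num 1 ⊞ cell i′ ≼ cell j′) body} refl refl refl Inv μ₃ (size S) initial
            λ i ν _ _ ei I → step i ν ei I

      module Two (e : ℕ) (P : ℕ → Bool) (P⊆ : ∀ u → u < n → P u ≡ true → interval e q u ≡ true)
                 (j<n : j < n) where

        open H.Second e q P P⊆

        z : ℕ
        z = q ^ j

        chain-suc : ∀ i x W → chain (suc i) x W ≡ narrow (rest i x % q) (chain i x W)
        chain-suc zero    x W = refl
        chain-suc (suc i) x W = chain-suc i (x / q) (narrow (x % q) W)

        Won : (ℕ → Bool) → ℕ → ℕ → Memory → Set
        Won V₀ x k μ = M ≤ # n (chain k x V₀) → 2 * s ≤ # n (H.L.sparse (16 * d) P (chain k x V₀)) → s ≤ μ best 0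

        module Descent (x : ℕ) (x<n : x < n) (V₀ : ℕ → Bool) where

          regs : List (ℕ × ℕ)
          regs = (D′ , 16 * d) ∷ (q′ , q) ∷ (j′ , j) ∷ (e′ , e) ∷ []

          record Inv (i : ℕ) (μ : Memory) : Set where
            field
              sound′ : Sound μ
              fixed  : Regs regs μ
              P-ok   : Holds μ P′ P
              W-ok   : Holds μ W′ (chain (i ⊓ j) x V₀)
              y-ok   : μ y′ 0 ≡ rest (i ⊓ j) x
              won    : ∀ k → k < i → k < j → Won V₀ x k μ
          open Inv

          shrinkᵇ : BT 1
          shrinkᵇ = nz (W′ at v0) & ~ edge true (inj₂ k′) x0 & num 1 ⊞ cell k′ ≼ cell 0 & nz (P′ at cell k′)

          shrink-spec : ∀ ν C u → Sound ν → ν k′ 0 ≡ u → Holds ν W′ C → Holds ν P′ P → ∀ v → v < n →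
                        mem (exec (W′ ⟵ᵇ shrinkᵇ) ν) W′ v ≡ C v ∧ not (g u v) ∧ inside u
          shrink-spec ν C u S k≡ hW hP v v<n = trans (assign-mem W′ shrinkᵇ ν (size S) v<n)
            (cong₂ _∧_ (hW v v<n) (cong₂ _∧_ (cong not (trans (adj≡ S (ν k′ 0) v) (cong (λ a → g a v) k≡)))
              (trans (cong₂ (λ a b → (suc a ≤ᵇ b) ∧ mem ν P′ a) k≡ (size S)) (within (suc u ≤ᵇ n) refl))))
            where
            -- Array `P′` is only known to represent P below n, which the first conjunct ensures.
            within : ∀ b → (suc u ≤ᵇ n) ≡ b → b ∧ mem ν P′ u ≡ b ∧ P u
            within false _  = refl
            within true  eq = hP u (≤ᵇ-true eq)

          body : Cmd
          body = extract true P′ W′ ⨟ nextDigit e′ ⨟ W′ ⟵ᵇ shrinkᵇ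

          body-safe : Safe body
          body-safe = extract-safe true P′ W′ then nextDigit-safe e′ then assigns refl

          step : ∀ i μ → μ i′ 0 ≡ i → Inv i μ → Inv (suc i) (set i′ (suc i) (exec (when (num 1 ⊞ cell i′ ≼ cell j′) body) μ))
          step i μ ei I = case (i <? j)
            where
            test : ∀ b → (suc i ≤ᵇ j) ≡ b → evalᵇ (num 1 ⊞ cell i′ ≼ cell j′) μ [] ≡ b
            test b eq = trans (cong₂ (λ a b → suc a ≤ᵇ b) ei (proj₁ (proj₂ (proj₂ (fixed I))))) eq
            case : Dec (i < j) → Inv (suc i) (set i′ (suc i) (exec (when (num 1 ⊞ cell i′ ≼ cell j′) body) μ))
            case (no i≮j) = subst (λ ν → Inv (suc i) (set i′ (suc i) ν)) (when-false (num 1 ⊞ cell i′ ≼ cell j′) body μ (test false (false-≤ᵇ (s≤s (≮⇒≥ i≮j))))) record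
              { sound′ = sound (unaffected i′ _ μ refl (sound′ I))
              ; fixed = regs-set regs i′ (suc i) μ refl (fixed I)
              ; P-ok = P-ok I
              ; W-ok = λ u u<n → trans (W-ok I u u<n) (cong (λ k → chain k x V₀ u) (sym (suc-⊓′ i≮j)))
              ; y-ok = trans (y-ok I) (cong (λ k → rest k x) (sym (suc-⊓′ i≮j)))
              ; won = λ k k≤i k<j → won I k (<-≤-trans k<j (≮⇒≥ i≮j)) k<j
              }
            case (yes i<j) = subst (λ ν → Inv (suc i) (set i′ (suc i) ν)) (when-true (num 1 ⊞ cell i′ ≼ cell j′) body μ (test true (true-≤ᵇ i<j))) record
              { sound′ = sound (unaffected i′ _ (exec body μ) refl (sound imp))
              ; fixed = regs-set regs i′ (suc i) (exec body μ) refl (regs-exec regs body μ refl (fixed I))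
              ; P-ok = Holds-frame body μ refl (P-ok I)
              ; W-ok = λ u u<n → trans (new u u<n) (cong (λ k → chain k x V₀ u) (sym (suc-⊓ i<j)))
              ; y-ok = trans (proj₂ digit) (trans (sym (rest-suc (i ⊓ j) x)) (cong (λ k → rest k x) (sym (suc-⊓ i<j))))
              ; won = λ k k≤i k<j → wins k (m≤n⇒m<n∨m≡n (s≤s⁻¹ k≤i)) k<j
              }
              where
              imp : Improves μ (exec body μ)
              imp = safe-improves body-safe μ (sound′ I)
              μ₁ μ₂ : Memory
              μ₁ = exec (extract true P′ W′) μ
              μ₂ = exec (nextDigit e′) μ₁
              imp₁ : Improves μ μ₁
              imp₁ = safe-improves (extract-safe true P′ W′) μ (sound′ I)
              imp₂ : Improves μ₁ μ₂
              imp₂ = safe-improves (nextDigit-safe e′) μ₁ (sound imp₁)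
              fixed₁ : Regs regs μ₁
              fixed₁ = regs-exec regs (extract true P′ W′) μ refl (fixed I)
              y₁ : μ₁ y′ 0 ≡ rest (i ⊓ j) x
              y₁ = trans (frame (extract true P′ W′) {y′} refl μ 0) (y-ok I)
              digit : μ₂ k′ 0 ≡ μ₁ e′ 0 + rest (i ⊓ j) x % q × μ₂ y′ 0 ≡ rest (i ⊓ j) x / q
              digit = nextDigit-spec e′ μ₁ (rest (i ⊓ j) x) refl refl (sound imp₁) (proj₁ (proj₂ fixed₁)) y₁ (≤-<-trans (rest≤ (i ⊓ j) x) x<n)
              u : ℕ
              u = e + rest (i ⊓ j) x % q
              k≡ : μ₂ k′ 0 ≡ u
              k≡ = trans (proj₁ digit) (cong (_+ rest (i ⊓ j) x % q) (proj₁ (proj₂ (proj₂ (proj₂ fixed₁)))))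
              W₂ : Holds μ₂ W′ (chain (i ⊓ j) x V₀)
              W₂ = Holds-frame (nextDigit e′) μ₁ refl (Holds-frame (extract true P′ W′) μ refl (W-ok I))
              P₂ : Holds μ₂ P′ P
              P₂ = Holds-frame (nextDigit e′) μ₁ refl (Holds-frame (extract true P′ W′) μ refl (P-ok I))
              new : ∀ v → v < n → mem (exec body μ) W′ v ≡ chain (suc (i ⊓ j)) x V₀ v
              new v v<n = trans (shrink-spec μ₂ (chain (i ⊓ j) x V₀) u (sound imp₂) k≡ W₂ P₂ v v<n)
                (cong (λ C → C v) (sym (chain-suc (i ⊓ j) x V₀)))
              wins : ∀ k → k < i ⊎ k ≡ i → k < j → Won V₀ x k (exec body μ)
              wins k (inj₁ k<i) k<j large many = ≤-trans (won I k k<i k<j large many) (grows imp)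
              wins k (inj₂ refl) k<j large many = ≤-trans
                (extract-wins true {P′} {W′} refl μ P (chain (k ⊓ j) x V₀) d E 1≤d (sound′ I) (proj₁ (fixed I)) (P-ok I) (W-ok I)
                  (subst (λ l → 2 * (2 ^ E * s) ≤ # n (chain l x V₀)) (sym (m≤n⇒m⊓n≡m (<⇒≤ k<j))) (≤-trans enough large))
                  (subst (λ l → 2 * s ≤ # n (H.L.sparse (16 * d) P (chain l x V₀))) (sym (m≤n⇒m⊓n≡m (<⇒≤ k<j))) many))
                (≤-trans (grows imp₂) (grows (assign-improves W′ shrinkᵇ μ₂ refl (sound imp₂))))

          descent-spec : ∀ μ → Sound μ → Regs regs μ → Holds μ P′ P → Holds μ V₀′ V₀ → μ x′ 0 ≡ x →
                         Holds (exec descent μ) W′ (chain j x V₀) × (∀ k → k < j → Won V₀ x k (exec descent μ))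
          descent-spec μ S R hP hV ex =
            subst (λ k → Holds (exec descent μ) W′ (chain k x V₀)) (m≥n⇒m⊓n≡n (<⇒≤ j<n)) (W-ok final) ,
            λ k k<j → won final k (<-trans k<j j<n) k<j
            where
            μ₁ μ₂ : Memory
            μ₁ = exec (W′ ⟵ V₀′ at v0) μ
            μ₂ = exec (y′ ⟵ cell x′) μ₁
            S₁ : Sound μ₁
            S₁ = sound (unaffected W′ _ μ refl S)
            S₂ : Sound μ₂
            S₂ = sound (unaffected y′ _ μ₁ refl S₁)
            initial : Inv 0 (set i′ 0 μ₂)
            initial = record
              { sound′ = sound (unaffected i′ _ μ₂ refl S₂)
              ; fixed = R
              ; P-ok = hP
              ; W-ok = λ v v<n → trans (cong nonzero (assign-cell W′ (V₀′ at v0) μ (size S) v<n)) (hV v v<n)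
              ; y-ok = trans (assign-cell y′ (cell x′) μ₁ (size S₁) 0<n) ex
              ; won = λ _ ()
              }
            final : Inv n (exec descent μ)
            final = for-ind {i′} {when (num 1 ⊞ cell i′ ≼ cell j′) body} refl refl refl Inv μ₂ (size S₂) initial
              λ i ν _ _ ei I → step i ν ei I

        regs : List (ℕ × ℕ)
        regs = (D′ , 16 * d) ∷ (q′ , q) ∷ (j′ , j) ∷ (z′ , z) ∷ (e′ , e) ∷ []

        module Prune (z<M : z < M) (z<n : z < n) (V₀ : ℕ → Bool) where

          record Inv (x : ℕ) (μ : Memory) : Set where
            field
              sound′ : Sound μ
              fixed  : Regs regs μ
              P-ok   : Holds μ P′ P
              V₀-ok  : Holds μ V₀′ V₀
              pruned : ∃[ V ] (Holds μ V′ V × Pruned M j V₀ (x ⊓ z) V)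
              won    : ∀ y → y < x → y < z → ∀ k → k < j → Won V₀ y k μ
          open Inv

          removeᵇ : BT 1
          removeᵇ = nz (V′ at v0) & ~ (v0 ≼ cell f′ & cell f′ ≼ v0)

          body : Cmd
          body = descent ⨟ f′ ⟵ firstᵗ (nz (W′ at v0) & nz (V′ at v0)) ⨟ V′ ⟵ᵇ removeᵇ

          body-safe : Safe body
          body-safe = descent-safe then assigns refl then assigns refl

          step : ∀ x μ → x < n → μ x′ 0 ≡ x → Inv x μ → Inv (suc x) (set x′ (suc x) (exec (when (num 1 ⊞ cell x′ ≼ cell z′) body) μ))
          step x μ x<n ex I = case (x <? z)
            where
            test : ∀ b → (suc x ≤ᵇ z) ≡ b → evalᵇ (num 1 ⊞ cell x′ ≼ cell z′) μ [] ≡ b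
            test b eq = trans (cong₂ (λ a b → suc a ≤ᵇ b) ex (proj₁ (proj₂ (proj₂ (proj₂ (fixed I)))))) eq
            case : Dec (x < z) → Inv (suc x) (set x′ (suc x) (exec (when (num 1 ⊞ cell x′ ≼ cell z′) body) μ))
            case (no x≮z) = subst (λ ν → Inv (suc x) (set x′ (suc x) ν)) (when-false (num 1 ⊞ cell x′ ≼ cell z′) body μ (test false (false-≤ᵇ (s≤s (≮⇒≥ x≮z))))) record
              { sound′ = sound (unaffected x′ _ μ refl (sound′ I))
              ; fixed = regs-set regs x′ (suc x) μ refl (fixed I)
              ; P-ok = P-ok I
              ; V₀-ok = V₀-ok I
              ; pruned = let V , hV , G = pruned I in V , hV ,
                  subst (λ k → Pruned M j V₀ k V) (trans (m≥n⇒m⊓n≡n (≮⇒≥ x≮z)) (sym (m≥n⇒m⊓n≡n (m≤n⇒m≤1+n (≮⇒≥ x≮z))))) G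
              ; won = λ y _ y<z → won I y (<-≤-trans y<z (≮⇒≥ x≮z)) y<z
              }
            case (yes x<z) = subst (λ ν → Inv (suc x) (set x′ (suc x) ν)) (when-true (num 1 ⊞ cell x′ ≼ cell z′) body μ (test true (true-≤ᵇ x<z))) record
              { sound′ = sound (unaffected x′ _ (exec body μ) refl (sound imp))
              ; fixed = regs-set regs x′ (suc x) (exec body μ) refl (regs-exec regs body μ refl (fixed I))
              ; P-ok = Holds-frame body μ refl (P-ok I)
              ; V₀-ok = Holds-frame body μ refl (V₀-ok I)
              ; pruned = next (pruned I)
              ; won = λ y y≤x y<z → wins y (m≤n⇒m<n∨m≡n (s≤s⁻¹ y≤x)) y<z
              }
              where
              imp : Improves μ (exec body μ)
              imp = safe-improves body-safe μ (sound′ I)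
              μ₁ μ₂ : Memory
              μ₁ = exec descent μ
              μ₂ = exec (f′ ⟵ firstᵗ (nz (W′ at v0) & nz (V′ at v0))) μ₁
              S₁ : Sound μ₁
              S₁ = sound (safe-improves descent-safe μ (sound′ I))
              S₂ : Sound μ₂
              S₂ = sound (unaffected f′ _ μ₁ refl S₁)
              descended : Holds μ₁ W′ (chain j x V₀) × (∀ k → k < j → Won V₀ x k μ₁)
              descended = Descent.descent-spec x x<n V₀ μ (sound′ I)
                (proj₁ (fixed I) , proj₁ (proj₂ (fixed I)) , proj₁ (proj₂ (proj₂ (fixed I))) , proj₁ (proj₂ (proj₂ (proj₂ (proj₂ (fixed I))))) , tt)
                (P-ok I) (V₀-ok I) ex
              next : ∃[ V ] (Holds μ V′ V × Pruned M j V₀ (x ⊓ z) V) →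
                     ∃[ V ] (Holds (exec body μ) V′ V × Pruned M j V₀ (suc x ⊓ z) V)
              next (V , hV , G) = remove j (chain j x V₀) V , hV⁺ ,
                subst (λ k → Pruned M j V₀ k (remove j (chain j x V₀) V)) (sym (m≤n⇒m⊓n≡m x<z))
                  (prune (<-trans x<z z<M) (subst (λ k → Pruned M j V₀ k V) (m≤n⇒m⊓n≡m (<⇒≤ x<z)) G))
                where
                hV₁ : Holds μ₁ V′ V
                hV₁ = Holds-frame descent μ refl hV
                f≡ : μ₂ f′ 0 ≡ first n (λ v → chain j x V₀ v ∧ V v)
                f≡ = trans (assign-cell f′ (firstᵗ (nz (W′ at v0) & nz (V′ at v0))) μ₁ (size S₁) 0<n)
                  (first-cong n λ v v<n → cong₂ _∧_ (proj₁ descended v v<n) (hV₁ v v<n))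
                hV⁺ : Holds (exec body μ) V′ (remove j (chain j x V₀) V)
                hV⁺ v v<n = trans (assign-mem V′ removeᵇ μ₂ (size S₂) v<n)
                  (cong₂ _∧_ (hV₁ v v<n) (cong (λ f → not ((v ≤ᵇ f) ∧ (f ≤ᵇ v))) f≡))
              wins : ∀ y → y < x ⊎ y ≡ x → y < z → ∀ k → k < j → Won V₀ y k (exec body μ)
              wins y (inj₁ y<x) y<z k k<j large many = ≤-trans (won I y y<x y<z k k<j large many) (grows imp)
              wins y (inj₂ refl) y<z k k<j large many = ≤-trans (proj₂ descended k k<j large many)
                (grows (assign-improves V′ removeᵇ μ₂ refl S₂))

          pruning-spec : ∀ μ → Sound μ → Regs regs μ → Holds μ P′ P → Holds μ V₀′ V₀ → Holds μ V′ V₀ → Inv n (exec pruning μ)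
          pruning-spec μ S R hP hV₀ hV = for-ind {x′} {when (num 1 ⊞ cell x′ ≼ cell z′) body} refl refl refl Inv μ (size S)
            (record { sound′ = sound (unaffected x′ _ μ refl S) ; fixed = R ; P-ok = hP ; V₀-ok = hV₀
                    ; pruned = V₀ , hV , record { V⊆V₀ = λ _ _ h → h ; few = m≤m+n _ 0 ; gain = ≤-reflexive (+-identityʳ _) ; loss = m≤m+n _ 0 }
                    ; won = λ _ () })
            λ x ν x<n _ ex I → step x ν x<n ex I

          Progress : Memory → Set
          Progress μ = ∃[ V ] (Holds μ V′ V × # n V + (# n P ∸ 2 * s) ^ j ≤ # n V₀ ×
                               # n (λ v → B v ∧ V₀ v) ≤ # n (λ v → B v ∧ V v) + outsiders ^ j)

          -- If `best` is still below s, then by `won` no stage with M vertices allowed an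
          -- extraction, so all sequences are barren. Then `many-large` and `avoids-few` evaluate
          -- the two counts in `Pruned`.
          pruning-progress : (16 * d) ^ j * M ≤ # n V₀ → ∀ μ → Inv n μ → s ≤ μ best 0 ⊎ Progress μ
          pruning-progress big μ I = case (s ≤? μ best 0) (pruned I)
            where
            case : Dec (s ≤ μ best 0) → ∃[ V ] (Holds μ V′ V × Pruned M j V₀ (n ⊓ z) V) → s ≤ μ best 0 ⊎ Progress μ
            case (yes win) _ = inj₁ win
            case (no lose) (V , hV , G) = inj₂ (V , hV ,
              ≤-trans (+-monoʳ-≤ (# n V) (many-large M j V₀ barren big)) (Pruned.gain G′) ,
              ≤-trans (Pruned.loss G′) (≤-reflexive (cong (# n (λ v → B v ∧ V v) +_) (avoids-few j))))
              where
              G′ : Pruned M j V₀ z V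
              G′ = subst (λ k → Pruned M j V₀ k V) (m≥n⇒m⊓n≡n (<⇒≤ z<n)) G
              barren : ∀ x → x < z → Barren M j x V₀
              barren x x<z k k<j large = ≮⇒≥ λ many → lose (won I x (<-trans x<z z<n) x<z k k<j large (<⇒≤ many))

-- The search finds a biclique of the promised size.

module Finding where

  open import Data.List using ([]; _∷_)
  open import Data.Nat hiding (_!)
  open import Data.Nat.Properties
  open import Data.Nat.Tactic.RingSolver using (solve-∀)
  open import Data.Vec using ([]; _∷_)
  open import Defs using (Memory)
  open Sums
  open Lang
  open Extraction
  open Search
  open Params
  open Algorithm
  open Extracting
  open Searching

  module Finds (n : ℕ) (0<n : 0 < n) (μ₀ : Memory) where

    open Searches n 0<n μ₀ public

    -- As `best` never decreases, one round with the right counter value is enough, whatever the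
    -- other rounds do.
    for-reach : ∀ {a c ps s v} → writes a c ≡ false → writes 0 c ≡ false → (5 ≤ᵇ a) ≡ true → Safe c →
                untouched ps c ≡ true → distinct a ps ≡ true → v < n →
                (∀ ν → Sound ν → Regs ((a , v) ∷ ps) ν → s ≤ exec c ν best 0) →
                ∀ μ → Sound μ → Regs ps μ → s ≤ exec (for a c) μ best 0
    for-reach {a} {c} {ps} {s} {v} wa w0 5≤a safe ups da v<n reach μ S R =
      proj₂ (proj₂ (for-ind wa w0 a≢0 Inv μ (size S)
        (sound (unaffected a _ μ 5≤a S) , regs-set ps a 0 μ da R , λ ()) step)) v<n
      where
      a≢0 : (a ≡ᵇ 0) ≡ false
      a≢0 = ≢⇒≡ᵇ {a} {0} λ { refl → zero-case 5≤a }
        where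
        zero-case : (5 ≤ᵇ 0) ≡ true → ⊥
        zero-case ()
      Inv : ℕ → Memory → Set
      Inv i ν = Sound ν × Regs ps ν × (v < i → s ≤ ν best 0)
      best-kept : ∀ i ν → set a i ν best 0 ≡ ν best 0
      best-kept i ν = if-false (≢⇒≡ᵇ {a} {best} λ { refl → four-case 5≤a })
        where
        four-case : (5 ≤ᵇ 4) ≡ true → ⊥
        four-case ()
      step : ∀ i ν → i < n → ν 0 0 ≡ n → ν a 0 ≡ i → Inv i ν → Inv (suc i) (set a (suc i) (exec c ν))
      step i ν _ _ ei (S , R , W) =
        sound (unaffected a _ (exec c ν) 5≤a (sound imp)) ,
        regs-set ps a (suc i) (exec c ν) da (regs-exec ps c ν ups R) ,
        λ v≤i → ≤-trans (case (m≤n⇒m<n∨m≡n (s≤s⁻¹ v≤i))) (≤-reflexive (sym (best-kept (suc i) (exec c ν))))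
        where
        imp : Improves ν (exec c ν)
        imp = safe-improves safe ν S
        case : v < i ⊎ v ≡ i → s ≤ exec c ν best 0
        case (inj₁ v<i)  = ≤-trans (W v<i) (grows imp)
        case (inj₂ refl) = reach ν S (ei , R)

    module Rounds (A B : ℕ → Bool) (biclique : ∀ u v → u < n → v < n → A u ≡ true → B v ≡ true → g u v ≡ true)
                  (d E : ℕ) (1≤d : 1 ≤ d) (q : ℕ) {{_ : NonZero q}} (j M : ℕ)
                  (enough : 2 * (2 ^ E * (d * E)) ≤ M) (j<n : j < n) (z<M : q ^ j < M) (z<n : q ^ j < n)
                  (descend : 2 * ((16 * d) ^ j * M) ≤ # n B) (1≤m : 1 ≤ # n B) where

      open Phases A B biclique d E 1≤d q j M enough

      module _ (e : ℕ) (U : ℕ → Bool) where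

        P : ℕ → Bool
        P u = U u ∧ interval e q u

        P⊆ : ∀ u → u < n → P u ≡ true → interval e q u ≡ true
        P⊆ u _ h = proj₂ (∧-true {U u} h)

        open Two e P P⊆ j<n
        open Hidden.Second n g A B biclique d (d * E) 1≤d e q P P⊆ using (outsiders)

        gain loss m : ℕ
        gain = (# n P ∸ 2 * s) ^ j
        loss = outsiders ^ j
        m = # n B

        -- The account after r rounds without success: each has removed at least `gain` vertices,
        -- and at most `loss` of them from B.
        Remaining : ℕ → Memory → Set
        Remaining r μ = ∃[ V ] (Holds μ V′ V × r * gain + # n V ≤ n × m ≤ # n (λ v → B v ∧ V v) + r * loss)

        module _ (1≤gain : 1 ≤ gain) (boost : 2 * n * loss ≤ m * gain) where

          open ≤-Reasoning

          -- Since r * gain ≤ n, the inequality 2 n loss ≤ m gain gives 2 r loss ≤ m. So at least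
          -- half of B is left, and it lies in V.
          remains : ∀ r V → r * gain + # n V ≤ n → m ≤ # n (λ v → B v ∧ V v) + r * loss → m ≤ 2 * # n V
          remains r V total left = +-cancelʳ-≤ m m (2 * # n V) (begin
            m + m                                        ≡⟨ cong (m +_) (sym (+-identityʳ m)) ⟩
            2 * m                                        ≤⟨ *-monoʳ-≤ 2 left ⟩
            2 * (# n (λ v → B v ∧ V v) + r * loss)       ≡⟨ *-distribˡ-+ 2 (# n (λ v → B v ∧ V v)) (r * loss) ⟩
            2 * # n (λ v → B v ∧ V v) + 2 * (r * loss)   ≤⟨ +-mono-≤ (*-monoʳ-≤ 2 (#-mono n λ v _ h → proj₂ (∧-true {B v} h))) small ⟩
            2 * # n V + m                                ∎)
            where
            shuffle : ∀ r l g → 2 * (r * l) * g ≡ 2 * (r * g) * l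
            shuffle = solve-∀
            small : 2 * (r * loss) ≤ m
            small = *-cancelʳ-≤ (2 * (r * loss)) m gain {{>-nonZero 1≤gain}} (begin
              2 * (r * loss) * gain      ≡⟨ shuffle r loss gain ⟩
              2 * (r * gain) * loss      ≤⟨ *-monoˡ-≤ loss (*-monoʳ-≤ 2 (≤-trans (m≤m+n (r * gain) (# n V)) total)) ⟩
              2 * n * loss               ≤⟨ boost ⟩
              m * gain                   ∎)

          record Inv (r : ℕ) (μ : Memory) : Set where
            field
              sound′   : Sound μ
              fixed    : Regs regs μ
              P-ok     : Holds μ P′ P
              progress : s ≤ μ best 0 ⊎ Remaining r μ
          open Inv

          body : Cmd
          body = V₀′ ⟵ V′ at v0 ⨟ pruning

          body-safe : Safe body
          body-safe = assigns refl then pruning-safe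

          step : ∀ r μ → Inv r μ → Inv (suc r) (set r′ (suc r) (exec body μ))
          step r μ I = record
            { sound′ = sound (unaffected r′ _ (exec body μ) refl (sound imp))
            ; fixed = regs-set regs r′ (suc r) (exec body μ) refl (regs-exec regs body μ refl (fixed I))
            ; P-ok = Holds-frame body μ refl (P-ok I)
            ; progress = case (progress I)
            }
            where
            imp : Improves μ (exec body μ)
            imp = safe-improves body-safe μ (sound′ I)
            case : s ≤ μ best 0 ⊎ Remaining r μ → s ≤ exec body μ best 0 ⊎ Remaining (suc r) (exec body μ)
            case (inj₁ win) = inj₁ (≤-trans win (grows imp))
            case (inj₂ (V , hV , total , left)) = combine
              -- Because m ≤ 2 |V|, the assumption `descend` makes V large enough to start another
              -- round of j steps from it.
              (pruning-progress (*-cancelˡ-≤ 2 (≤-trans descend (remains r V total left))) (exec body μ)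
                (pruning-spec μ₁ S₁ (fixed I) (P-ok I) hV₁ hV))
              where
              open Prune z<M z<n V using (Progress; pruning-spec; pruning-progress)
              μ₁ : Memory
              μ₁ = exec (V₀′ ⟵ V′ at v0) μ
              S₁ : Sound μ₁
              S₁ = sound (unaffected V₀′ _ μ refl (sound′ I))
              hV₁ : Holds μ₁ V₀′ V
              hV₁ v v<n = trans (cong nonzero (assign-cell V₀′ (V′ at v0) μ (size (sound′ I)) v<n)) (hV v v<n)
              combine : s ≤ exec body μ best 0 ⊎ Progress (exec body μ) → s ≤ exec body μ best 0 ⊎ Remaining (suc r) (exec body μ)
              combine (inj₁ win) = inj₁ win
              combine (inj₂ (V₁ , hV₁ , more , fewer)) = inj₂ (V₁ , hV₁ ,
                (begin
                  gain + r * gain + # n V₁      ≡⟨ shuffle gain (r * gain) (# n V₁) ⟩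
                  r * gain + (# n V₁ + gain)    ≤⟨ +-monoʳ-≤ (r * gain) more ⟩
                  r * gain + # n V              ≤⟨ total ⟩
                  n                             ∎) ,
                (begin
                  m                                                  ≤⟨ left ⟩
                  # n (λ v → B v ∧ V v) + r * loss                   ≤⟨ +-monoˡ-≤ (r * loss) fewer ⟩
                  # n (λ v → B v ∧ V₁ v) + loss + r * loss           ≡⟨ +-assoc (# n (λ v → B v ∧ V₁ v)) loss (r * loss) ⟩
                  # n (λ v → B v ∧ V₁ v) + (loss + r * loss)         ∎))
                where
                shuffle : ∀ a b c → a + b + c ≡ b + (c + a)
                shuffle = solve-∀

          secondPhase-spec : ∀ μ → Sound μ → Regs regs μ → Holds μ U′ U → s ≤ exec secondPhase μ best 0
          secondPhase-spec μ S R hU = finish (progress final)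
            where
            μ₁ μ₂ : Memory
            μ₁ = exec (P′ ⟵ᵇ nz (U′ at v0) & cell e′ ≼ v0 & num 1 ⊞ v0 ≼ cell e′ ⊞ cell q′) μ
            μ₂ = exec (V′ ⟵ᵇ ~ never) μ₁
            S₁ : Sound μ₁
            S₁ = sound (unaffected P′ _ μ refl S)
            S₂ : Sound μ₂
            S₂ = sound (unaffected V′ _ μ₁ refl S₁)
            e≡ : μ e′ 0 ≡ e
            e≡ = proj₁ (proj₂ (proj₂ (proj₂ (proj₂ R))))
            initial : Inv 0 (set r′ 0 μ₂)
            initial = record
              { sound′ = sound (unaffected r′ _ μ₂ refl S₂)
              ; fixed = R
              ; P-ok = λ u u<n → trans (assign-mem P′ (nz (U′ at v0) & cell e′ ≼ v0 & num 1 ⊞ v0 ≼ cell e′ ⊞ cell q′) μ (size S) u<n)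
                  (cong₂ _∧_ (hU u u<n) (cong₂ (λ e q → (e ≤ᵇ u) ∧ (suc u ≤ᵇ e + q)) e≡ (proj₁ (proj₂ R))))
              ; progress = inj₂ ((λ _ → true) , (λ v v<n → assign-mem V′ (~ never) μ₁ (size S₁) v<n) ,
                  ≤-reflexive (#-all n) , ≤-trans (#-mono n λ v _ Bv → ∧-intro Bv refl) (m≤m+n _ 0))
              }
            final : Inv n (exec secondPhase μ)
            final = for-ind {r′} {body} refl refl refl Inv μ₂ (size S₂) initial λ r ν _ _ _ I → step r ν I
            finish : s ≤ exec secondPhase μ best 0 ⊎ Remaining n (exec secondPhase μ) → s ≤ exec secondPhase μ best 0
            finish (inj₁ win) = win
            -- After n rounds with at least one removal each, V is empty, contrary to m ≤ 2 |V|.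
            finish (inj₂ (V , _ , total , left)) = contradiction (≤-trans 1≤m (remains n V total left)) (<⇒≱ (s≤s (≤-reflexive (cong (2 *_) empty))))
              where
              empty : # n V ≡ 0
              empty = n≤0⇒n≡0 (+-cancelˡ-≤ n (# n V) 0 (≤-trans (+-monoˡ-≤ (# n V) (m≤m*n n gain {{>-nonZero 1≤gain}})) (≤-trans total (m≤m+n n 0))))

    module _ (A B : ℕ → Bool) (biclique : ∀ u v → u < n → v < n → A u ≡ true → B v ≡ true → g u v ≡ true)
             (m : ℕ) (#A : # n A ≡ m) (#B : # n B ≡ m) (1≤m : 1 ≤ m) where

      singleEdges-finds : ∀ μ → Sound μ → 1 ≤ exec singleEdges μ best 0
      singleEdges-finds μ S = let u , u<n , Au = #-pos n A (subst (1 ≤_) (sym #A) 1≤m)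
                                  v , v<n , Bv = #-pos n B (subst (1 ≤_) (sym #B) 1≤m)
                              in reach u v u<n v<n (biclique u v u<n v<n Au Bv)
        where
        body : Cmd
        body = U′ ⟵ᵇ v0 ≼ cell a′ & cell a′ ≼ v0 ⨟ V′ ⟵ᵇ v0 ≼ cell b′ & cell b′ ≼ v0 ⨟ submit U′ V′
        body-safe : Safe body
        body-safe = assigns refl then assigns refl then submits refl refl
        reach : ∀ u v → u < n → v < n → g u v ≡ true → 1 ≤ exec singleEdges μ best 0
        reach u v u<n v<n uv = for-reach {a′} {for b′ body} {[]} refl refl refl (fors refl body-safe) refl refl u<n
          (for-reach {b′} {body} {(a′ , u) ∷ []} refl refl refl body-safe refl refl v<n inner) μ S tt
          where
          inner : ∀ ν → Sound ν → Regs ((b′ , v) ∷ (a′ , u) ∷ []) ν → 1 ≤ exec body ν best 0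
          inner ν T (bv , au , _) = ≤-trans (≤-reflexive (sym (cong₂ _⊓_ sizeᵘ sizeᵛ)))
            (Submitted.best≥ (submit-spec U′ V′ ν₂ refl refl T₂) λ u′ v′ u′<n v′<n hu hv →
              subst₂ (λ a b → g a b ≡ true) (is u u′ (trans (sym (memᵘ u′ u′<n)) hu)) (is v v′ (trans (sym (memᵛ v′ v′<n)) hv)) uv)
            where
            ν₁ ν₂ : Memory
            ν₁ = exec (U′ ⟵ᵇ v0 ≼ cell a′ & cell a′ ≼ v0) ν
            ν₂ = exec (V′ ⟵ᵇ v0 ≼ cell b′ & cell b′ ≼ v0) ν₁
            T₁ : Sound ν₁
            T₁ = sound (unaffected U′ _ ν refl T)
            T₂ : Sound ν₂
            T₂ = sound (unaffected V′ _ ν₁ refl T₁)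
            memᵘ : Holds ν₂ U′ (λ k → (k ≤ᵇ u) ∧ (u ≤ᵇ k))
            memᵘ k k<n = trans (assign-mem U′ (v0 ≼ cell a′ & cell a′ ≼ v0) ν (size T) k<n) (cong (λ x → (k ≤ᵇ x) ∧ (x ≤ᵇ k)) au)
            memᵛ : Holds ν₂ V′ (λ k → (k ≤ᵇ v) ∧ (v ≤ᵇ k))
            memᵛ k k<n = trans (assign-mem V′ (v0 ≼ cell b′ & cell b′ ≼ v0) ν₁ (size T₁) k<n) (cong (λ x → (k ≤ᵇ x) ∧ (x ≤ᵇ k)) bv)
            sizeᵘ : # n (mem ν₂ U′) ≡ 1
            sizeᵘ = trans (#-cong n memᵘ) (#-single n u<n)
            sizeᵛ : # n (mem ν₂ V′) ≡ 1
            sizeᵛ = trans (#-cong n memᵛ) (#-single n v<n)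
            is : ∀ x k → (k ≤ᵇ x) ∧ (x ≤ᵇ k) ≡ true → x ≡ k
            is x k h = ≤-antisym (≤ᵇ-true {x} (proj₂ (∧-true {k ≤ᵇ x} h))) (≤ᵇ-true {k} (proj₁ (∧-true h)))

      module _ {d E : ℕ} (p : Parameters n m d E) where

        open Parameters p

        private
          s z : ℕ
          s = d * E
          z = q ^ j
          all : ℕ → Bool
          all _ = true

        open Phases A B biclique d E 1≤d q j M enough hiding (s)

        both : Cmd
        both = firstPhase ⨟ secondPhase

        -- Quantified over all memories with these registers, since c, e and t are determined by the
        -- graph before the program runs.
        Reached : ℕ → ℕ → ℕ → Set
        Reached c e t = ∀ ν → Sound ν →
          Regs ((t′ , t) ∷ (e′ , e) ∷ (c′ , c) ∷ (z′ , z) ∷ (j′ , j) ∷ (q′ , q) ∷ (D′ , 16 * d) ∷ []) ν → s ≤ exec both ν best 0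

        first-regs : ∀ {c e t ν} →
          Regs ((t′ , t) ∷ (e′ , e) ∷ (c′ , c) ∷ (z′ , z) ∷ (j′ , j) ∷ (q′ , q) ∷ (D′ , 16 * d) ∷ []) ν →
          Regs ((D′ , 16 * d) ∷ (q′ , q) ∷ (j′ , j) ∷ (z′ , z) ∷ (c′ , c) ∷ (e′ , e) ∷ (t′ , t) ∷ []) ν
        first-regs (t , e , c , z , j , q , D , _) = D , q , j , z , c , e , t , tt

        second-regs : ∀ {c e t ν} →
          Regs ((D′ , 16 * d) ∷ (q′ , q) ∷ (j′ , j) ∷ (z′ , z) ∷ (c′ , c) ∷ (e′ , e) ∷ (t′ , t) ∷ []) ν →
          Regs ((D′ , 16 * d) ∷ (q′ , q) ∷ (j′ , j) ∷ (z′ , z) ∷ (e′ , e) ∷ []) ν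
        second-regs (D , q , j , z , c , e , t , _) = D , q , j , z , e , tt

        choice : ∃[ c ] ∃[ e ] ∃[ t ] (c < n × e < n × t < n × Reached c e t)
        choice = from-block (block n q r (2 * s) B cover (≤-<-trans (*-monoʳ-≤ r (*-monoˡ-≤ s {2} {8} (s≤s (s≤s z≤n)))) (subst (r * (8 * s) <_) (sym #B) blocks)))
          where
          from-block : ∃[ c ] (c < n × 2 * s ≤ # n (λ v → B v ∧ interval c q v)) → ∃[ c ] ∃[ e ] ∃[ t ] (c < n × e < n × t < n × Reached c e t)
          from-block (c , c<n , big) = from-outcome (outcome big j all λ _ _ _ → refl)
            where
            open H.First c q using (chain; Outcome; outcome; Q)
            from-outcome : ∃[ t ] (t < q ^ j × Outcome j all t) → ∃[ c ] ∃[ e ] ∃[ t ] (c < n × e < n × t < n × Reached c e t)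
            -- Extraction succeeds during the first phase already, for any e; 0 is a default value.
            from-outcome (t , t<z , inj₁ (i , i<j , large , many)) = c , 0 , t , c<n , 0<n , t<n , λ ν S R →
              let open One c 0 t z t<n
                  F = firstPhase-spec j<n ν S (first-regs {c} {0} {t} {ν} R)
              in ≤-trans (Result.won″ F i i<j (≤-trans M≤m (≤-trans (≤-reflexive (sym #A)) large)) many)
                         (grows (safe-improves secondPhase-safe (exec firstPhase ν) (Result.sound″ F)))
              where
              t<n : t < n
              t<n = <-trans t<z q^j<n
            from-outcome (t , t<z , inj₂ (A⊆U , shrinks)) = from-dense
              (dense-block n q r s A (chain j t all) cover (subst (r * (8 * s) <_) (sym #A) blocks) A⊆U)
              where
              U : ℕ → Bool
              U = chain j t all
              t<n : t < n
              t<n = <-trans t<z q^j<n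
              from-dense : ∃[ e ] (e < n × # n A * # n (λ u → U u ∧ interval e q u) ≤ 2 * # n U * # n (λ u → A u ∧ interval e q u) ×
                                   4 * s < # n (λ u → A u ∧ interval e q u)) →
                           ∃[ c ] ∃[ e ] ∃[ t ] (c < n × e < n × t < n × Reached c e t)
              from-dense (e , e<n , dense , 4s<a) = c , e , t , c<n , e<n , t<n , λ ν S R →
                let open One c e t z t<n
                    F = firstPhase-spec j<n ν S (first-regs {c} {e} {t} {ν} R)
                in R.secondPhase-spec e U 1≤gain boosted (exec firstPhase ν) (Result.sound″ F) (second-regs {c} {e} {t} {exec firstPhase ν} (Result.fixed″ F)) (Result.U-ok″ F)
                where
                module R = Rounds A B biclique d E 1≤d q j M enough j<n q^j<M q^j<n
                  (subst (2 * ((16 * d) ^ j * M) ≤_) (sym #B) descend) (subst (1 ≤_) (sym #B) 1≤m)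
                P : ℕ → Bool
                P = R.P e U
                a : ℕ
                a = # n (λ u → A u ∧ interval e q u)
                P∧A : # n (λ u → P u ∧ A u) ≡ a
                P∧A = #-cong n λ u u<n → bool-ext
                  (λ h → ∧-intro (proj₂ (∧-true {P u} h)) (proj₂ (∧-true {U u} (proj₁ (∧-true {P u} h)))))
                  (λ h → ∧-intro (∧-intro (A⊆U u u<n (proj₁ (∧-true h))) (proj₂ (∧-true {A u} h))) (proj₁ (∧-true h)))
                p≡ : # n P ≡ a + # n (λ u → P u ∧ not (A u))
                p≡ = trans (#-split n P A) (cong (_+ # n (λ u → P u ∧ not (A u))) P∧A)
                outsiders≡ : # n P ∸ a ≡ # n (λ u → P u ∧ not (A u))
                outsiders≡ = trans (cong (_∸ a) p≡) (m+n∸m≡n a _)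
                a≤p : a ≤ # n P
                a≤p = ≤-trans (m≤m+n a _) (≤-reflexive (sym p≡))
                2s<p : 2 * s < # n P
                2s<p = ≤-<-trans (*-monoˡ-≤ s {2} {4} (s≤s (s≤s z≤n))) (<-≤-trans 4s<a a≤p)
                1≤gain : 1 ≤ R.gain e U
                1≤gain = m^n>0 (# n P ∸ 2 * s) {{>-nonZero (m<n⇒0<n∸m 2s<p)}} j
                boosted : 2 * n * R.loss e U ≤ R.m e U * R.gain e U
                boosted = subst₂ (λ o m → 2 * n * o ^ j ≤ m * (# n P ∸ 2 * s) ^ j) outsiders≡ (sym #B)
                  (boost (# n U) a (# n P) (≤-trans (≤-reflexive (sym #A)) (#-mono n A⊆U))
                    (≤-trans shrinks (≤-reflexive (cong ((16 * d ∸ 2) ^ j *_) (#-all n))))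
                    (≤-trans (s≤s z≤n) 2s<p) a≤p (<⇒≤ 4s<a)
                    (subst (λ m → m * # n P ≤ 2 * # n U * a) #A dense))

        search-finds : ∀ μ → Sound μ → s ≤ exec search μ best 0
        search-finds μ S = from-choice choice
          where
          safe₁ : Safe both
          safe₁ = firstPhase-safe then secondPhase-safe
          from-choice : ∃[ c ] ∃[ e ] ∃[ t ] (c < n × e < n × t < n × Reached c e t) → s ≤ exec search μ best 0
          from-choice (c , e , t , c<n , e<n , t<n , reached) =
            for-reach {D′} {c₆} {[]} refl refl refl safe₇ refl refl D<n
            (for-reach {q′} {c₅} {(D′ , 16 * d) ∷ []} refl refl refl safe₆ refl refl q<n
            (for-reach {j′} {c₄} {(q′ , q) ∷ (D′ , 16 * d) ∷ []} refl refl refl safe₅ refl refl j<n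
            (for-reach {z′} {c₃} {(j′ , j) ∷ (q′ , q) ∷ (D′ , 16 * d) ∷ []} refl refl refl safe₄ refl refl q^j<n
            (for-reach {c′} {c₂} {(z′ , z) ∷ (j′ , j) ∷ (q′ , q) ∷ (D′ , 16 * d) ∷ []} refl refl refl safe₃ refl refl c<n
            (for-reach {e′} {c₁} {(c′ , c) ∷ (z′ , z) ∷ (j′ , j) ∷ (q′ , q) ∷ (D′ , 16 * d) ∷ []} refl refl refl safe₂ refl refl e<n
            (for-reach {t′} {both} {(e′ , e) ∷ (c′ , c) ∷ (z′ , z) ∷ (j′ , j) ∷ (q′ , q) ∷ (D′ , 16 * d) ∷ []} refl refl refl safe₁ refl refl t<n
              reached)))))) μ S tt
            where
            c₁ c₂ c₃ c₄ c₅ c₆ : Cmd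
            c₁ = for t′ both
            c₂ = for e′ c₁
            c₃ = for c′ c₂
            c₄ = for z′ c₃
            c₅ = for j′ c₄
            c₆ = for q′ c₅
            safe₂ : Safe c₁
            safe₂ = fors refl safe₁
            safe₃ : Safe c₂
            safe₃ = fors refl safe₂
            safe₄ : Safe c₃
            safe₄ = fors refl safe₃
            safe₅ : Safe c₄
            safe₅ = fors refl safe₄
            safe₆ : Safe c₅
            safe₆ = fors refl safe₅
            safe₇ : Safe c₆
            safe₇ = fors refl safe₆

-- Lower bounds for Riemann sums of the logarithm.

module LogBounds where

  import Data.Integer as ℤ
  import Data.Integer.Properties as ℤ
  open import Data.List using (foldr; map; applyUpTo)
  open import Data.Nat as ℕ using (ℕ; zero; suc)
  import Data.Nat.Properties as ℕ
  open import Data.Rational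
  open import Data.Rational.Properties
  open import Data.Rational.Solver using (module +-*-Solver)
  import Data.Rational.Unnormalised as ℚᵘ
  import Data.Rational.Unnormalised.Properties as ℚᵘ
  open import Defs using (riemann; step) renaming (_÷_ to _÷₀_)

  ι : ℕ → ℚ
  ι k = ℤ.+ k / 1

  toℚᵘ-ι : ∀ k → toℚᵘ (ι k) ℚᵘ.≃ ℚᵘ.mkℚᵘ (ℤ.+ k) 0
  toℚᵘ-ι k = toℚᵘ-fromℚᵘ (ℚᵘ.mkℚᵘ (ℤ.+ k) 0)

  ι-+ : ∀ a b → ι (a ℕ.+ b) ≡ ι a + ι b
  ι-+ a b = toℚᵘ-injective (ℚᵘ.≃-trans (toℚᵘ-ι (a ℕ.+ b)) (ℚᵘ.≃-sym (ℚᵘ.≃-trans (toℚᵘ-homo-+ (ι a) (ι b))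
    (ℚᵘ.≃-trans (ℚᵘ.+-cong (toℚᵘ-ι a) (toℚᵘ-ι b)) (ℚᵘ.*≡* (cong (ℤ._* ℤ.+ 1) (trans (cong₂ ℤ._+_ (ℤ.*-identityʳ (ℤ.+ a)) (ℤ.*-identityʳ (ℤ.+ b))) (sym (ℤ.pos-+ a b)))))))))

  ι-* : ∀ a b → ι (a ℕ.* b) ≡ ι a * ι b
  ι-* a b = toℚᵘ-injective (ℚᵘ.≃-trans (toℚᵘ-ι (a ℕ.* b)) (ℚᵘ.≃-sym (ℚᵘ.≃-trans (toℚᵘ-homo-* (ι a) (ι b))
    (ℚᵘ.≃-trans (ℚᵘ.*-cong (toℚᵘ-ι a) (toℚᵘ-ι b)) (ℚᵘ.*≡* (cong (ℤ._* ℤ.+ 1) (sym (ℤ.pos-* a b))))))))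

  ι-mono : ∀ {a b} → a ℕ.≤ b → ι a ≤ ι b
  ι-mono {a} {b} a≤b = toℚᵘ-cancel-≤ (ℚᵘ.≤-trans (ℚᵘ.≤-reflexive (toℚᵘ-ι a)) (ℚᵘ.≤-trans
    (ℚᵘ.*≤* (ℤ.*-monoʳ-≤-nonNeg (ℤ.+ 1) (ℤ.+≤+ a≤b))) (ℚᵘ.≤-reflexive (ℚᵘ.≃-sym (toℚᵘ-ι b)))))

  0≤ι : ∀ k → 0ℚ ≤ ι k
  0≤ι k = ι-mono {0} {k} ℕ.z≤n

  inv : ℕ → ℚ
  inv k = ℤ.+ 1 / suc k

  ι*inv : ∀ k → ι (suc k) * inv k ≡ 1ℚ
  ι*inv k = toℚᵘ-injective (ℚᵘ.≃-trans (toℚᵘ-homo-* (ι (suc k)) (inv k)) (ℚᵘ.≃-trans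
    (ℚᵘ.*-cong (toℚᵘ-ι (suc k)) (toℚᵘ-fromℚᵘ (ℚᵘ.mkℚᵘ (ℤ.+ 1) k))) (ℚᵘ.*≡* (lemma (ℤ.+ suc k)))))
    where
    lemma : ∀ i → i ℤ.* ℤ.+ 1 ℤ.* ℤ.+ 1 ≡ ℤ.+ 1 ℤ.* (ℤ.+ 1 ℤ.* i)
    lemma i = trans (ℤ.*-identityʳ _) (trans (ℤ.*-identityʳ i) (sym (trans (ℤ.*-identityˡ _) (ℤ.*-identityˡ i))))

  *-monoʳ : ∀ {a b c} → 0ℚ ≤ c → a ≤ b → a * c ≤ b * c
  *-monoʳ {c = c} 0≤c = *-monoʳ-≤-nonNeg c {{nonNegative 0≤c}}

  *-monoˡ : ∀ {a b c} → 0ℚ ≤ c → a ≤ b → c * a ≤ c * b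
  *-monoˡ {c = c} 0≤c = *-monoˡ-≤-nonNeg c {{nonNegative 0≤c}}

  0≤* : ∀ {a b} → 0ℚ ≤ a → 0ℚ ≤ b → 0ℚ ≤ a * b
  0≤* {a} {b} 0≤a 0≤b = ≤-trans (≤-reflexive (sym (*-zeroˡ b))) (*-monoʳ 0≤b 0≤a)

  p≤q⇒0≤q-p : ∀ {p q} → p ≤ q → 0ℚ ≤ q - p
  p≤q⇒0≤q-p {p} p≤q = ≤-trans (≤-reflexive (sym (+-inverseʳ p))) (+-monoˡ-≤ (- p) p≤q)

  0≤inv : ∀ k → 0ℚ ≤ inv k
  0≤inv k = nonNegative⁻¹ (inv k) {{pos⇒nonNeg (inv k) {{normalize-pos 1 (suc k)}}}}

  inv-decreasing : ∀ k → inv (suc k) ≤ inv k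
  inv-decreasing k = begin
    inv (suc k)                              ≡⟨ sym (*-identityʳ _) ⟩
    inv (suc k) * 1ℚ                         ≡⟨ cong (inv (suc k) *_) (sym (ι*inv k)) ⟩
    inv (suc k) * (ι (suc k) * inv k)        ≤⟨ *-monoˡ (0≤inv (suc k)) (*-monoʳ (0≤inv k) (ι-mono (ℕ.n≤1+n (suc k)))) ⟩
    inv (suc k) * (ι (2 ℕ.+ k) * inv k)      ≡⟨ solve 3 (λ a b c → a :* (b :* c) := b :* a :* c) refl (inv (suc k)) (ι (2 ℕ.+ k)) (inv k) ⟩
    ι (2 ℕ.+ k) * inv (suc k) * inv k        ≡⟨ cong (_* inv k) (ι*inv (suc k)) ⟩
    1ℚ * inv k                               ≡⟨ *-identityˡ _ ⟩
    inv k                                    ∎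
    where
    open ≤-Reasoning
    open +-*-Solver

  ÷-cancel : ∀ h t → 0ℚ < t → (h ÷₀ t) * t ≡ h
  ÷-cancel h t 0<t with t ≟ 0ℚ
  ... | yes t≡0 = contradiction 0<t (λ lt → <-irrefl (sym t≡0) lt)
  ... | no  t≢0 = trans (*-assoc h _ t) (trans (cong (h *_) (*-inverseˡ t {{≢-nonZero t≢0}})) (*-identityʳ h))

  ÷-lower : ∀ {c h t} → 0ℚ < t → c * t ≤ h → c ≤ h ÷₀ t
  ÷-lower {c} {h} {t} 0<t le = *-cancelʳ-≤-pos t {{positive 0<t}} (≤-trans le (≤-reflexive (sym (÷-cancel h t 0<t))))

  ÷-upper : ∀ {c h t} → 0ℚ < t → h ≤ c * t → h ÷₀ t ≤ c
  ÷-upper {c} {h} {t} 0<t le = *-cancelʳ-≤-pos t {{positive 0<t}} (≤-trans (≤-reflexive (÷-cancel h t 0<t)) le)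

  total : (ℕ → ℚ) → ℕ → ℚ
  total f zero    = 0ℚ
  total f (suc k) = total f k + f k

  map-applyUpTo : ∀ (f : ℕ → ℕ) (h : ℕ → ℚ) n → map h (applyUpTo f n) ≡ applyUpTo (λ i → h (f i)) n
  map-applyUpTo f h zero    = refl
  map-applyUpTo f h (suc n) = cong (h (f 0) Data.List.∷_) (map-applyUpTo (λ i → f (suc i)) h n)

  foldr-total : ∀ f n → foldr _+_ 0ℚ (applyUpTo f n) ≡ total f n
  foldr-total f zero    = refl
  foldr-total f (suc n) = trans (cong (f 0 +_) (foldr-total (λ i → f (suc i)) n)) (front f n)
    where
    front : ∀ f n → f 0 + total (λ i → f (suc i)) n ≡ total f (suc n)
    front f zero    = trans (+-identityʳ (f 0)) (sym (+-identityˡ (f 0)))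
    front f (suc n) = trans (sym (+-assoc (f 0) (total (λ i → f (suc i)) n) (f (suc n)))) (cong (_+ f (suc n)) (front f n))

  module Identities where

    open +-*-Solver

    advance : ∀ z h → 1ℚ + (1ℚ + z) * h ≡ (1ℚ + z * h) + h
    advance = solve 2 (λ z h → con 1ℚ :+ (con 1ℚ :+ z) :* h := (con 1ℚ :+ z :* h) :+ h) refl

    rotate : ∀ a b c → a * (b * c) ≡ b * (a * c)
    rotate = solve 3 (λ a b c → a :* (b :* c) := b :* (a :* c)) refl

    restore : ∀ x → 1ℚ + (x - 1ℚ) ≡ x
    restore = solve 1 (λ x → con 1ℚ :+ (x :- con 1ℚ) := x) refl

    join : ∀ B c a y w → B + (c - a) * w + (y - c) * w ≡ B + (y - a) * w
    join = solve 5 (λ B c a y w → B :+ (c :- a) :* w :+ (y :- c) :* w := B :+ (y :- a) :* w) refl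

    vanish : ∀ b w → 0ℚ + (b - b) * w ≡ 0ℚ
    vanish = solve 2 (λ b w → con 0ℚ :+ (b :- b) :* w := con 0ℚ) refl

    extend : ∀ B y h b w → B + (y + h - b) * w ≡ B + (y - b) * w + w * h
    extend = solve 5 (λ B y h b w → B :+ (y :+ h :- b) :* w := B :+ (y :- b) :* w :+ w :* h) refl

    shuffle : ∀ w h y → w * h * y ≡ h * (w * y)
    shuffle = solve 3 (λ w h y → w :* h :* y := h :* (w :* y)) refl

  module Riemann (m : ℕ) (x : ℚ) (1≤x : 1ℚ ≤ x) where

    open ≤-Reasoning
    open Identities

    h : ℚ
    h = step m x

    t S : ℕ → ℚ
    t i = 1ℚ + ι i * h
    S = total (λ i → h ÷₀ t i)

    riemann≡ : riemann m x ≡ S (suc m)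
    riemann≡ = trans (cong (foldr _+_ 0ℚ) (map-applyUpTo (λ i → i) (λ i → h ÷₀ t i) (suc m))) (foldr-total (λ i → h ÷₀ t i) (suc m))

    0≤h : 0ℚ ≤ h
    0≤h = 0≤* (p≤q⇒0≤q-p 1≤x) (0≤inv m)

    t-suc : ∀ i → t (suc i) ≡ t i + h
    t-suc i = trans (cong (λ z → 1ℚ + z * h) (ι-+ 1 i)) (advance (ι i) h)

    t-0 : t 0 ≡ 1ℚ
    t-0 = trans (cong (1ℚ +_) (*-zeroˡ h)) (+-identityʳ 1ℚ)

    t-last : t (suc m) ≡ x
    t-last = begin-equality
      1ℚ + ι (suc m) * ((x - 1ℚ) * inv m)     ≡⟨ cong (1ℚ +_) (rotate (ι (suc m)) (x - 1ℚ) (inv m)) ⟩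
      1ℚ + (x - 1ℚ) * (ι (suc m) * inv m)     ≡⟨ cong (λ z → 1ℚ + (x - 1ℚ) * z) (ι*inv m) ⟩
      1ℚ + (x - 1ℚ) * 1ℚ                      ≡⟨ cong (1ℚ +_) (*-identityʳ (x - 1ℚ)) ⟩
      1ℚ + (x - 1ℚ)                           ≡⟨ restore x ⟩
      x                                       ∎

    t≤t : ∀ i → t i ≤ t (suc i)
    t≤t i = ≤-trans (≤-reflexive (sym (+-identityʳ (t i)))) (≤-trans (+-monoʳ-≤ (t i) 0≤h) (≤-reflexive (sym (t-suc i))))

    1≤t : ∀ i → 1ℚ ≤ t i
    1≤t zero    = ≤-reflexive (sym t-0)
    1≤t (suc i) = ≤-trans (1≤t i) (t≤t i)

    0<t : ∀ i → 0ℚ < t i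
    0<t i = <-≤-trans (positive⁻¹ 1ℚ) (1≤t i)

    -- A lower bound by a concave piecewise linear function with breakpoints
    -- b₀ < b₁ < … and slopes w k ≤ 1 / b (k + 1).
    module Lower (b w base : ℕ → ℚ)
                 (b-0 : b 0 ≡ 1ℚ) (base-0 : base 0 ≡ 0ℚ)
                 (base-suc : ∀ k → base (suc k) ≡ base k + (b (suc k) - b k) * w k)
                 (0≤w : ∀ k → 0ℚ ≤ w k) (w-decreasing : ∀ k → w (suc k) ≤ w k)
                 (slope : ∀ k → w k * b (suc k) ≤ 1ℚ)
                 (spacing : ∀ k → b k + h ≤ b (suc k)) where

      φ : ℕ → ℚ → ℚ
      φ k y = base k + (y - b k) * w k

      -- Consecutive lines meet at their common breakpoint, and to the right of it the one with the
      -- smaller slope is lower.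
      next-line : ∀ k y → b (suc k) ≤ y → φ (suc k) y ≤ φ k y
      next-line k y le = begin
        base (suc k) + (y - b (suc k)) * w (suc k)                  ≤⟨ +-monoʳ-≤ (base (suc k)) (*-monoˡ (p≤q⇒0≤q-p le) (w-decreasing k)) ⟩
        base (suc k) + (y - b (suc k)) * w k                        ≡⟨ cong (_+ (y - b (suc k)) * w k) (base-suc k) ⟩
        base k + (b (suc k) - b k) * w k + (y - b (suc k)) * w k    ≡⟨ join (base k) (b (suc k)) (b k) y (w k) ⟩
        base k + (y - b k) * w k                                    ∎

      b-increasing : ∀ k → b k ≤ b (suc k)
      b-increasing k = ≤-trans (≤-trans (≤-reflexive (sym (+-identityʳ (b k)))) (+-monoʳ-≤ (b k) 0≤h)) (spacing k)

      base-increasing : ∀ k → base k ≤ base (suc k)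
      base-increasing k = ≤-trans (≤-reflexive (sym (+-identityʳ (base k)))) (≤-trans (+-monoʳ-≤ (base k) (0≤* (p≤q⇒0≤q-p (b-increasing k)) (0≤w k)))
        (≤-reflexive (sym (base-suc k))))

      base-mono : ∀ k o → base k ≤ base (k ℕ.+ o)
      base-mono k zero    = ≤-reflexive (cong base (sym (ℕ.+-identityʳ k)))
      base-mono k (suc o) = ≤-trans (base-mono k o) (≤-trans (base-increasing (k ℕ.+ o)) (≤-reflexive (cong base (sym (ℕ.+-suc k o)))))

      line-mono : ∀ k o y → b (k ℕ.+ o) ≤ y → φ (k ℕ.+ o) y ≤ φ k y
      line-mono k zero    y le = ≤-reflexive (cong (λ z → φ z y) (ℕ.+-identityʳ k))
      line-mono k (suc o) y le = ≤-trans (≤-reflexive (cong (λ z → φ z y) (ℕ.+-suc k o)))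
        (≤-trans (next-line (k ℕ.+ o) y le′) (line-mono k o y (≤-trans (b-increasing (k ℕ.+ o)) le′)))
        where
        le′ : b (suc (k ℕ.+ o)) ≤ y
        le′ = subst (λ z → b z ≤ y) (ℕ.+-suc k o) le

      -- The grid point lies on the k-th piece and that line bounds the sum. A step is no longer
      -- than a piece, so it crosses at most one breakpoint; and up to b (k + 1) the integrand 1 / t
      -- is at least the slope.
      Below : ℕ → Set
      Below i = ∃[ k ] (b k ≤ t i × t i ≤ b (suc k) × φ k (t i) ≤ S i)

      grow : ∀ i k → t i ≤ b (suc k) → φ k (t i) ≤ S i → φ k (t (suc i)) ≤ S (suc i)
      grow i k hi le = begin
        base k + (t (suc i) - b k) * w k     ≡⟨ cong (λ y → base k + (y - b k) * w k) (t-suc i) ⟩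
        base k + (t i + h - b k) * w k       ≡⟨ extend (base k) (t i) h (b k) (w k) ⟩
        φ k (t i) + w k * h                  ≤⟨ +-mono-≤ le (÷-lower {w k * h} {h} {t i} (0<t i) contribution) ⟩
        S i + (h ÷₀ t i)                     ∎
        where
        contribution : w k * h * t i ≤ h
        contribution = begin
          w k * h * t i      ≡⟨ shuffle (w k) h (t i) ⟩
          h * (w k * t i)    ≤⟨ *-monoˡ 0≤h (≤-trans (*-monoˡ (0≤w k) hi) (slope k)) ⟩
          h * 1ℚ             ≡⟨ *-identityʳ h ⟩
          h                  ∎

      below : ∀ i → Below i
      below zero = 0 , ≤-reflexive (trans b-0 (sym t-0)) , ≤-trans (≤-reflexive (trans t-0 (sym b-0))) (b-increasing 0) , ≤-reflexive at-0
        where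
        at-0 : φ 0 (t 0) ≡ 0ℚ
        at-0 = begin-equality
          base 0 + (t 0 - b 0) * w 0     ≡⟨ cong₂ (λ B y → B + (y - b 0) * w 0) base-0 (trans t-0 (sym b-0)) ⟩
          0ℚ + (b 0 - b 0) * w 0         ≡⟨ vanish (b 0) (w 0) ⟩
          0ℚ                             ∎
      below (suc i) = advance-below (below i)
        where
        advance-below : Below i → Below (suc i)
        advance-below (k , lo , hi , le) = choose-line (≤-total (t (suc i)) (b (suc k)))
          where
          choose-line : t (suc i) ≤ b (suc k) ⊎ b (suc k) ≤ t (suc i) → Below (suc i)
          choose-line (inj₁ inside)  = k , ≤-trans lo (t≤t i) , inside , grow i k hi le
          choose-line (inj₂ outside) = suc k , outside , ≤-trans (≤-reflexive (t-suc i)) (≤-trans (+-monoˡ-≤ h hi) (spacing (suc k))) ,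
            ≤-trans (next-line k (t (suc i)) outside) (grow i k hi le)

      base≤φ : ∀ k y → b k ≤ y → base k ≤ φ k y
      base≤φ k y le = ≤-trans (≤-reflexive (sym (+-identityʳ (base k)))) (+-monoʳ-≤ (base k) (0≤* (p≤q⇒0≤q-p le) (0≤w k)))

      lower : ∀ K → b K ≤ x → base K ≤ riemann m x
      lower K b≤x = ≤-trans (reach (below (suc m))) (≤-reflexive (sym riemann≡))
        where
        reach : Below (suc m) → base K ≤ S (suc m)
        reach (k , lo , _ , le) = compare (ℕ.≤-total K k)
          where
          past : ∃[ o ] K ℕ.+ o ≡ k → base K ≤ S (suc m)
          past (o , eq) = ≤-trans (base-mono K o) (≤-trans (≤-reflexive (cong base eq)) (≤-trans (base≤φ k (t (suc m)) lo) le))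
          short : ∃[ o ] k ℕ.+ o ≡ K → base K ≤ S (suc m)
          short (o , eq) = ≤-trans (base≤φ K x b≤x) (≤-trans (≤-reflexive (cong (λ z → φ z x) (sym eq)))
            (≤-trans (line-mono k o x (≤-trans (≤-reflexive (cong b eq)) b≤x)) (≤-trans (≤-reflexive (cong (φ k) (sym t-last))) le)))
          compare : K ℕ.≤ k ⊎ k ℕ.≤ K → base K ≤ S (suc m)
          compare (inj₁ K≤k) = past (ℕ.m≤n⇒∃[o]m+o≡n K≤k)
          compare (inj₂ k≤K) = short (ℕ.m≤n⇒∃[o]m+o≡n k≤K)

-- Explicit bounds for log n, log log n and their ratio.

module LogLog where

  open import Data.Nat as ℕ using (ℕ; zero; suc)
  import Data.Nat.Properties as ℕ
  open import Data.Rational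
  open import Data.Rational.Properties
  open import Data.Rational.Solver using (module +-*-Solver)
  open import Defs using (riemann; step) renaming (_÷_ to _÷₀_)
  open LogBounds
  open import Relation.Nullary.Decidable using (toWitness)
  open ≤-Reasoning

  module Arithmetic where

    open +-*-Solver

    cancelled : ∀ a b c d → a * b * (c * d) ≡ (a * d) * (b * c)
    cancelled = solve 4 (λ a b c d → a :* b :* (c :* d) := (a :* d) :* (b :* c)) refl

    difference : ∀ a b → (a + b) - b ≡ a
    difference = solve 2 (λ a b → (a :+ b) :- b := a) refl

    exchange : ∀ a b c → a * (b * c) ≡ b * (a * c)
    exchange = solve 3 (λ a b c → a :* (b :* c) := b :* (a :* c)) refl

    collect : ∀ h k u v → h + k + (u + v) ≡ h + (u + k) + v
    collect = solve 4 (λ h k u v → h :+ k :+ (u :+ v) := h :+ (u :+ k) :+ v) refl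

    turn : ∀ h t w → h * (t * w) ≡ w * h * t
    turn = solve 3 (λ h t w → h :* (t :* w) := w :* h :* t) refl

    regroup : ∀ u s q → u + (s + q) ≡ (u + s) + q
    regroup = solve 3 (λ u s q → u :+ (s :+ q) := (u :+ s) :+ q) refl

    climb : ∀ H k y h w → (H + k + y * w) + w * h ≡ H + k + (y + h) * w
    climb = solve 5 (λ H k y h w → (H :+ k :+ y :* w) :+ w :* h := H :+ k :+ (y :+ h) :* w) refl

  open Arithmetic

  ½^_ : ℕ → ℚ
  ½^ zero  = 1ℚ
  ½^ suc k = inv 1 * ½^ k

  0≤½^ : ∀ k → 0ℚ ≤ ½^ k
  0≤½^ zero    = 0≤ι 1
  0≤½^ (suc k) = 0≤* (0≤inv 1) (0≤½^ k)

  2^*½^ : ∀ k → ι (2 ℕ.^ k) * ½^ k ≡ 1ℚ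
  2^*½^ zero    = refl
  2^*½^ (suc k) = begin-equality
    ι (2 ℕ.* 2 ℕ.^ k) * (inv 1 * ½^ k)        ≡⟨ cong (_* (inv 1 * ½^ k)) (ι-* 2 (2 ℕ.^ k)) ⟩
    ι 2 * ι (2 ℕ.^ k) * (inv 1 * ½^ k)        ≡⟨ cancelled (ι 2) (ι (2 ℕ.^ k)) (inv 1) (½^ k) ⟩
    (ι 2 * ½^ k) * (ι (2 ℕ.^ k) * inv 1)      ≡⟨ cancelled (ι 2) (½^ k) (ι (2 ℕ.^ k)) (inv 1) ⟩
    (ι 2 * inv 1) * (½^ k * ι (2 ℕ.^ k))      ≡⟨ cong (_* (½^ k * ι (2 ℕ.^ k))) (ι*inv 1) ⟩
    1ℚ * (½^ k * ι (2 ℕ.^ k))                 ≡⟨ *-identityˡ _ ⟩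
    ½^ k * ι (2 ℕ.^ k)                        ≡⟨ *-comm (½^ k) (ι (2 ℕ.^ k)) ⟩
    ι (2 ℕ.^ k) * ½^ k                        ≡⟨ 2^*½^ k ⟩
    1ℚ                                        ∎

  inv-antitone : ∀ k o → inv (o ℕ.+ k) ≤ inv k
  inv-antitone k zero    = ≤-refl
  inv-antitone k (suc o) = ≤-trans (inv-decreasing (o ℕ.+ k)) (inv-antitone k o)

  ½^-decreasing : ∀ k → ½^ suc k ≤ ½^ k
  ½^-decreasing k = begin
    inv 1 * ½^ k     ≤⟨ *-monoʳ (0≤½^ k) (inv-decreasing 0) ⟩
    1ℚ * ½^ k        ≡⟨ *-identityˡ _ ⟩
    ½^ k             ∎

  ½^-halves : ∀ k → ½^ suc k + ½^ suc k ≡ ½^ k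
  ½^-halves k = begin-equality
    inv 1 * ½^ k + inv 1 * ½^ k     ≡⟨ sym (*-distribʳ-+ (½^ k) (inv 1) (inv 1)) ⟩
    1ℚ * ½^ k                       ≡⟨ *-identityˡ _ ⟩
    ½^ k                            ∎

  step-bound : ∀ c m N x → x ≤ ι N → suc c ℕ.* N ℕ.≤ suc m → step m x ≤ inv c
  step-bound c m N x x≤N big = begin
    (x - 1ℚ) * inv m                         ≤⟨ *-monoʳ (0≤inv m) (≤-trans (+-monoʳ-≤ x {(- 1ℚ)} {0ℚ} (toWitness {a? = (- 1ℚ) ≤? 0ℚ} tt)) (≤-trans (≤-reflexive (+-identityʳ x)) x≤N)) ⟩
    ι N * inv m                              ≡⟨ cong (_* inv m) (sym (*-identityʳ (ι N))) ⟩
    ι N * 1ℚ * inv m                         ≡⟨ cong (λ z → ι N * z * inv m) (sym (ι*inv c)) ⟩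
    ι N * (ι (suc c) * inv c) * inv m        ≡⟨ cong (_* inv m) (exchange (ι N) (ι (suc c)) (inv c)) ⟩
    ι (suc c) * (ι N * inv c) * inv m        ≡⟨ cong (_* inv m) (sym (*-assoc (ι (suc c)) (ι N) (inv c))) ⟩
    ι (suc c) * ι N * inv c * inv m          ≡⟨ *-assoc (ι (suc c) * ι N) (inv c) (inv m) ⟩
    ι (suc c) * ι N * (inv c * inv m)        ≡⟨ cong (_* (inv c * inv m)) (sym (ι-* (suc c) N)) ⟩
    ι (suc c ℕ.* N) * (inv c * inv m)        ≤⟨ *-monoʳ (0≤* (0≤inv c) (0≤inv m)) (ι-mono big) ⟩
    ι (suc m) * (inv c * inv m)              ≡⟨ exchange (ι (suc m)) (inv c) (inv m) ⟩
    inv c * (ι (suc m) * inv m)              ≡⟨ cong (inv c *_) (ι*inv m) ⟩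
    inv c * 1ℚ                               ≡⟨ *-identityʳ (inv c) ⟩
    inv c                                    ∎

  module _ (m : ℕ) (x : ℚ) (1≤x : 1ℚ ≤ x) where

    open Riemann m x 1≤x

    -- Breakpoints 2 ^ k with slopes 1 / 2 ^ (k + 1) credit each doubling with 1 / 2.
    log-≥-half : step m x ≤ 1ℚ → ∀ K → ι (2 ℕ.^ K) ≤ x → ι K * inv 1 ≤ riemann m x
    log-≥-half h≤1 = Lower.lower (λ k → ι (2 ℕ.^ k)) (λ k → ½^ suc k) (λ k → ι k * inv 1) refl (*-zeroˡ (inv 1))
      base-suc (λ k → 0≤½^ (suc k)) (λ k → ½^-decreasing (suc k))
      (λ k → ≤-reflexive (trans (*-comm (½^ suc k) (ι (2 ℕ.^ suc k))) (2^*½^ (suc k)))) spacing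
      where
      double : ∀ k → ι (2 ℕ.^ suc k) ≡ ι (2 ℕ.^ k) + ι (2 ℕ.^ k)
      double k = trans (cong (λ z → ι (2 ℕ.^ k ℕ.+ z)) (ℕ.+-identityʳ (2 ℕ.^ k))) (ι-+ (2 ℕ.^ k) (2 ℕ.^ k))
      spacing : ∀ k → ι (2 ℕ.^ k) + step m x ≤ ι (2 ℕ.^ suc k)
      spacing k = ≤-trans (+-monoʳ-≤ (ι (2 ℕ.^ k)) (≤-trans h≤1 (ι-mono (ℕ.m^n>0 2 k)))) (≤-reflexive (sym (double k)))
      base-suc : ∀ k → ι (suc k) * inv 1 ≡ ι k * inv 1 + (ι (2 ℕ.^ suc k) - ι (2 ℕ.^ k)) * ½^ suc k
      base-suc k = begin-equality
        ι (suc k) * inv 1                                                  ≡⟨ cong (_* inv 1) (trans (ι-+ 1 k) (+-comm 1ℚ (ι k))) ⟩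
        (ι k + 1ℚ) * inv 1                                                 ≡⟨ *-distribʳ-+ (inv 1) (ι k) 1ℚ ⟩
        ι k * inv 1 + 1ℚ * inv 1                                           ≡⟨ cong (λ z → ι k * inv 1 + z) (*-comm 1ℚ (inv 1)) ⟩
        ι k * inv 1 + inv 1 * 1ℚ                                           ≡⟨ cong (λ z → ι k * inv 1 + inv 1 * z) (sym (2^*½^ k)) ⟩
        ι k * inv 1 + inv 1 * (ι (2 ℕ.^ k) * ½^ k)                         ≡⟨ cong (ι k * inv 1 +_) (exchange (inv 1) (ι (2 ℕ.^ k)) (½^ k)) ⟩
        ι k * inv 1 + ι (2 ℕ.^ k) * ½^ suc k                               ≡⟨ cong (λ z → ι k * inv 1 + z * ½^ suc k) (sym (trans (cong (_- ι (2 ℕ.^ k)) (double k)) (difference (ι (2 ℕ.^ k)) (ι (2 ℕ.^ k))))) ⟩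
        ι k * inv 1 + (ι (2 ℕ.^ suc k) - ι (2 ℕ.^ k)) * ½^ suc k           ∎

    -- Breakpoints 1 + k / c, where c = suc c′.
    log-≥-harmonic : ∀ c′ → step m x ≤ inv c′ → ∀ K → ι (suc (c′ ℕ.+ K)) * inv c′ ≤ x → total (λ i → inv (suc (c′ ℕ.+ i))) K ≤ riemann m x
    log-≥-harmonic c′ h≤ = Lower.lower (λ k → ι (suc (c′ ℕ.+ k)) * inv c′) (λ k → ι (suc c′) * inv (suc (c′ ℕ.+ k))) (total (λ i → inv (suc (c′ ℕ.+ i))))
      (trans (cong (λ z → ι (suc z) * inv c′) (ℕ.+-identityʳ c′)) (ι*inv c′)) refl base-suc (λ k → 0≤* (0≤ι (suc c′)) (0≤inv (suc (c′ ℕ.+ k))))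
      (λ k → *-monoˡ (0≤ι (suc c′)) (≤-trans (≤-reflexive (cong (λ z → inv (suc z)) (ℕ.+-suc c′ k))) (inv-decreasing (suc (c′ ℕ.+ k)))))
      slope (λ k → ≤-trans (+-monoʳ-≤ (ι (suc (c′ ℕ.+ k)) * inv c′) h≤) (≤-reflexive (sym (next k))))
      where
      next : ∀ k → ι (suc (c′ ℕ.+ suc k)) * inv c′ ≡ ι (suc (c′ ℕ.+ k)) * inv c′ + inv c′
      next k = begin-equality
        ι (suc (c′ ℕ.+ suc k)) * inv c′                ≡⟨ cong (λ z → ι (suc z) * inv c′) (ℕ.+-suc c′ k) ⟩
        ι (suc (suc (c′ ℕ.+ k))) * inv c′              ≡⟨ cong (_* inv c′) (trans (ι-+ 1 (suc (c′ ℕ.+ k))) (+-comm 1ℚ (ι (suc (c′ ℕ.+ k))))) ⟩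
        (ι (suc (c′ ℕ.+ k)) + 1ℚ) * inv c′             ≡⟨ *-distribʳ-+ (inv c′) (ι (suc (c′ ℕ.+ k))) 1ℚ ⟩
        ι (suc (c′ ℕ.+ k)) * inv c′ + 1ℚ * inv c′      ≡⟨ cong (λ z → ι (suc (c′ ℕ.+ k)) * inv c′ + z) (*-identityˡ (inv c′)) ⟩
        ι (suc (c′ ℕ.+ k)) * inv c′ + inv c′           ∎
      base-suc : ∀ k → total (λ i → inv (suc (c′ ℕ.+ i))) k + inv (suc (c′ ℕ.+ k)) ≡
        total (λ i → inv (suc (c′ ℕ.+ i))) k + (ι (suc (c′ ℕ.+ suc k)) * inv c′ - ι (suc (c′ ℕ.+ k)) * inv c′) * (ι (suc c′) * inv (suc (c′ ℕ.+ k)))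
      base-suc k = cong (total (λ i → inv (suc (c′ ℕ.+ i))) k +_) (sym (begin-equality
        (ι (suc (c′ ℕ.+ suc k)) * inv c′ - a) * (ι (suc c′) * r)   ≡⟨ cong (λ z → (z - a) * (ι (suc c′) * r)) (trans (next k) (+-comm a (inv c′))) ⟩
        ((inv c′ + a) - a) * (ι (suc c′) * r)                      ≡⟨ cong (_* (ι (suc c′) * r)) (difference (inv c′) a) ⟩
        inv c′ * (ι (suc c′) * r)                                  ≡⟨ exchange (inv c′) (ι (suc c′)) r ⟩
        ι (suc c′) * (inv c′ * r)                                  ≡⟨ sym (*-assoc (ι (suc c′)) (inv c′) r) ⟩
        ι (suc c′) * inv c′ * r                                    ≡⟨ cong (_* r) (ι*inv c′) ⟩
        1ℚ * r                                                     ≡⟨ *-identityˡ r ⟩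
        r                                                          ∎))
        where
        a r : ℚ
        a = ι (suc (c′ ℕ.+ k)) * inv c′
        r = inv (suc (c′ ℕ.+ k))
      slope : ∀ k → ι (suc c′) * inv (suc (c′ ℕ.+ k)) * (ι (suc (c′ ℕ.+ suc k)) * inv c′) ≤ 1ℚ
      slope k = ≤-reflexive (begin-equality
        ι (suc c′) * inv (suc (c′ ℕ.+ k)) * (ι (suc (c′ ℕ.+ suc k)) * inv c′)    ≡⟨ cancelled (ι (suc c′)) (inv (suc (c′ ℕ.+ k))) (ι (suc (c′ ℕ.+ suc k))) (inv c′) ⟩
        (ι (suc c′) * inv c′) * (inv (suc (c′ ℕ.+ k)) * ι (suc (c′ ℕ.+ suc k)))  ≡⟨ cong₂ _*_ (ι*inv c′) (trans (*-comm (inv (suc (c′ ℕ.+ k))) (ι (suc (c′ ℕ.+ suc k)))) (trans (cong (λ z → ι (suc z) * inv (suc (c′ ℕ.+ k))) (ℕ.+-suc c′ k)) (ι*inv (suc (c′ ℕ.+ k))))) ⟩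
        1ℚ * 1ℚ                                                                  ≡⟨ *-identityʳ 1ℚ ⟩
        1ℚ                                                                       ∎)

    -- Up to 2 ^ (k + 1) the line of index k + 1 is not below the line of index k.
    coarser : ∀ i k → t i ≤ ι (2 ℕ.^ suc k) → 1ℚ + S (suc i) ≤ h + ι k + t i * ½^ k → 1ℚ + S (suc i) ≤ h + ι (suc k) + t i * ½^ suc k
    coarser i k ti≤ le = begin
      1ℚ + S (suc i)                                     ≤⟨ le ⟩
      h + ι k + t i * ½^ k                               ≡⟨ cong (λ z → h + ι k + t i * z) (sym (½^-halves k)) ⟩
      h + ι k + t i * (½^ suc k + ½^ suc k)              ≡⟨ cong (h + ι k +_) (*-distribˡ-+ (t i) (½^ suc k) (½^ suc k)) ⟩
      h + ι k + (t i * ½^ suc k + t i * ½^ suc k)        ≤⟨ +-monoʳ-≤ (h + ι k) (+-monoˡ-≤ (t i * ½^ suc k) (≤-trans (*-monoʳ (0≤½^ (suc k)) ti≤) (≤-reflexive (2^*½^ (suc k))))) ⟩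
      h + ι k + (1ℚ + t i * ½^ suc k)                    ≡⟨ collect h (ι k) 1ℚ (t i * ½^ suc k) ⟩
      h + (1ℚ + ι k) + t i * ½^ suc k                    ≡⟨ cong (λ z → h + z + t i * ½^ suc k) (sym (ι-+ 1 k)) ⟩
      h + ι (suc k) + t i * ½^ suc k                     ∎

    -- To the right of 2 ^ k, the integrand 1 / t is at most the slope 1 / 2 ^ k, so the line
    -- outgrows the sum.
    further : ∀ i k → ι (2 ℕ.^ k) ≤ t (suc i) → 1ℚ + S (suc i) ≤ h + ι k + t i * ½^ k → 1ℚ + S (suc (suc i)) ≤ h + ι k + t (suc i) * ½^ k
    further i k ≤t le = begin
      1ℚ + (S (suc i) + (h ÷₀ t (suc i)))         ≡⟨ regroup 1ℚ (S (suc i)) (h ÷₀ t (suc i)) ⟩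
      (1ℚ + S (suc i)) + (h ÷₀ t (suc i))         ≤⟨ +-mono-≤ le (÷-upper {½^ k * h} {h} {t (suc i)} (0<t (suc i)) term) ⟩
      (h + ι k + t i * ½^ k) + ½^ k * h           ≡⟨ climb h (ι k) (t i) h (½^ k) ⟩
      h + ι k + (t i + h) * ½^ k                  ≡⟨ cong (λ z → h + ι k + z * ½^ k) (sym (t-suc i)) ⟩
      h + ι k + t (suc i) * ½^ k                  ∎
      where
      term : h ≤ ½^ k * h * t (suc i)
      term = begin
        h                               ≡⟨ sym (*-identityʳ h) ⟩
        h * 1ℚ                          ≡⟨ cong (h *_) (sym (2^*½^ k)) ⟩
        h * (ι (2 ℕ.^ k) * ½^ k)        ≤⟨ *-monoˡ 0≤h (*-monoʳ (0≤½^ k) ≤t) ⟩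
        h * (t (suc i) * ½^ k)          ≡⟨ turn h (t (suc i)) (½^ k) ⟩
        ½^ k * h * t (suc i)            ∎

    -- The lines k - 1 + y / 2ᵏ are upper bounds for the right Riemann sums,
    -- which differ from the left ones by at most the first term h.
    right-sum : ∀ i k → 1ℚ + S (suc i) ≤ h + ι k + t i * ½^ k
    right-sum zero zero = begin
      1ℚ + (0ℚ + (h ÷₀ t 0))       ≡⟨ cong (1ℚ +_) (+-identityˡ (h ÷₀ t 0)) ⟩
      1ℚ + (h ÷₀ t 0)              ≤⟨ +-monoʳ-≤ 1ℚ (÷-upper {h} {h} {t 0} (0<t 0) (≤-reflexive (sym (trans (cong (h *_) t-0) (*-identityʳ h))))) ⟩
      1ℚ + h                       ≡⟨ +-comm 1ℚ h ⟩
      h + 1ℚ                       ≡⟨ cong₂ _+_ (sym (+-identityʳ h)) (sym (trans (*-identityʳ (t 0)) t-0)) ⟩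
      h + 0ℚ + t 0 * 1ℚ            ∎
    right-sum zero (suc k) = coarser zero k (≤-trans (≤-reflexive t-0) (ι-mono (ℕ.m^n>0 2 (suc k)))) (right-sum zero k)
    right-sum (suc i) zero = further i zero (1≤t (suc i)) (right-sum i zero)
    right-sum (suc i) (suc k) = by-size (≤-total (t (suc i)) (ι (2 ℕ.^ suc k)))
      where
      by-size : t (suc i) ≤ ι (2 ℕ.^ suc k) ⊎ ι (2 ℕ.^ suc k) ≤ t (suc i) → 1ℚ + S (suc (suc i)) ≤ h + ι (suc k) + t (suc i) * ½^ suc k
      by-size (inj₁ small) = coarser (suc i) k small (right-sum (suc i) k)
      by-size (inj₂ large) = further i (suc k) large (right-sum i (suc k))

    -- At the last grid point, which is at most 2 ^ k, the line has value at most k; the first term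
    -- of the left sum adds h ≤ 1.
    log-≤ : step m x ≤ 1ℚ → ∀ k → x ≤ ι (2 ℕ.^ k) → riemann m x ≤ ι (suc k)
    log-≤ h≤1 k x≤ = subtract (begin
      1ℚ + riemann m x            ≡⟨ cong (1ℚ +_) riemann≡ ⟩
      1ℚ + S (suc m)              ≤⟨ right-sum m k ⟩
      h + ι k + t m * ½^ k        ≤⟨ +-mono-≤ (+-monoˡ-≤ (ι k) h≤1) (≤-trans (*-monoʳ (0≤½^ k) (≤-trans (t≤t m) (≤-trans (≤-reflexive t-last) x≤))) (≤-reflexive (2^*½^ k))) ⟩
      1ℚ + ι k + 1ℚ               ≡⟨ cong (_+ 1ℚ) (sym (ι-+ 1 k)) ⟩
      ι (suc k) + 1ℚ              ≡⟨ +-comm (ι (suc k)) 1ℚ ⟩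
      1ℚ + ι (suc k)              ∎)
      where
      subtract : ∀ {a b} → 1ℚ + a ≤ 1ℚ + b → a ≤ b
      subtract {a} {b} le = begin
        a                  ≡⟨ sym (difference′ 1ℚ a) ⟩
        1ℚ + a - 1ℚ        ≤⟨ +-monoˡ-≤ (- 1ℚ) le ⟩
        1ℚ + b - 1ℚ        ≡⟨ difference′ 1ℚ b ⟩
        b                  ∎
        where
        difference′ : ∀ c a → c + a - c ≡ a
        difference′ c a = trans (cong (_- c) (+-comm c a)) (difference a c)

  module Ratio (n L ℓ m : ℕ) (3≤n : 3 ℕ.≤ n) (1≤L : 1 ℕ.≤ L) (2^L≤n : 2 ℕ.^ L ℕ.≤ n) (n<2^ : n ℕ.< 2 ℕ.^ suc L)
               (L<2^ℓ : L ℕ.< 2 ℕ.^ ℓ) (2^ℓ≤2L : 2 ℕ.^ ℓ ℕ.≤ 2 ℕ.* L) (fine : 51 ℕ.* (2 ℕ.+ n) ℕ.≤ suc m) where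

    x y : ℚ
    x = ι n
    y = riemann m x

    1≤x : 1ℚ ≤ x
    1≤x = ι-mono (ℕ.≤-trans (ℕ.s≤s ℕ.z≤n) 3≤n)

    x-step : step m x ≤ inv 50
    x-step = step-bound 50 m (2 ℕ.+ n) x (ι-mono (ℕ.m≤n+m n 2)) fine

    y≤ : y ≤ ι (suc (suc L))
    y≤ = log-≤ m x 1≤x (≤-trans x-step (inv-antitone 0 50)) (suc L) (ι-mono (ℕ.<⇒≤ n<2^))

    -- `inv 50` is 1 / 51. The breakpoints 1 + k / 4 up to 3 give 1 / 5 + ... + 1 / 12 as a lower
    -- bound for log 3, and this just exceeds 52 / 51. The margin above 1 keeps log log n away from
    -- 0 even for n = 3.
    52/51≤y : ι 52 * inv 50 ≤ y
    52/51≤y = ≤-trans (toWitness {a? = ι 52 * inv 50 ≤? total (λ i → inv (suc (3 ℕ.+ i))) 8} tt)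
      (log-≥-harmonic m x 1≤x 3 (≤-trans x-step (inv-antitone 3 47)) 8 (≤-trans (toWitness {a? = ι 12 * inv 3 ≤? ι 3} tt) (ι-mono 3≤n)))

    1≤y : 1ℚ ≤ y
    1≤y = ≤-trans (toWitness {a? = 1ℚ ≤? ι 52 * inv 50} tt) 52/51≤y

    0<y : 0ℚ < y
    0<y = <-≤-trans (positive⁻¹ 1ℚ) 1≤y

    L<n : L ℕ.< n
    L<n = ℕ.<-≤-trans (k<2^k L) 2^L≤n
      where
      k<2^k : ∀ k → k ℕ.< 2 ℕ.^ k
      k<2^k zero    = ℕ.s≤s ℕ.z≤n
      k<2^k (suc k) = ℕ.+-mono-≤ (ℕ.m^n>0 2 k) (ℕ.≤-trans (k<2^k k) (ℕ.m≤m+n (2 ℕ.^ k) 0))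

    -- The outer logarithm is taken at y ≤ L + 2 < n + 2, so the bound 51 * (2 + n) on the number of
    -- pieces makes the steps of both sums at most 1 / 51.
    y-step : step m y ≤ inv 50
    y-step = step-bound 50 m (2 ℕ.+ n) y (≤-trans y≤ (ι-mono (ℕ.+-monoʳ-≤ 2 (ℕ.<⇒≤ L<n)))) fine

    -- 156 = 3 * 52: for ℓ ≤ 3 the single term log (52 / 51) ≥ 1 / 52 suffices. For larger ℓ, log n
    -- ≥ L / 2 ≥ 2 ^ (ℓ - 2), and with 1 / 2 per doubling log log n is at least (ℓ - 2) / 2 ≥ ℓ / 6.
    loglog-≥ : ι ℓ * inv 155 ≤ riemann m y
    loglog-≥ = by-size (ℕ.≤-total ℓ 3)
      where
      by-size : ℓ ℕ.≤ 3 ⊎ 3 ℕ.≤ ℓ → ι ℓ * inv 155 ≤ riemann m y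
      by-size (inj₁ ℓ≤3) = begin
        ι ℓ * inv 155                          ≤⟨ *-monoʳ (0≤inv 155) (ι-mono ℓ≤3) ⟩
        ι 3 * inv 155                          ≤⟨ toWitness {a? = ι 3 * inv 155 ≤? total (λ i → inv (suc (50 ℕ.+ i))) 1} tt ⟩
        total (λ i → inv (suc (50 ℕ.+ i))) 1   ≤⟨ log-≥-harmonic m y 1≤y 50 y-step 1 52/51≤y ⟩
        riemann m y                            ∎
      by-size (inj₂ 3≤ℓ) = from-offset (ℕ.m≤n⇒∃[o]m+o≡n 3≤ℓ)
        where
        from-offset : ∃[ o ] 3 ℕ.+ o ≡ ℓ → ι ℓ * inv 155 ≤ riemann m y
        from-offset (o , eq) = begin
          ι ℓ * inv 155                        ≤⟨ *-monoˡ (0≤ι ℓ) (inv-antitone 5 150) ⟩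
          ι ℓ * inv 5                          ≤⟨ *-monoʳ (0≤inv 5) (ι-mono ℓ≤) ⟩
          ι (3 ℕ.* suc o) * inv 5              ≡⟨ cong (_* inv 5) (trans (ι-* 3 (suc o)) (*-comm (ι 3) (ι (suc o)))) ⟩
          ι (suc o) * ι 3 * inv 5              ≡⟨ *-assoc (ι (suc o)) (ι 3) (inv 5) ⟩
          ι (suc o) * inv 1                    ≤⟨ log-≥-half m y 1≤y (≤-trans y-step (inv-antitone 0 50)) (suc o) dyadic ⟩
          riemann m y                          ∎
          where
          ℓ≤ : ℓ ℕ.≤ 3 ℕ.* suc o
          ℓ≤ = ℕ.≤-trans (ℕ.≤-reflexive (sym eq)) (ℕ.≤-trans (ℕ.+-monoʳ-≤ 3 (ℕ.m≤n*m o 3)) (ℕ.≤-reflexive (sym (ℕ.*-suc 3 o))))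
          quadruple : 2 ℕ.* 2 ℕ.^ suc o ℕ.≤ L
          quadruple = ℕ.*-cancelˡ-≤ 2 (ℕ.≤-trans (ℕ.≤-reflexive (cong (2 ℕ.^_) eq)) 2^ℓ≤2L)
          dyadic : ι (2 ℕ.^ suc o) ≤ y
          dyadic = begin
            ι (2 ℕ.^ suc o)                        ≡⟨ sym (*-identityʳ _) ⟩
            ι (2 ℕ.^ suc o) * (ι 2 * inv 1)        ≡⟨ sym (*-assoc (ι (2 ℕ.^ suc o)) (ι 2) (inv 1)) ⟩
            ι (2 ℕ.^ suc o) * ι 2 * inv 1          ≡⟨ cong (_* inv 1) (trans (*-comm (ι (2 ℕ.^ suc o)) (ι 2)) (sym (ι-* 2 (2 ℕ.^ suc o)))) ⟩
            ι (2 ℕ.* 2 ℕ.^ suc o) * inv 1          ≤⟨ *-monoʳ (0≤inv 1) (ι-mono quadruple) ⟩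
            ι L * inv 1                            ≤⟨ log-≥-half m x 1≤x (≤-trans x-step (inv-antitone 0 50)) L (ι-mono 2^L≤n) ⟩
            y                                      ∎

    ratio : ι ℓ * inv 155 * inv (suc L) ≤ riemann m y ÷₀ y
    ratio = ÷-lower {ι ℓ * inv 155 * inv (suc L)} {riemann m y} {y} 0<y (begin
      ι ℓ * inv 155 * inv (suc L) * y                            ≤⟨ *-monoˡ (0≤* (0≤* (0≤ι ℓ) (0≤inv 155)) (0≤inv (suc L))) y≤ ⟩
      ι ℓ * inv 155 * inv (suc L) * ι (suc (suc L))              ≡⟨ *-assoc (ι ℓ * inv 155) (inv (suc L)) (ι (suc (suc L))) ⟩
      ι ℓ * inv 155 * (inv (suc L) * ι (suc (suc L)))            ≡⟨ cong (ι ℓ * inv 155 *_) (trans (*-comm (inv (suc L)) (ι (suc (suc L)))) (ι*inv (suc L))) ⟩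
      ι ℓ * inv 155 * 1ℚ                                         ≡⟨ *-identityʳ (ι ℓ * inv 155) ⟩
      ι ℓ * inv 155                                              ≤⟨ loglog-≥ ⟩
      riemann m y                                                ∎)

-- From memories back to graphs: output, optimum and integer guarantee.

module Solving where

  open import Data.Fin using (Fin; zero; suc; toℕ; fromℕ<; combine; remQuot)
  open import Data.Fin.Properties using (toℕ-injective; toℕ-fromℕ<; toℕ<n; toℕ-combine; remQuot-combine)
  open import Data.Fin.Subset using (Subset; ∣_∣; _∈_)
  open import Data.List using (List; filter; upTo)
  open import Data.List.Membership.Propositional.Properties using (∈-filter⁻)
  open import Data.Nat hiding (_!)
  open import Data.Nat.Properties
  open import Data.List.Extrema ≤-totalOrder using (argmax-sel)
  open import Data.Vec using (Vec; []; _∷_; lookup; tabulate)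
  open import Data.Vec.Properties using ([]=⇒lookup; lookup⇒[]=)
  open import Defs using (BipartiteGraph; IsBiclique; HasBiclique; hasBiclique?; OPT; Memory; bit; input; readSubset; outputU; outputV)
  open Algorithm
  open Compile using (correct)
  open Finding
  open Lang
  open Params using (logarithm; choose)
  open Sums

  -- Subsets become predicates on all numbers, false from n on, to match the arrays.
  member : ∀ {n} → Vec Bool n → ℕ → Bool
  member []      _       = false
  member (b ∷ S) zero    = b
  member (b ∷ S) (suc i) = member S i

  member-lookup : ∀ {n} (S : Vec Bool n) u → member S (toℕ u) ≡ lookup S u
  member-lookup (b ∷ S) zero    = refl
  member-lookup (b ∷ S) (suc u) = member-lookup S u

  member-tabulate : ∀ n (p : ℕ → Bool) i → i < n → member (tabulate {n = n} (λ u → p (toℕ u))) i ≡ p i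
  member-tabulate (suc n) p zero    _   = refl
  member-tabulate (suc n) p (suc i) i<n = member-tabulate n (λ k → p (suc k)) i (s≤s⁻¹ i<n)

  ∣∣≡# : ∀ {n} (S : Subset n) → ∣ S ∣ ≡ # n (member S)
  ∣∣≡# []                = refl
  ∣∣≡# {suc n} (b ∷ S) = trans (head b) (sym (sum-append 1 n (λ i → bit (member (b ∷ S) i))))
    where
    head : ∀ b → ∣ b ∷ S ∣ ≡ bit b + # n (member S)
    head true  = cong suc (∣∣≡# S)
    head false = ∣∣≡# S

  readSubset-member : ∀ n a μ i → i < n → member (readSubset n a μ) i ≡ mem μ a i
  readSubset-member n a μ i i<n = trans (member-tabulate n (λ k → if μ a k ≡ᵇ 0 then false else true) i i<n) (test (μ a i))
    where
    test : ∀ x → (if x ≡ᵇ 0 then false else true) ≡ nonzero x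
    test zero    = refl
    test (suc x) = refl

  module _ {n : ℕ} (G : BipartiteGraph n) where

    input-edge : ∀ k j → j ≡ toℕ k → input G 1 j ≡ bit (uncurry G (remQuot n k))
    input-edge k j eq with j <? n * n
    ... | yes lt = cong (λ i → bit (uncurry G (remQuot n i))) (toℕ-injective (trans (toℕ-fromℕ< lt) eq))
    ... | no  ge = contradiction (subst (_< n * n) (sym eq) (toℕ<n k)) ge

    input-adjacency : ∀ u v → adj n (input G) (toℕ u) (toℕ v) ≡ G u v
    input-adjacency u v = trans (cong nonzero (trans
      (input-edge (combine u v) (sum n (λ _ → toℕ u) + toℕ v) (trans (cong (_+ toℕ v) (sum-const n (toℕ u))) (sym (toℕ-combine u v))))
      (cong (λ p → bit (uncurry G p)) (remQuot-combine u v)))) (nonzero-bit (G u v))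
      where
      nonzero-bit : ∀ b → nonzero (bit b) ≡ b
      nonzero-bit true  = refl
      nonzero-bit false = refl

    -- The maximum is either the default 0, for which the empty sets serve, or an entry of the list,
    -- which has passed the filter.
    OPT-attained : HasBiclique G (OPT G)
    OPT-attained = from (argmax-sel id 0 (filter (hasBiclique? G) (upTo (suc n))))
      where
      from : OPT G ≡ 0 ⊎ _ → HasBiclique G (OPT G)
      from (inj₁ eq) = subst (HasBiclique G) (sym eq) (∅ , ∅ , ∣∅∣ , ∣∅∣ , λ u v u∈ _ → contradiction u∈ ∉)
        where
        open import Data.Fin.Subset using () renaming (⊥ to ∅)
        open import Data.Fin.Subset.Properties using () renaming (∣⊥∣≡0 to size; ∉⊥ to ∉)
        ∣∅∣ = size n
      from (inj₂ in-list) = proj₂ (∈-filter⁻ (hasBiclique? G) {xs = upTo (suc n)} in-list)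

    module Solve (0<n : 0 < n) where

      open Finds n 0<n (input G)

      initially : Sound (input G)
      initially = record
        { size  = refl
        ; graph = λ _ → refl
        ; left  = #-none n
        ; right = #-none n
        ; valid = λ _ _ _ _ ()
        }

      result : Memory
      result = exec algorithm (input G)

      s : ℕ
      s = result best 0

      afterwards : Improves (exec singleEdges (input G)) result
      afterwards = safe-improves search-safe (exec singleEdges (input G)) middle
        where
        middle : Sound (exec singleEdges (input G))
        middle = sound (safe-improves singleEdges-safe (input G) initially)

      module _ (ν : Memory) (A : Agree base result ν) where

        output-# : ∀ a → a < base → # n (mem result a) ≡ s → ∣ readSubset n a ν ∣ ≡ s
        output-# a a<b eq = trans (∣∣≡# (readSubset n a ν)) (trans (#-cong n λ i i<n →
          trans (readSubset-member n a ν i i<n) (cong nonzero (sym (A a a<b i)))) eq)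

        output-∈ : ∀ a → a < base → ∀ u → u ∈ readSubset n a ν → mem result a (toℕ u) ≡ true
        output-∈ a a<b u u∈ = trans (cong nonzero (A a a<b (toℕ u))) (trans (sym (readSubset-member n a ν (toℕ u) (toℕ<n u)))
          (trans (member-lookup (readSubset n a ν) u) ([]=⇒lookup u∈)))

        output-biclique : IsBiclique G s (outputU n ν) (outputV n ν)
        output-biclique = output-# 2 (s≤s (s≤s (s≤s z≤n))) (left final) , output-# 3 (s≤s (s≤s (s≤s (s≤s z≤n)))) (right final) , λ u v u∈ v∈ →
          trans (sym (input-adjacency u v)) (valid final (toℕ u) (toℕ v) (toℕ<n u) (toℕ<n v)
            (output-∈ 2 (s≤s (s≤s (s≤s z≤n))) u u∈) (output-∈ 3 (s≤s (s≤s (s≤s (s≤s z≤n)))) v v∈))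
          where
          final : Sound result
          final = sound afterwards

      module Quality (C₀ : ℕ) (1≤C₀ : 1 ≤ C₀) (C₀-large : 128 * (128 * 128) * 384 * 2 ≤ C₀) (C₀-larger : ∀ N → N ≡ 2 ^ 20 → N * (N * N) ≤ C₀)
                     (L ℓ : ℕ) (2^L≤n : 2 ^ L ≤ n) (L<2^ℓ : L < 2 ^ ℓ) (2^ℓ≤2L : 2 ^ ℓ ≤ 2 * L) where

        quality : OPT G * (L * (L * L)) ≤ C₀ * (n * (ℓ * (ℓ * ℓ)) * s)
        quality = by-size (OPT G) refl OPT-attained
          where
          by-size : ∀ m → OPT G ≡ m → HasBiclique G m → m * (L * (L * L)) ≤ C₀ * (n * (ℓ * (ℓ * ℓ)) * s)
          by-size zero    _ _                                     = z≤n
          by-size (suc k) _ (X , Y , ∣X∣≡m , ∣Y∣≡m , complete) = found (choose C₀ 1≤C₀ C₀-large C₀-larger n m L ℓ (s≤s z≤n) m≤n 2^L≤n L<2^ℓ 2^ℓ≤2L)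
            where
            m : ℕ
            m = suc k
            #X : # n (member X) ≡ m
            #X = trans (sym (∣∣≡# X)) ∣X∣≡m
            #Y : # n (member Y) ≡ m
            #Y = trans (sym (∣∣≡# Y)) ∣Y∣≡m
            m≤n : m ≤ n
            m≤n = subst (_≤ n) #X (#≤n n (member X))
            ∈X : ∀ (S : Subset n) u → member S (toℕ u) ≡ true → u ∈ S
            ∈X S u h = lookup⇒[]= u S (trans (sym (member-lookup S u)) h)
            biclique′ : ∀ u v → member X (toℕ u) ≡ true → member Y (toℕ v) ≡ true → adj n (input G) (toℕ u) (toℕ v) ≡ true
            biclique′ u v hu hv = trans (input-adjacency u v) (complete u v (∈X X u hu) (∈X Y v hv))
            biclique : ∀ u v → u < n → v < n → member X u ≡ true → member Y v ≡ true → adj n (input G) u v ≡ true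
            biclique u v u<n v<n hu hv = subst₂ (λ a b → adj n (input G) a b ≡ true) (toℕ-fromℕ< u<n) (toℕ-fromℕ< v<n)
              (biclique′ (fromℕ< u<n) (fromℕ< v<n) (subst (λ a → member X a ≡ true) (sym (toℕ-fromℕ< u<n)) hu)
                                                    (subst (λ a → member Y a ≡ true) (sym (toℕ-fromℕ< v<n)) hv))
            enlarge : ∀ {x y} → x ≤ y → C₀ * (n * (ℓ * (ℓ * ℓ)) * x) ≤ C₀ * (n * (ℓ * (ℓ * ℓ)) * y)
            enlarge le = *-monoʳ-≤ C₀ (*-monoʳ-≤ (n * (ℓ * (ℓ * ℓ))) le)
            found : _ → m * (L * (L * L)) ≤ C₀ * (n * (ℓ * (ℓ * ℓ)) * s)
            found (inj₁ few) = ≤-trans few (enlarge (≤-trans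
              (singleEdges-finds (member X) (member Y) biclique m #X #Y (s≤s z≤n) (input G) initially) (grows afterwards)))
            found (inj₂ (d , E , p , many)) = ≤-trans many (enlarge
              (search-finds (member X) (member Y) biclique m #X #Y (s≤s z≤n) p (exec singleEdges (input G))
                (sound (safe-improves singleEdges-safe (input G) initially))))

  -- L is the binary logarithm of n rounded down, and ℓ is one more than that of L, so that L < 2 ^
  -- ℓ.
  logarithms : ∀ n → 3 ≤ n → ∃[ L ] ∃[ ℓ ] (1 ≤ L × 2 ^ L ≤ n × n < 2 ^ suc L × L < 2 ^ ℓ × 2 ^ ℓ ≤ 2 * L)
  logarithms n 3≤n = outer (logarithm n (≤-trans (s≤s z≤n) 3≤n))
    where
    outer : ∃[ L ] (2 ^ L ≤ n × n < 2 ^ suc L) → ∃[ L ] ∃[ ℓ ] (1 ≤ L × 2 ^ L ≤ n × n < 2 ^ suc L × L < 2 ^ ℓ × 2 ^ ℓ ≤ 2 * L)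
    outer (zero  , lo , hi) = contradiction (<-≤-trans hi (≤-trans (n≤1+n 2) 3≤n)) (<-irrefl refl)
    outer (suc L , lo , hi) = inner (logarithm (suc L) (s≤s z≤n))
      where
      inner : ∃[ k ] (2 ^ k ≤ suc L × suc L < 2 ^ suc k) → ∃[ L ] ∃[ ℓ ] (1 ≤ L × 2 ^ L ≤ n × n < 2 ^ suc L × L < 2 ^ ℓ × 2 ^ ℓ ≤ 2 * L)
      inner (k , lo′ , hi′) = suc L , suc k , s≤s z≤n , lo , hi , hi′ , *-monoʳ-≤ 2 lo′

  solves : ∀ {n} (G : BipartiteGraph n) (0<n : 0 < n) r → let open Solve G 0<n in
    Runs (compile base algorithm) (input G) r (costᶜ algorithm n) (λ ν → IsBiclique G s (outputU n ν) (outputV n ν))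
  solves G 0<n r = runs-weaken ≤-refl (λ {ν} A → output-biclique ν A)
    (correct {base} (s≤s z≤n) algorithm algorithm-wellFormed (input G) (input G) r λ _ _ _ → refl)
    where open Solve G 0<n

-- Transfer of the integer guarantee to the real approximation ratio.

module Reals where

  import Data.Integer as ℤ
  import Data.Integer.Properties as ℤ
  open import Data.Nat as ℕ using (ℕ; zero; suc)
  import Data.Nat.Properties as ℕ
  open import Data.Rational
  open import Data.Rational.Properties
  open import Data.Rational.Solver using (module +-*-Solver)
  import Data.Rational.Unnormalised as ℚᵘ
  open import Defs using (count; Pr; Real; fromℕ; fromℚ; log; _≲_) renaming (_*_ to _·_; _/_ to _//_; _^_ to _^^_)
  open LogBounds
  open LogLog using (module Ratio)

  count-true : ∀ m → count {m} (λ _ → true) ≡ 2 ℕ.^ m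
  count-true zero    = refl
  count-true (suc m) = cong₂ ℕ._+_ (count-true m) (trans (count-true m) (sym (ℕ.+-identityʳ (2 ℕ.^ m))))

  n/n≡1 : ∀ k d .{{_ : ℕ.NonZero d}} → k ≡ d → ℤ.+ k / d ≡ 1ℚ
  n/n≡1 k (suc d) refl = fromℚᵘ-cong {ℚᵘ.mkℚᵘ (ℤ.+ suc d) d} {ℚᵘ.1ℚᵘ} (ℚᵘ.*≡* (ℤ.*-comm (ℤ.+ suc d) (ℤ.+ 1)))

  Pr-true : ∀ m → Pr {m} (λ _ → true) ≡ 1ℚ
  Pr-true m = n/n≡1 (count {m} (λ _ → true)) (2 ℕ.^ m) {{ℕ.m^n≢0 2 m}} (count-true m)

  cube : ℚ → ℚ
  cube x = x * (x * (x * 1ℚ))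

  module Cubes where

    open +-*-Solver

    cube-* : ∀ a b → cube (a * b) ≡ cube a * cube b
    cube-* = solve 2 (λ a b → (a :* b) :* ((a :* b) :* ((a :* b) :* con 1ℚ)) := (a :* (a :* (a :* con 1ℚ))) :* (b :* (b :* (b :* con 1ℚ)))) refl

    collect : ∀ K N l s i w p → K * (N * l * s) * i * (w * p) ≡ K * w * N * (l * p * i) * s
    collect = solve 7 (λ K N l s i w p → K :* (N :* l :* s) :* i :* (w :* p) := K :* w :* N :* (l :* p :* i) :* s) refl

  open Cubes

  cube-mono : ∀ {a b} → 0ℚ ≤ a → a ≤ b → cube a ≤ cube b
  cube-mono {a} {b} 0≤a a≤b = begin
    a * (a * (a * 1ℚ))   ≤⟨ *-monoʳ (0≤* 0≤a (0≤* 0≤a (0≤ι 1))) a≤b ⟩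
    b * (a * (a * 1ℚ))   ≤⟨ *-monoˡ 0≤b (*-monoʳ (0≤* 0≤a (0≤ι 1)) a≤b) ⟩
    b * (b * (a * 1ℚ))   ≤⟨ *-monoˡ 0≤b (*-monoˡ 0≤b (*-monoʳ (0≤ι 1) a≤b)) ⟩
    b * (b * (b * 1ℚ))   ∎
    where
    open ≤-Reasoning
    0≤b : 0ℚ ≤ b
    0≤b = ≤-trans 0≤a a≤b

  cube-ι : ∀ k → ι (k ℕ.* (k ℕ.* k)) ≡ cube (ι k)
  cube-ι k = trans (ι-* k (k ℕ.* k)) (cong (ι k *_) (trans (ι-* k k) (cong (ι k *_) (sym (*-identityʳ (ι k))))))

  0≤cube : ∀ {x} → 0ℚ ≤ x → 0ℚ ≤ cube x
  0≤cube 0≤x = 0≤* 0≤x (0≤* 0≤x (0≤* 0≤x (0≤ι 1)))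

  -- With i = 1 / k and p = 1 / w, dividing the integer inequality by k ^ 3 and inserting (w p) ^ 3
  -- = 1 produces the cube of l p i, which is bounded by r.
  scale : ∀ m K N l s k (i w p r : ℚ) → m ℕ.* (k ℕ.* (k ℕ.* k)) ℕ.≤ K ℕ.* (N ℕ.* (l ℕ.* (l ℕ.* l)) ℕ.* s) →
          ι k * i ≡ 1ℚ → w * p ≡ 1ℚ → 0ℚ ≤ i → 0ℚ ≤ w → 0ℚ ≤ p → ι l * p * i ≤ r →
          ι m ≤ ι K * cube w * ι N * cube r * ι s
  scale m K N l s k i w p r le ki wp 0≤i 0≤w 0≤p c≤r = begin
    ι m                                                        ≡⟨ sym (*-identityʳ (ι m)) ⟩
    ι m * 1ℚ                                                   ≡⟨ cong (λ z → ι m * cube z) (sym ki) ⟩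
    ι m * cube (ι k * i)                                       ≡⟨ cong (ι m *_) (cube-* (ι k) i) ⟩
    ι m * (cube (ι k) * cube i)                                ≡⟨ sym (*-assoc (ι m) (cube (ι k)) (cube i)) ⟩
    ι m * cube (ι k) * cube i                                  ≡⟨ cong (λ z → ι m * z * cube i) (sym (cube-ι k)) ⟩
    ι m * ι (k ℕ.* (k ℕ.* k)) * cube i                         ≡⟨ cong (_* cube i) (sym (ι-* m (k ℕ.* (k ℕ.* k)))) ⟩
    ι (m ℕ.* (k ℕ.* (k ℕ.* k))) * cube i                       ≤⟨ *-monoʳ (0≤cube 0≤i) (ι-mono le) ⟩
    ι (K ℕ.* (N ℕ.* (l ℕ.* (l ℕ.* l)) ℕ.* s)) * cube i         ≡⟨ cong (_* cube i) expand ⟩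
    ι K * (ι N * cube (ι l) * ι s) * cube i                    ≡⟨ sym (*-identityʳ _) ⟩
    ι K * (ι N * cube (ι l) * ι s) * cube i * 1ℚ               ≡⟨ cong (λ z → ι K * (ι N * cube (ι l) * ι s) * cube i * cube z) (sym wp) ⟩
    ι K * (ι N * cube (ι l) * ι s) * cube i * cube (w * p)     ≡⟨ cong (ι K * (ι N * cube (ι l) * ι s) * cube i *_) (cube-* w p) ⟩
    ι K * (ι N * cube (ι l) * ι s) * cube i * (cube w * cube p) ≡⟨ collect (ι K) (ι N) (cube (ι l)) (ι s) (cube i) (cube w) (cube p) ⟩
    ι K * cube w * ι N * (cube (ι l) * cube p * cube i) * ι s  ≡⟨ cong (λ z → ι K * cube w * ι N * z * ι s) (sym (trans (cube-* (ι l * p) i) (cong (_* cube i) (cube-* (ι l) p)))) ⟩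
    ι K * cube w * ι N * cube (ι l * p * i) * ι s              ≤⟨ *-monoʳ (0≤ι s) (*-monoˡ (0≤* (0≤* (0≤ι K) (0≤cube 0≤w)) (0≤ι N))
                                                                    (cube-mono (0≤* (0≤* (0≤ι l) 0≤p) 0≤i) c≤r)) ⟩
    ι K * cube w * ι N * cube r * ι s                          ∎
    where
    open ≤-Reasoning
    expand : ι (K ℕ.* (N ℕ.* (l ℕ.* (l ℕ.* l)) ℕ.* s)) ≡ ι K * (ι N * cube (ι l) * ι s)
    expand = trans (ι-* K (N ℕ.* (l ℕ.* (l ℕ.* l)) ℕ.* s)) (cong (ι K *_) (trans (ι-* (N ℕ.* (l ℕ.* (l ℕ.* l))) s)
      (cong (_* ι s) (trans (ι-* N (l ℕ.* (l ℕ.* l))) (cong (ι N *_) (cube-ι l))))))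

  ratioBound : ℚ → ℕ → Real
  ratioBound C n = fromℚ C · fromℕ n · (log (log (fromℕ n)) // log (fromℕ n)) ^^ 3

  module Bound (C₀ : ℕ) where

    -- 27 is the cube of 3 in L + 2 ≤ 3 L, where L + 2 bounds log n; 156 ^ 3 is the loss in bounding
    -- log log n below by ℓ / 156.
    C : ℚ
    C = ι (27 ℕ.* C₀) * cube (ι 156)

    0<C : 1 ℕ.≤ C₀ → 0ℚ < C
    0<C 1≤C₀ = positive⁻¹ C {{pos*pos⇒pos (ι (27 ℕ.* C₀)) {{positive 0<27C₀}} (cube (ι 156)) }}
      where
      0<27C₀ : 0ℚ < ι (27 ℕ.* C₀)
      0<27C₀ = <-≤-trans (positive⁻¹ 1ℚ) (ι-mono (ℕ.*-mono-≤ {1} {27} {1} {C₀} (ℕ.s≤s ℕ.z≤n) 1≤C₀))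

    bounded : ∀ n L ℓ o s → 3 ℕ.≤ n → 1 ℕ.≤ L → 2 ℕ.^ L ℕ.≤ n → n ℕ.< 2 ℕ.^ suc L → L ℕ.< 2 ℕ.^ ℓ → 2 ℕ.^ ℓ ℕ.≤ 2 ℕ.* L →
              o ℕ.* (L ℕ.* (L ℕ.* L)) ℕ.≤ C₀ ℕ.* (n ℕ.* (ℓ ℕ.* (ℓ ℕ.* ℓ)) ℕ.* s) →
              fromℕ o ≲ ratioBound C n · fromℕ s
    -- The inequality holds exactly for each sufficiently fine Riemann sum, and ε is merely added.
    bounded n L ℓ o s 3≤n 1≤L 2^L≤n n<2^ L<2^ℓ 2^ℓ≤2L le ε 0<ε = 51 ℕ.* (2 ℕ.+ n) , λ m N≤m →
      ≤-trans (exact m (ℕ.≤-trans N≤m (ℕ.n≤1+n m))) (≤-trans (≤-reflexive (sym (+-identityʳ ((ratioBound C n · fromℕ s) m)))) (+-monoʳ-≤ ((ratioBound C n · fromℕ s) m) (<⇒≤ 0<ε)))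
      where
      le′ : o ℕ.* (suc (suc L) ℕ.* (suc (suc L) ℕ.* suc (suc L))) ℕ.≤ 27 ℕ.* C₀ ℕ.* (n ℕ.* (ℓ ℕ.* (ℓ ℕ.* ℓ)) ℕ.* s)
      le′ = begin
        o ℕ.* (suc (suc L) ℕ.* (suc (suc L) ℕ.* suc (suc L)))   ≤⟨ ℕ.*-monoʳ-≤ o (ℕ.*-mono-≤ 2+L≤ (ℕ.*-mono-≤ 2+L≤ 2+L≤)) ⟩
        o ℕ.* (3 ℕ.* L ℕ.* (3 ℕ.* L ℕ.* (3 ℕ.* L)))             ≡⟨ twentySeven o L ⟩
        27 ℕ.* (o ℕ.* (L ℕ.* (L ℕ.* L)))                        ≤⟨ ℕ.*-monoʳ-≤ 27 le ⟩
        27 ℕ.* (C₀ ℕ.* (n ℕ.* (ℓ ℕ.* (ℓ ℕ.* ℓ)) ℕ.* s))         ≡⟨ sym (ℕ.*-assoc 27 C₀ (n ℕ.* (ℓ ℕ.* (ℓ ℕ.* ℓ)) ℕ.* s)) ⟩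
        27 ℕ.* C₀ ℕ.* (n ℕ.* (ℓ ℕ.* (ℓ ℕ.* ℓ)) ℕ.* s)           ∎
        where
        open ℕ.≤-Reasoning
        open import Data.Nat.Tactic.RingSolver using (solve-∀)
        2+L≤ : suc (suc L) ℕ.≤ 3 ℕ.* L
        2+L≤ = ℕ.≤-trans (ℕ.+-monoˡ-≤ L (ℕ.*-monoʳ-≤ 2 1≤L)) (ℕ.≤-reflexive (ℕ.+-comm (2 ℕ.* L) L))
        twentySeven : ∀ o L → o ℕ.* (3 ℕ.* L ℕ.* (3 ℕ.* L ℕ.* (3 ℕ.* L))) ≡ 27 ℕ.* (o ℕ.* (L ℕ.* (L ℕ.* L)))
        twentySeven = solve-∀
      exact : ∀ m → 51 ℕ.* (2 ℕ.+ n) ℕ.≤ suc m → ι o ≤ (ratioBound C n · fromℕ s) m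
      exact m fine = scale o (27 ℕ.* C₀) n ℓ s (suc (suc L)) (inv (suc L)) (ι 156) (inv 155) _ le′ (ι*inv (suc L)) (ι*inv 155) (0≤inv (suc L)) (0≤ι 156) (0≤inv 155)
        (Ratio.ratio n L ℓ m 3≤n 1≤L 2^L≤n n<2^ L<2^ℓ 2^ℓ≤2L fine)

-- Assembly of the approximation guarantee.

open import Data.Vec using (toList)
import Data.Nat as ℕ
import Data.Nat.Properties as ℕ
import Data.Rational.Properties as ℚ
open Lang using (Runs; Poly; polyᶜ; costᶜ; compile; runs-weaken)
open Algorithm using (algorithm; base)
open Solving
open Reals
open import Defs
open import Data.Nat using (ℕ)
open import Data.Rational using (ℚ; 0ℚ; _<_)

abstract

  -- The requirement (2 ^ 20) ^ 3 ≤ C₀ dominates the others. The value is opaque, so that 2 ^ 60 is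
  -- never unfolded.
  constant : ∃[ C₀ ] (1 ℕ.≤ C₀ × 128 ℕ.* (128 ℕ.* 128) ℕ.* 384 ℕ.* 2 ℕ.≤ C₀ × (∀ N → N ≡ 2 ℕ.^ 20 → N ℕ.* (N ℕ.* N) ℕ.≤ C₀))
  constant = 2 ℕ.^ 60 , ℕ.≤ᵇ⇒≤ 1 (2 ℕ.^ 60) _ , ℕ.≤ᵇ⇒≤ (128 ℕ.* (128 ℕ.* 128) ℕ.* 384 ℕ.* 2) (2 ℕ.^ 60) _ ,
    λ { _ refl → ℕ.≤ᵇ⇒≤ (2 ℕ.^ 20 ℕ.* (2 ℕ.^ 20 ℕ.* 2 ℕ.^ 20)) (2 ℕ.^ 60) _ }

approximates : ∀ {n} (G : BipartiteGraph n) → 3 ℕ.≤ n → ∀ r →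
               Runs (compile base algorithm) (input G) r (costᶜ algorithm n)
                 (λ ν → IsApproximateMBB (ratioBound (Bound.C (proj₁ constant)) n) G (outputU n ν) (outputV n ν))
approximates {n} G 3≤n r = from (logarithms n 3≤n) (proj₂ constant)
  where
  C₀ : ℕ
  C₀ = proj₁ constant
  0<n : 0 ℕ.< n
  0<n = ℕ.≤-trans (ℕ.s≤s ℕ.z≤n) 3≤n
  open Solve G 0<n using (s; module Quality)
  from : ∃[ L ] ∃[ ℓ ] (1 ℕ.≤ L × 2 ℕ.^ L ℕ.≤ n × n ℕ.< 2 ℕ.^ ℕ.suc L × L ℕ.< 2 ℕ.^ ℓ × 2 ℕ.^ ℓ ℕ.≤ 2 ℕ.* L) →
         (1 ℕ.≤ C₀ × 128 ℕ.* (128 ℕ.* 128) ℕ.* 384 ℕ.* 2 ℕ.≤ C₀ × (∀ N → N ≡ 2 ℕ.^ 20 → N ℕ.* (N ℕ.* N) ℕ.≤ C₀)) →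
         Runs (compile base algorithm) (input G) r (costᶜ algorithm n)
           (λ ν → IsApproximateMBB (ratioBound (Bound.C C₀) n) G (outputU n ν) (outputV n ν))
  from (L , ℓ , 1≤L , lo , hi , lo′ , hi′) (1≤C₀ , large , larger) = runs-weaken ℕ.≤-refl
    (λ isBiclique → s , isBiclique , Bound.bounded C₀ n L ℓ (OPT G) s 3≤n 1≤L lo hi lo′ hi′
      (Quality.quality C₀ 1≤C₀ large larger L ℓ lo lo′ hi′))
    (solves G 0<n r)

-- Success on every coin sequence makes the whole space the event, of probability 1 - 0.
randomized : ∀ {P K D ρ} →
             (∀ n → 3 ℕ.≤ n → (G : BipartiteGraph n) → ∀ r →
               Runs P (input G) r (K ℕ.* n ℕ.^ D) (λ ν → IsApproximateMBB (ρ n) G (outputU n ν) (outputV n ν))) →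
             RandomizedApproximation P K D (λ _ → 0ℚ) ρ
randomized {P} {K} {D} {ρ} runs = record
  { running-time = λ n 3≤n G r → let t , ν , t≤ , run , _ = runs n 3≤n G (toList r) in t , (ν , toList r) , t≤ , run
  ; correctness  = λ n 3≤n G → (λ _ → true) ,
      (λ r _ → let t , ν , _ , run , approximate = runs n 3≤n G (toList r) in t , ν , toList r , run , approximate) ,
      ℚ.≤-reflexive (sym (Pr-true (K ℕ.* n ℕ.^ D)))
  }

theorem1 :
    ∃[ C ] 0ℚ < C ×
    (∃[ P ] ∃[ c ] ∃[ d ] ∃[ δ ] IsVanishing δ ×
      RandomizedApproximation P c d δ
        (λ n → fromℚ C * fromℕ n * (log (log (fromℕ n)) / log (fromℕ n)) ^ 3))
theorem1 = from-poly (polyᶜ algorithm)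
  where
  C₀ : ℕ
  C₀ = proj₁ constant
  from-poly : Poly (costᶜ algorithm) →
    ∃[ C ] 0ℚ < C ×
    (∃[ P ] ∃[ c ] ∃[ d ] ∃[ δ ] IsVanishing δ ×
      RandomizedApproximation P c d δ
        (λ n → fromℚ C * fromℕ n * (log (log (fromℕ n)) / log (fromℕ n)) ^ 3))
  from-poly (K , D , cost≤) = Bound.C C₀ , Bound.0<C C₀ (proj₁ (proj₂ constant)) , compile base algorithm , K , D , (λ _ → 0ℚ) ,
    (λ ε 0<ε → 0 , λ _ _ → ℚ.<⇒≤ 0<ε) ,
    randomized λ n 3≤n G r → runs-weaken (cost≤ n (ℕ.≤-trans (ℕ.s≤s ℕ.z≤n) 3≤n)) (λ approximate → approximate) (approximates G 3≤n r)
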